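{- For every $K_3N$ $n=pqr$: (a) $C\le\mathcal C\left(\mathcal N^{ -1}(n)\right)$; (b) $ABC\le\mathcal A\left(\mathcal N^{ -1}(n)\right)\,\mathcal B\left(\mathcal N^{ -1}(n)\right)\,\mathcal C\left(\mathcal N^{ -1}(n)\right)$; with equality (in each case) if and only if $E=2$ and $F=G=1$; if there is equality then $H\not\equiv 2\pmod 6$, and if also $n$ is a $C_3N$, then $H\equiv 0\pmod 6$. For large $n$ (i.e. as $n\to\infty$ through $K_3N$'s, with $o(1)$ depending only on $n$), $C\le 2^{ -3/5}n^{2/5}(1+o(1))$ and $ABC\le 2^{ -3/10}n^{7/10}(1+o(1))$.
   Context: A $K_3N$ (Korselt number with three factors) is an integer $n$ together with a factorisation $n=pqr$, where $1<p<q<r$ are odd integers (not necessarily prime) such that each of $p-1,\ q-1,\ r-1$ divides $n-1$, and such that $E:=\dfrac{pq-1}{r-1}$ (which is an integer by the divisibility condition) satisfies $E\ge 2$. A $C_3N$ is a Carmichael number with exactly three prime factors $p<q<r$, i.e. a $K_3N$ $n=pqr$ in which $p,q,r$ are all prime. Put $H:=\gcd(p-1,q-1,r-1)$, $A:=\frac{p-1}{H}$, $B:=\frac{q-1}{H}$, $C:=\frac{r-1}{H}$, $F:=H\left(\frac1A+\frac1B+\frac1C\right)+\frac1{AB}+\frac1{AC}+\frac1{BC}$ (which is a positive integer), and $G:=AF-H$. The following polynomials are used: $\mathcal A(x):=x+1$, $\mathcal B(x):=x^2+x+3$, $\mathcal C(x):=\frac12\left(x^4+2x^3+5x^2+5x+4\right)$,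 and $$\mathcal N(x):=\tfrac12\left(x^{10}+4x^9+14x^8+30x^7+53x^6+69x^5+71x^4+55x^3+31x^2+12x+2\right).$$ $\mathcal N$ is a strictly increasing bijection from $[0,\infty)$ onto $[1,\infty)$ and $\mathcal N^{ -1}$ denotes its inverse. -}

module Defs where

open import Algebra.Bundles.Raw using (RawSemiring)
import Algebra.Definitions.RawSemiring as RawSemiringDefs
open import Data.Integer.Base as ℤ using (ℤ; +_; -[1+_])
import Data.Integer.Properties as ℤₚ
open import Data.Nat.Base as ℕ using (ℕ; zero; suc; _∸_)
open import Data.Nat.Divisibility
  using (_∣_; _∤_; ∣m+n∣m⇒∣n; n∣m*n; ∣⇒≤; ∣-trans)
open import Data.Nat.DivMod using (m/n*n≡m; m≥n⇒m/n>0)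
open import Data.Nat.GCD using (gcd; gcd[m,n]∣m; gcd[m,n]∣n; gcd[m,n]≢0)
open import Data.Nat.Primality using (Prime)
import Data.Nat.Properties as ℕₚ
open import Data.Product.Base using (∃; _×_; _,_; proj₁; proj₂)
open import Data.Rational.Base as ℚ
  using (ℚ; 0ℚ; 1ℚ; ½; _/_; ∣_∣; ↥_; ↧ₙ_; *≤*)
import Data.Rational.Properties as ℚₚ
open import Data.Rational.Unnormalised.Base as ℚᵘ using (mkℚᵘ)
import Data.Rational.Unnormalised.Properties as ℚᵘₚ
open import Data.Rational.Solver using (module +-*-Solver)
open import Data.Sum.Base using (inj₁; inj₂)
open import Level using (0ℓ)
open import Relation.Binary.PropositionalEquality
  using (_≡_; refl; sym; trans; cong; cong₂; subst; subst₂; module ≡-Reasoning)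
open import Relation.Nullary using (Dec; yes; no)

ℕ→ℚ : ℕ → ℚ
ℕ→ℚ m = + m / 1

toℚᵘ-ℕ→ℚ : ∀ m → ℚ.toℚᵘ (ℕ→ℚ m) ℚᵘ.≃ mkℚᵘ (+ m) 0
toℚᵘ-ℕ→ℚ m = ℚₚ.toℚᵘ-fromℚᵘ (mkℚᵘ (+ m) 0)

ℕ→ℚ-suc : ∀ m → ℕ→ℚ (suc m) ≡ 1ℚ ℚ.+ ℕ→ℚ m
ℕ→ℚ-suc m = ℚₚ.toℚᵘ-injective (begin
  ℚ.toℚᵘ (ℕ→ℚ (suc m))              ≈⟨ toℚᵘ-ℕ→ℚ (suc m) ⟩
  mkℚᵘ (+ suc m) 0                  ≈⟨ ℚᵘ.*≡* (cong (λ k → (+ 1 ℤ.+ k) ℤ.* + 1) (sym (ℤₚ.*-identityʳ (+ m)))) ⟩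
  mkℚᵘ (+ 1) 0 ℚᵘ.+ mkℚᵘ (+ m) 0    ≈⟨ ℚᵘₚ.+-congʳ (mkℚᵘ (+ 1) 0) (ℚᵘₚ.≃-sym (toℚᵘ-ℕ→ℚ m)) ⟩
  ℚ.toℚᵘ 1ℚ ℚᵘ.+ ℚ.toℚᵘ (ℕ→ℚ m)     ≈⟨ ℚₚ.toℚᵘ-homo-+ 1ℚ (ℕ→ℚ m) ⟨
  ℚ.toℚᵘ (1ℚ ℚ.+ ℕ→ℚ m)             ∎)
  where
  open import Relation.Binary.Reasoning.Setoid ℚᵘₚ.≃-setoid

0≤ℕ→ℚ : ∀ m → 0ℚ ℚ.≤ ℕ→ℚ m
0≤ℕ→ℚ zero    = ℚₚ.≤-refl
0≤ℕ→ℚ (suc m) = subst (0ℚ ℚ.≤_) (sym (ℕ→ℚ-suc m))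
  (ℚₚ.+-mono-≤ {0ℚ} {1ℚ} (*≤* (ℤ.+≤+ ℕ.z≤n)) (0≤ℕ→ℚ m))

archimedean : ∀ a → ∃ λ m → a ℚ.≤ ℕ→ℚ m
archimedean (ℚ.mkℚ (+ m) d c) = m , ℚₚ.toℚᵘ-cancel-≤
  (ℚᵘₚ.≤-respʳ-≃ (ℚᵘₚ.≃-sym (toℚᵘ-ℕ→ℚ m))
    (ℚᵘ.*≤* (ℤₚ.*-monoˡ-≤-nonNeg (+ m) (ℤ.+≤+ (ℕ.s≤s (ℕ.z≤n {d}))))))
archimedean (ℚ.mkℚ (-[1+ m ]) d c) = 0 , *≤* ℤ.-≤+

½ε+½ε≡ε : ∀ ε → ½ ℚ.* ε ℚ.+ ½ ℚ.* ε ≡ ε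
½ε+½ε≡ε ε = trans (sym (ℚₚ.*-distribʳ-+ ε ½ ½)) (ℚₚ.*-identityˡ ε)

0<½ε : ∀ {ε} → 0ℚ ℚ.< ε → 0ℚ ℚ.< ½ ℚ.* ε
0<½ε {ε} 0<ε = ℚₚ.positive⁻¹ (½ ℚ.* ε) {{ℚₚ.pos*pos⇒pos ½ ε {{ℚ.positive 0<ε}}}}

0≤* : ∀ {a b} → 0ℚ ℚ.≤ a → 0ℚ ℚ.≤ b → 0ℚ ℚ.≤ a ℚ.* b
0≤* {a} {b} 0≤a 0≤b = ℚₚ.nonNegative⁻¹ (a ℚ.* b)
  {{ℚₚ.nonNeg*nonNeg⇒nonNeg a {{ℚ.nonNegative 0≤a}} b {{ℚ.nonNegative 0≤b}}}}

0≤+ : ∀ {a b} → 0ℚ ℚ.≤ a → 0ℚ ℚ.≤ b → 0ℚ ℚ.≤ a ℚ.+ b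
0≤+ 0≤a 0≤b = ℚₚ.+-mono-≤ 0≤a 0≤b

p≤r+p : ∀ {p r} → 0ℚ ℚ.≤ r → p ℚ.≤ r ℚ.+ p
p≤r+p {p} {r} 0≤r = subst (ℚ._≤ r ℚ.+ p) (ℚₚ.+-identityˡ p) (ℚₚ.+-monoˡ-≤ p 0≤r)

*-mono-≤ : ∀ {a b c d} → 0ℚ ℚ.≤ a → 0ℚ ℚ.≤ d →
           a ℚ.≤ c → b ℚ.≤ d → a ℚ.* b ℚ.≤ c ℚ.* d
*-mono-≤ {a} {b} {c} {d} 0≤a 0≤d a≤c b≤d = ℚₚ.≤-trans
  (ℚₚ.*-monoˡ-≤-nonNeg a {{ℚ.nonNegative 0≤a}} b≤d)
  (ℚₚ.*-monoʳ-≤-nonNeg d {{ℚ.nonNegative 0≤d}} a≤c)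

p≤∣p∣ : ∀ p → p ℚ.≤ ∣ p ∣
p≤∣p∣ p with ℚₚ.≤-total 0ℚ p
... | inj₁ 0≤p = ℚₚ.≤-reflexive (sym (ℚₚ.0≤p⇒∣p∣≡p 0≤p))
... | inj₂ p≤0 = ℚₚ.≤-trans p≤0 (ℚₚ.0≤∣p∣ p)

∣p-q∣≡∣q-p∣ : ∀ p q → ∣ p ℚ.- q ∣ ≡ ∣ q ℚ.- p ∣
∣p-q∣≡∣q-p∣ p q = trans
  (cong ∣_∣ (solve 2 (λ p q → p :- q := :- (q :- p)) refl p q))
  (ℚₚ.∣-p∣≡∣p∣ (q ℚ.- p))
  where
  open +-*-Solver

0<1+∣p∣ : ∀ p → 0ℚ ℚ.< 1ℚ ℚ.+ ∣ p ∣
0<1+∣p∣ p = ℚₚ.+-mono-<-≤ (ℚₚ.positive⁻¹ 1ℚ) (ℚₚ.0≤∣p∣ p)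

-- Two points of [l , u] are at distance at most u - l.
∣a-b∣≤u-l : ∀ {a b l u} → l ℚ.≤ a → a ℚ.≤ u → l ℚ.≤ b → b ℚ.≤ u →
            ∣ a ℚ.- b ∣ ℚ.≤ u ℚ.- l
∣a-b∣≤u-l {a} {b} {l} {u} l≤a a≤u l≤b b≤u with ℚₚ.∣p∣≡p∨∣p∣≡-p (a ℚ.- b)
... | inj₁ eq = subst (ℚ._≤ u ℚ.- l) (sym eq)
                  (ℚₚ.+-mono-≤ a≤u (ℚₚ.neg-antimono-≤ l≤b))
... | inj₂ eq = subst (ℚ._≤ u ℚ.- l)
                  (sym (trans eq (solve 2 (λ a b → :- (a :- b) := b :- a) refl a b)))
                  (ℚₚ.+-mono-≤ b≤u (ℚₚ.neg-antimono-≤ l≤a))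
  where
  open +-*-Solver

∣[a+b]-[c+d]∣≤ : ∀ {a b c d ε} → ∣ a ℚ.- c ∣ ℚ.≤ ½ ℚ.* ε → ∣ b ℚ.- d ∣ ℚ.≤ ½ ℚ.* ε →
                 ∣ (a ℚ.+ b) ℚ.- (c ℚ.+ d) ∣ ℚ.≤ ε
∣[a+b]-[c+d]∣≤ {a} {b} {c} {d} {ε} h k = begin
  ∣ (a ℚ.+ b) ℚ.- (c ℚ.+ d) ∣   ≡⟨ cong ∣_∣ (solve 4 (λ a b c d →
                                     (a :+ b) :- (c :+ d) := (a :- c) :+ (b :- d)) refl a b c d) ⟩
  ∣ (a ℚ.- c) ℚ.+ (b ℚ.- d) ∣   ≤⟨ ℚₚ.∣p+q∣≤∣p∣+∣q∣ (a ℚ.- c) (b ℚ.- d) ⟩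
  ∣ a ℚ.- c ∣ ℚ.+ ∣ b ℚ.- d ∣   ≤⟨ ℚₚ.+-mono-≤ h k ⟩
  ½ ℚ.* ε ℚ.+ ½ ℚ.* ε           ≡⟨ ½ε+½ε≡ε ε ⟩
  ε                             ∎
  where
  open ℚₚ.≤-Reasoning
  open +-*-Solver

∣ab-cd∣≤ : ∀ {a b c d M M′ δ δ′ ε} → ∣ a ∣ ℚ.≤ M → ∣ d ∣ ℚ.≤ M′ →
           M ℚ.* δ ℚ.≤ ½ ℚ.* ε → M′ ℚ.* δ′ ℚ.≤ ½ ℚ.* ε → 0ℚ ℚ.≤ δ → 0ℚ ℚ.≤ δ′ →
           ∣ b ℚ.- d ∣ ℚ.≤ δ → ∣ a ℚ.- c ∣ ℚ.≤ δ′ →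
           ∣ a ℚ.* b ℚ.- c ℚ.* d ∣ ℚ.≤ ε
∣ab-cd∣≤ {a} {b} {c} {d} {M} {M′} {δ} {δ′} {ε} a≤ d≤ Mδ M′δ′ 0≤δ 0≤δ′ b-d a-c = begin
  ∣ a ℚ.* b ℚ.- c ℚ.* d ∣
    ≡⟨ cong ∣_∣ (solve 4 (λ a b c d →
         (a :* b) :- (c :* d) := (a :* (b :- d)) :+ (d :* (a :- c))) refl a b c d) ⟩
  ∣ a ℚ.* (b ℚ.- d) ℚ.+ d ℚ.* (a ℚ.- c) ∣
    ≤⟨ ℚₚ.∣p+q∣≤∣p∣+∣q∣ (a ℚ.* (b ℚ.- d)) (d ℚ.* (a ℚ.- c)) ⟩
  ∣ a ℚ.* (b ℚ.- d) ∣ ℚ.+ ∣ d ℚ.* (a ℚ.- c) ∣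
    ≡⟨ cong₂ ℚ._+_ (ℚₚ.∣p*q∣≡∣p∣*∣q∣ a (b ℚ.- d)) (ℚₚ.∣p*q∣≡∣p∣*∣q∣ d (a ℚ.- c)) ⟩
  ∣ a ∣ ℚ.* ∣ b ℚ.- d ∣ ℚ.+ ∣ d ∣ ℚ.* ∣ a ℚ.- c ∣
    ≤⟨ ℚₚ.+-mono-≤ (*-mono-≤ (ℚₚ.0≤∣p∣ a) 0≤δ a≤ b-d) (*-mono-≤ (ℚₚ.0≤∣p∣ d) 0≤δ′ d≤ a-c) ⟩
  M ℚ.* δ ℚ.+ M′ ℚ.* δ′
    ≤⟨ ℚₚ.+-mono-≤ Mδ M′δ′ ⟩
  ½ ℚ.* ε ℚ.+ ½ ℚ.* ε
    ≡⟨ ½ε+½ε≡ε ε ⟩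
  ε ∎
  where
  open ℚₚ.≤-Reasoning
  open +-*-Solver

divide : ∀ M ε → 0ℚ ℚ.< M → 0ℚ ℚ.< ε → ∃ λ δ → 0ℚ ℚ.< δ × M ℚ.* δ ≡ ε
divide M ε 0<M 0<ε = 1/M ℚ.* ε ,
  ℚₚ.positive⁻¹ (1/M ℚ.* ε) {{ℚₚ.pos*pos⇒pos 1/M {{ℚₚ.1/pos⇒pos M}} ε}} ,
  trans (sym (ℚₚ.*-assoc M 1/M ε)) (trans (cong (ℚ._* ε) (ℚₚ.*-inverseʳ M)) (ℚₚ.*-identityˡ ε))
  where
  instance
    posM = ℚ.positive 0<M
    posε = ℚ.positive 0<ε
    nzM  = ℚₚ.pos⇒nonZero M
  1/M = ℚ.1/ M

-- A real number is a Cauchy sequence of rationals; _≃_ is its equality.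

IsCauchy : (ℕ → ℚ) → Set
IsCauchy s = ∀ ε → 0ℚ ℚ.< ε → ∃ λ N → ∀ m n → N ℕ.≤ m → N ℕ.≤ n → ∣ s m ℚ.- s n ∣ ℚ.≤ ε

record ℝ : Set where
  no-eta-equality
  field
    seq      : ℕ → ℚ
    isCauchy : IsCauchy seq

open ℝ public

infix 4 _≃_ _≤ᴿ_

_≃_ : ℝ → ℝ → Set
x ≃ y = ∀ ε → 0ℚ ℚ.< ε → ∃ λ N → ∀ n → N ℕ.≤ n → ∣ seq x n ℚ.- seq y n ∣ ℚ.≤ ε

_≤ᴿ_ : ℝ → ℝ → Set
x ≤ᴿ y = ∀ ε → 0ℚ ℚ.< ε → ∃ λ N → ∀ n → N ℕ.≤ n → seq x n ℚ.≤ seq y n ℚ.+ ε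

ℚ→ℝ : ℚ → ℝ
ℚ→ℝ a .seq      _     = a
ℚ→ℝ a .isCauchy ε 0<ε = 0 , λ _ _ _ _ →
  subst (ℚ._≤ ε) (sym (cong ∣_∣ (ℚₚ.+-inverseʳ a))) (ℚₚ.<⇒≤ 0<ε)

ℕ→ℝ : ℕ → ℝ
ℕ→ℝ m = ℚ→ℝ (ℕ→ℚ m)

eventually-bounded : ∀ x → ∃ λ N → ∃ λ M → 0ℚ ℚ.< M × (∀ n → N ℕ.≤ n → ∣ seq x n ∣ ℚ.≤ M)
eventually-bounded x =
  let N , h = isCauchy x 1ℚ (ℚₚ.positive⁻¹ 1ℚ)
      a     = seq x N
  in N , 1ℚ ℚ.+ ∣ a ∣ , 0<1+∣p∣ a , λ n N≤n → begin
    ∣ seq x n ∣                   ≡⟨ cong ∣_∣ (solve 2 (λ s a → s := (s :- a) :+ a) refl (seq x n) a) ⟩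
    ∣ (seq x n ℚ.- a) ℚ.+ a ∣     ≤⟨ ℚₚ.∣p+q∣≤∣p∣+∣q∣ (seq x n ℚ.- a) a ⟩
    ∣ seq x n ℚ.- a ∣ ℚ.+ ∣ a ∣   ≤⟨ ℚₚ.+-monoˡ-≤ ∣ a ∣ (h n N N≤n ℕₚ.≤-refl) ⟩
    1ℚ ℚ.+ ∣ a ∣                  ∎
  where
  open ℚₚ.≤-Reasoning
  open +-*-Solver

infixl 6 _+ᴿ_
infixl 7 _*ᴿ_

_+ᴿ_ : ℝ → ℝ → ℝ
(x +ᴿ y) .seq n = seq x n ℚ.+ seq y n
(x +ᴿ y) .isCauchy ε 0<ε =
  let N  , h  = isCauchy x (½ ℚ.* ε) (0<½ε 0<ε)
      N′ , h′ = isCauchy y (½ ℚ.* ε) (0<½ε 0<ε)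
  in N ℕ.⊔ N′ , λ m n m≥ n≥ → ∣[a+b]-[c+d]∣≤ {seq x m}
       (h  m n (ℕₚ.m⊔n≤o⇒m≤o N N′ m≥) (ℕₚ.m⊔n≤o⇒m≤o N N′ n≥))
       (h′ m n (ℕₚ.m⊔n≤o⇒n≤o N N′ m≥) (ℕₚ.m⊔n≤o⇒n≤o N N′ n≥))

_*ᴿ_ : ℝ → ℝ → ℝ
(x *ᴿ y) .seq n = seq x n ℚ.* seq y n
(x *ᴿ y) .isCauchy ε 0<ε =
  let K  , M  , 0<M  , b  = eventually-bounded x
      K′ , M′ , 0<M′ , b′ = eventually-bounded y
      δ  , 0<δ  , Mδ      = divide M  (½ ℚ.* ε) 0<M  (0<½ε 0<ε)
      δ′ , 0<δ′ , Mδ′     = divide M′ (½ ℚ.* ε) 0<M′ (0<½ε 0<ε)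
      N  , h              = isCauchy y δ  0<δ
      N′ , h′             = isCauchy x δ′ 0<δ′
      L                   = K ℕ.⊔ K′
      L′                  = N ℕ.⊔ N′
      K≤   = λ {m} (m≥ : L ℕ.⊔ L′ ℕ.≤ m) → ℕₚ.m⊔n≤o⇒m≤o K K′ (ℕₚ.m⊔n≤o⇒m≤o L L′ m≥)
      K′≤  = λ {m} (m≥ : L ℕ.⊔ L′ ℕ.≤ m) → ℕₚ.m⊔n≤o⇒n≤o K K′ (ℕₚ.m⊔n≤o⇒m≤o L L′ m≥)
      N≤   = λ {m} (m≥ : L ℕ.⊔ L′ ℕ.≤ m) → ℕₚ.m⊔n≤o⇒m≤o N N′ (ℕₚ.m⊔n≤o⇒n≤o L L′ m≥)
      N′≤  = λ {m} (m≥ : L ℕ.⊔ L′ ℕ.≤ m) → ℕₚ.m⊔n≤o⇒n≤o N N′ (ℕₚ.m⊔n≤o⇒n≤o L L′ m≥)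
  in L ℕ.⊔ L′ , λ m n m≥ n≥ → ∣ab-cd∣≤ {seq x m} {seq y m} {seq x n} {seq y n}
       (b m (K≤ m≥)) (b′ n (K′≤ n≥)) (ℚₚ.≤-reflexive Mδ) (ℚₚ.≤-reflexive Mδ′)
       (ℚₚ.<⇒≤ 0<δ) (ℚₚ.<⇒≤ 0<δ′)
       (h m n (N≤ m≥) (N≤ n≥)) (h′ m n (N′≤ m≥) (N′≤ n≥))

≃-refl : ∀ {x} → x ≃ x
≃-refl {x} ε 0<ε = 0 , λ n _ →
  subst (ℚ._≤ ε) (sym (cong ∣_∣ (ℚₚ.+-inverseʳ (seq x n)))) (ℚₚ.<⇒≤ 0<ε)

+ᴿ-cong : ∀ {x x′ y y′} → x ≃ x′ → y ≃ y′ → x +ᴿ y ≃ x′ +ᴿ y′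
+ᴿ-cong {x} x≃x′ y≃y′ ε 0<ε =
  let N  , h  = x≃x′ (½ ℚ.* ε) (0<½ε 0<ε)
      N′ , h′ = y≃y′ (½ ℚ.* ε) (0<½ε 0<ε)
  in N ℕ.⊔ N′ , λ n n≥ → ∣[a+b]-[c+d]∣≤ {seq x n}
       (h n (ℕₚ.m⊔n≤o⇒m≤o N N′ n≥)) (h′ n (ℕₚ.m⊔n≤o⇒n≤o N N′ n≥))

*ᴿ-cong : ∀ {x x′ y y′} → x ≃ x′ → y ≃ y′ → x *ᴿ y ≃ x′ *ᴿ y′
*ᴿ-cong {x} {x′} {y} {y′} x≃x′ y≃y′ ε 0<ε =
  let K  , M  , 0<M  , b  = eventually-bounded x
      K′ , M′ , 0<M′ , b′ = eventually-bounded y′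
      δ  , 0<δ  , Mδ      = divide M  (½ ℚ.* ε) 0<M  (0<½ε 0<ε)
      δ′ , 0<δ′ , Mδ′     = divide M′ (½ ℚ.* ε) 0<M′ (0<½ε 0<ε)
      N  , h              = y≃y′ δ  0<δ
      N′ , h′             = x≃x′ δ′ 0<δ′
      L                   = K ℕ.⊔ K′
      L′                  = N ℕ.⊔ N′
  in L ℕ.⊔ L′ , λ n n≥ →
       let n≥L  = ℕₚ.m⊔n≤o⇒m≤o L L′ n≥
           n≥L′ = ℕₚ.m⊔n≤o⇒n≤o L L′ n≥
       in ∣ab-cd∣≤ {seq x n} {seq y n} {seq x′ n} {seq y′ n}
            (b n (ℕₚ.m⊔n≤o⇒m≤o K K′ n≥L)) (b′ n (ℕₚ.m⊔n≤o⇒n≤o K K′ n≥L))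
            (ℚₚ.≤-reflexive Mδ) (ℚₚ.≤-reflexive Mδ′) (ℚₚ.<⇒≤ 0<δ) (ℚₚ.<⇒≤ 0<δ′)
            (h n (ℕₚ.m⊔n≤o⇒m≤o N N′ n≥L′)) (h′ n (ℕₚ.m⊔n≤o⇒n≤o N N′ n≥L′))

ℝ-rawSemiring : RawSemiring 0ℓ 0ℓ
ℝ-rawSemiring = record
  { Carrier = ℝ ; _≈_ = _≃_ ; _+_ = _+ᴿ_ ; _*_ = _*ᴿ_ ; 0# = ℚ→ℝ 0ℚ ; 1# = ℚ→ℝ 1ℚ }

Vanishes : (ℕ → ℝ) → Set
Vanishes δ = ∀ ε → 0ℚ ℚ.< ε → ∃ λ N → ∀ n → N ℕ.≤ n →
  ℚ→ℝ (ℚ.- ε) ≤ᴿ δ n × δ n ≤ᴿ ℚ→ℝ ε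

-- Stated over a semiring with a chosen element ½, since 𝒩 is needed
-- over ℝ and also over ℚ, to construct its inverse by bisection.  Here
-- m · x is the m-fold sum x + ⋯ + x.

module Polynomials {c ℓ} (R : RawSemiring c ℓ) (half : RawSemiring.Carrier R) where
  open RawSemiring R
  open RawSemiringDefs R using (_^_) renaming (_×_ to infixr 8 _·_)

  𝒜 ℬ 𝒞 𝒩 : Carrier → Carrier
  𝒜 x = x + 1#
  ℬ x = x ^ 2 + x + 3 · 1#
  𝒞 x = half * (x ^ 4 + 2 · x ^ 3 + 5 · x ^ 2 + 5 · x + 4 · 1#)
  𝒩 x = half * (x ^ 10 + 4 · x ^ 9 + 14 · x ^ 8 + 30 · x ^ 7 + 53 · x ^ 6 + 69 · x ^ 5
                 + 71 · x ^ 4 + 55 · x ^ 3 + 31 · x ^ 2 + 12 · x + 2 · 1#)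

module ℚ-Polynomials = Polynomials ℚ.+-*-rawSemiring ½
open Polynomials ℝ-rawSemiring (ℚ→ℝ ½) public
open RawSemiringDefs ℝ-rawSemiring public using () renaming (_^_ to infixr 8 _^ᴿ_; _×_ to infixr 8 _·ᴿ_)
open RawSemiringDefs ℚ.+-*-rawSemiring public using () renaming (_^_ to infixr 8 _^ᵠ_; _×_ to infixr 8 _·ᵠ_)

-- g is the continuous extension of f, computed termwise.
record Lifts (g : ℝ → ℝ) (f : ℚ → ℚ) : Set where
  field
    g-cong    : ∀ {x y} → x ≃ y → g x ≃ g y
    pointwise : ∀ x n → seq (g x) n ≡ f (seq x n)

open Lifts

lifts-id : Lifts (λ x → x) (λ q → q)
lifts-id .g-cong    x≃y = x≃y
lifts-id .pointwise _ _ = refl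

lifts-const : ∀ a → Lifts (λ _ → ℚ→ℝ a) (λ _ → a)
lifts-const a .g-cong    _   = ≃-refl {ℚ→ℝ a}
lifts-const a .pointwise _ _ = refl

lifts-+ : ∀ {g f h e} → Lifts g f → Lifts h e → Lifts (λ x → g x +ᴿ h x) (λ q → f q ℚ.+ e q)
lifts-+ {g} {h = h} G H .g-cong {x} {y} x≃y =
  +ᴿ-cong {g x} {g y} {h x} {h y} (G .g-cong x≃y) (H .g-cong x≃y)
lifts-+ G H .pointwise x n = cong₂ ℚ._+_ (G .pointwise x n) (H .pointwise x n)

lifts-* : ∀ {g f h e} → Lifts g f → Lifts h e → Lifts (λ x → g x *ᴿ h x) (λ q → f q ℚ.* e q)
lifts-* {g} {h = h} G H .g-cong {x} {y} x≃y =
  *ᴿ-cong {g x} {g y} {h x} {h y} (G .g-cong x≃y) (H .g-cong x≃y)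
lifts-* G H .pointwise x n = cong₂ ℚ._*_ (G .pointwise x n) (H .pointwise x n)

lifts-^ : ∀ k {g f} → Lifts g f → Lifts (λ x → g x ^ᴿ k) (λ q → f q ^ᵠ k)
lifts-^ zero    G = lifts-const 1ℚ
lifts-^ (suc k) G = lifts-* G (lifts-^ k G)

lifts-· : ∀ k {g f} → Lifts g f → Lifts (λ x → k ·ᴿ g x) (λ q → k ·ᵠ f q)
lifts-· zero    G = lifts-const 0ℚ
lifts-· (suc k) G = lifts-+ G (lifts-· k G)

lifts-𝒩 : Lifts 𝒩 ℚ-Polynomials.𝒩
lifts-𝒩 = lifts-* (lifts-const ½) (lifts-+ (lifts-+ (lifts-+ (lifts-+ (lifts-+ (lifts-+
  (lifts-+ (lifts-+ (lifts-+ (lifts-+ (pow 10) (4 ·x^ 9)) (14 ·x^ 8)) (30 ·x^ 7)) (53 ·x^ 6))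
  (69 ·x^ 5)) (71 ·x^ 4)) (55 ·x^ 3)) (31 ·x^ 2)) (lifts-· 12 lifts-id))
  (lifts-· 2 (lifts-const 1ℚ)))
  where
  pow : ∀ k → Lifts (_^ᴿ k) (_^ᵠ k)
  pow k = lifts-^ k lifts-id
  _·x^_ : ∀ m k → Lifts (λ x → m ·ᴿ x ^ᴿ k) (λ q → m ·ᵠ q ^ᵠ k)
  m ·x^ k = lifts-· m (pow k)

-- For f : ℚ → ℚ increasing and continuous on [0, ∞) with
-- f 0 ≤ t ≤ f (1 + ∣t∣), solution is the real x ≥ 0 with f x = t,
-- found by bisecting [0, 1 + ∣t∣].

module Bisection (f : ℚ → ℚ) (t : ℚ) where

  mid : ℚ → ℚ → ℚ
  mid l u = ½ ℚ.* (l ℚ.+ u)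

  choose : ∀ l u → Dec (f (mid l u) ℚ.≤ t) → ℚ × ℚ
  choose l u (yes _) = mid l u , u
  choose l u (no  _) = l , mid l u

  bracket : ℕ → ℚ × ℚ
  bracket zero    = 0ℚ , 1ℚ ℚ.+ ∣ t ∣
  bracket (suc n) = let l , u = bracket n in choose l u (f (mid l u) ℚₚ.≤? t)

  lo hi : ℕ → ℚ
  lo n = proj₁ (bracket n)
  hi n = proj₂ (bracket n)

  Shrinks : ℚ × ℚ → ℚ × ℚ → Set
  Shrinks (l , u) (l′ , u′) =
    l′ ℚ.≤ u′ × l ℚ.≤ l′ × u′ ℚ.≤ u × u′ ℚ.- l′ ≡ ½ ℚ.* (u ℚ.- l)

  l≤mid : ∀ {l u} → l ℚ.≤ u → l ℚ.≤ mid l u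
  l≤mid {l} {u} l≤u = subst (ℚ._≤ mid l u) (trans (ℚₚ.*-distribˡ-+ ½ l l) (½ε+½ε≡ε l))
    (ℚₚ.*-monoˡ-≤-nonNeg ½ (ℚₚ.+-monoʳ-≤ l l≤u))

  mid≤u : ∀ {l u} → l ℚ.≤ u → mid l u ℚ.≤ u
  mid≤u {l} {u} l≤u = subst (mid l u ℚ.≤_) (trans (ℚₚ.*-distribˡ-+ ½ u u) (½ε+½ε≡ε u))
    (ℚₚ.*-monoˡ-≤-nonNeg ½ (ℚₚ.+-monoˡ-≤ u l≤u))

  choose-shrinks : ∀ l u d → l ℚ.≤ u → Shrinks (l , u) (choose l u d)
  choose-shrinks l u (yes _) l≤u = mid≤u l≤u , l≤mid l≤u , ℚₚ.≤-refl ,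
    solve 2 (λ l u → u :- con ½ :* (l :+ u) := con ½ :* (u :- l)) refl l u
    where
    open +-*-Solver
  choose-shrinks l u (no  _) l≤u = l≤mid l≤u , ℚₚ.≤-refl , mid≤u l≤u ,
    solve 2 (λ l u → con ½ :* (l :+ u) :- l := con ½ :* (u :- l)) refl l u
    where
    open +-*-Solver

  shrinks : ∀ n → lo n ℚ.≤ hi n → Shrinks (bracket n) (bracket (suc n))
  shrinks n = choose-shrinks (lo n) (hi n) (f (mid (lo n) (hi n)) ℚₚ.≤? t)

  lo≤hi : ∀ n → lo n ℚ.≤ hi n
  lo≤hi zero    = ℚₚ.<⇒≤ (0<1+∣p∣ t)
  lo≤hi (suc n) = proj₁ (shrinks n (lo≤hi n))

  nested′ : ∀ {m n} → m ℕ.≤′ n → lo m ℚ.≤ lo n × hi n ℚ.≤ hi m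
  nested′ ℕ.≤′-refl                     = ℚₚ.≤-refl , ℚₚ.≤-refl
  nested′ {n = suc n} (ℕ.≤′-step m≤n) =
    let l , h = nested′ m≤n ; _ , l′ , h′ , _ = shrinks n (lo≤hi n)
    in ℚₚ.≤-trans l l′ , ℚₚ.≤-trans h′ h

  nested : ∀ {m n} → m ℕ.≤ n → lo m ℚ.≤ lo n × hi n ℚ.≤ hi m
  nested m≤n = nested′ (ℕₚ.≤⇒≤′ m≤n)

  width : ∀ n → ℕ→ℚ (suc n) ℚ.* (hi n ℚ.- lo n) ℚ.≤ hi 0 ℚ.- lo 0
  width zero    = ℚₚ.≤-reflexive (ℚₚ.*-identityˡ (hi 0 ℚ.- lo 0))
  width (suc n) = begin
    ℕ→ℚ (suc (suc n)) ℚ.* (hi (suc n) ℚ.- lo (suc n))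
      ≡⟨ cong₂ ℚ._*_ (ℕ→ℚ-suc (suc n)) (proj₂ (proj₂ (proj₂ (shrinks n (lo≤hi n))))) ⟩
    (1ℚ ℚ.+ N) ℚ.* (½ ℚ.* w)
      ≤⟨ ℚₚ.*-monoʳ-≤-nonNeg (½ ℚ.* w) {{ℚ.nonNegative (0≤* {½} (ℚₚ.<⇒≤ (ℚₚ.positive⁻¹ ½)) 0≤w)}}
           (ℚₚ.+-monoˡ-≤ N 1≤N) ⟩
    (N ℚ.+ N) ℚ.* (½ ℚ.* w)
      ≡⟨ solve 2 (λ N w → (N :+ N) :* (con ½ :* w) := N :* w) refl N w ⟩
    N ℚ.* w
      ≤⟨ width n ⟩
    hi 0 ℚ.- lo 0 ∎
    where
    open ℚₚ.≤-Reasoning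
    open +-*-Solver
    N = ℕ→ℚ (suc n)
    w = hi n ℚ.- lo n
    0≤w : 0ℚ ℚ.≤ w
    0≤w = subst (ℚ._≤ w) (ℚₚ.+-inverseʳ (lo n)) (ℚₚ.+-monoˡ-≤ (ℚ.- lo n) (lo≤hi n))
    1≤N : 1ℚ ℚ.≤ N
    1≤N = subst (1ℚ ℚ.≤_) (sym (ℕ→ℚ-suc n)) (ℚₚ.+-monoʳ-≤ 1ℚ (0≤ℕ→ℚ n))

  narrow : ∀ ε → 0ℚ ℚ.< ε → ∃ λ n → hi n ℚ.- lo n ℚ.≤ ε
  narrow ε 0<ε = n , ℚₚ.*-cancelˡ-≤-pos N {{posN}} (begin
    N ℚ.* (hi n ℚ.- lo n)   ≤⟨ width n ⟩
    hi 0 ℚ.- lo 0           ≡⟨ εa≡w ⟨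
    ε ℚ.* a                 ≤⟨ ℚₚ.*-monoˡ-≤-nonNeg ε {{ℚ.nonNegative (ℚₚ.<⇒≤ 0<ε)}}
                                 (ℚₚ.≤-trans a≤n (ℚₚ.<⇒≤ n<N)) ⟩
    ε ℚ.* N                 ≡⟨ ℚₚ.*-comm ε N ⟩
    N ℚ.* ε                 ∎)
    where
    open ℚₚ.≤-Reasoning
    0<w : 0ℚ ℚ.< hi 0 ℚ.- lo 0
    0<w = subst (0ℚ ℚ.<_) (sym (ℚₚ.+-identityʳ (hi 0))) (0<1+∣p∣ t)
    quot = divide ε (hi 0 ℚ.- lo 0) 0<ε 0<w
    a    = proj₁ quot
    εa≡w = proj₂ (proj₂ quot)
    n    = proj₁ (archimedean a)
    a≤n  = proj₂ (archimedean a)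
    N    = ℕ→ℚ (suc n)
    n<N : ℕ→ℚ n ℚ.< N
    n<N = subst₂ ℚ._<_ (ℚₚ.+-identityˡ (ℕ→ℚ n)) (sym (ℕ→ℚ-suc n))
            (ℚₚ.+-monoˡ-< (ℕ→ℚ n) (ℚₚ.positive⁻¹ 1ℚ))
    posN = ℚ.positive (ℚₚ.≤-<-trans (0≤ℕ→ℚ n) n<N)

  within : ∀ {N n} → N ℕ.≤ n →
           (lo N ℚ.≤ lo n × lo n ℚ.≤ hi N) × (lo N ℚ.≤ hi n × hi n ℚ.≤ hi N)
  within {N} {n} N≤n = let l , h = nested N≤n in
    (l , ℚₚ.≤-trans (lo≤hi n) h) , (ℚₚ.≤-trans l (lo≤hi n) , h)

  solution upper : ℝ
  solution .seq      = lo
  solution .isCauchy ε 0<ε = let N , w≤ε = narrow ε 0<ε in N , λ m n N≤m N≤n →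
    let (a , b) , _ = within N≤m ; (c , d) , _ = within N≤n
    in ℚₚ.≤-trans (∣a-b∣≤u-l a b c d) w≤ε
  upper .seq      = hi
  upper .isCauchy ε 0<ε = let N , w≤ε = narrow ε 0<ε in N , λ m n N≤m N≤n →
    let _ , (a , b) = within N≤m ; _ , (c , d) = within N≤n
    in ℚₚ.≤-trans (∣a-b∣≤u-l a b c d) w≤ε

  solution≃upper : solution ≃ upper
  solution≃upper ε 0<ε = let N , w≤ε = narrow ε 0<ε in N , λ n N≤n →
    let (a , b) , (c , d) = within N≤n
    in ℚₚ.≤-trans (∣a-b∣≤u-l a b c d) w≤ε

  0≤solution : ℚ→ℝ 0ℚ ≤ᴿ solution
  0≤solution ε 0<ε = 0 , λ n _ → ℚₚ.+-mono-≤ (proj₁ (nested {0} {n} ℕ.z≤n)) (ℚₚ.<⇒≤ 0<ε)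

  module _ (f0≤t : f 0ℚ ℚ.≤ t) (t≤f : t ℚ.≤ f (1ℚ ℚ.+ ∣ t ∣)) where

    choose-brackets : ∀ l u d → f l ℚ.≤ t → t ℚ.≤ f u →
      f (proj₁ (choose l u d)) ℚ.≤ t × t ℚ.≤ f (proj₂ (choose l u d))
    choose-brackets l u (yes fm≤t) _    t≤fu = fm≤t , t≤fu
    choose-brackets l u (no  fm≰t) fl≤t _    = fl≤t , ℚₚ.<⇒≤ (ℚₚ.≰⇒> fm≰t)

    brackets : ∀ n → f (lo n) ℚ.≤ t × t ℚ.≤ f (hi n)
    brackets zero    = f0≤t , t≤f
    brackets (suc n) = let a , b = brackets n in
      choose-brackets (lo n) (hi n) (f (mid (lo n) (hi n)) ℚₚ.≤? t) a b

    solves : ∀ {g} → Lifts g f → g solution ≃ ℚ→ℝ t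
    solves {g} L ε 0<ε = let N , h = Lifts.g-cong L solution≃upper ε 0<ε in N , λ n N≤n →
      let a , b = brackets n
          l = f (lo n)
          u = f (hi n)
      in begin
        ∣ seq (g solution) n ℚ.- t ∣                    ≡⟨ cong (λ s → ∣ s ℚ.- t ∣) (Lifts.pointwise L solution n) ⟩
        ∣ l ℚ.- t ∣                                     ≤⟨ ∣a-b∣≤u-l ℚₚ.≤-refl (ℚₚ.≤-trans a b) a b ⟩
        u ℚ.- l                                         ≤⟨ p≤∣p∣ (u ℚ.- l) ⟩
        ∣ u ℚ.- l ∣                                     ≡⟨ ∣p-q∣≡∣q-p∣ u l ⟩
        ∣ l ℚ.- u ∣                                     ≡⟨ cong₂ (λ s s′ → ∣ s ℚ.- s′ ∣) (Lifts.pointwise L solution n) (Lifts.pointwise L upper n) ⟨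
        ∣ seq (g solution) n ℚ.- seq (g upper) n ∣      ≤⟨ h n N≤n ⟩
        ε                                               ∎
      where
      open ℚₚ.≤-Reasoning

-- The inverse of 𝒩 : [0, ∞) → [1, ∞) at a natural number n ≥ 1; see
-- 0≤𝒩⁻¹ and 𝒩-𝒩⁻¹ below.  (For n = 0 it is a junk value.)

𝒩⁻¹ : ℕ → ℝ
𝒩⁻¹ n = Bisection.solution ℚ-Polynomials.𝒩 (ℕ→ℚ n)

0≤𝒩⁻¹ : ∀ n → ℚ→ℝ 0ℚ ≤ᴿ 𝒩⁻¹ n
0≤𝒩⁻¹ n = Bisection.0≤solution ℚ-Polynomials.𝒩 (ℕ→ℚ n)

𝒩-𝒩⁻¹ : ∀ n → 1 ℕ.≤ n → 𝒩 (𝒩⁻¹ n) ≃ ℕ→ℝ n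
𝒩-𝒩⁻¹ n@(suc m) _ = Bisection.solves ℚ-Polynomials.𝒩 t 1≤t t≤𝒩 {𝒩} lifts-𝒩
  where
  t   = ℕ→ℚ n
  u   = 1ℚ ℚ.+ ∣ t ∣
  0≤u = ℚₚ.<⇒≤ (0<1+∣p∣ t)
  1≤t : 1ℚ ℚ.≤ t
  1≤t = subst (1ℚ ℚ.≤_) (sym (ℕ→ℚ-suc m)) (ℚₚ.+-monoʳ-≤ 1ℚ (0≤ℕ→ℚ m))
  0≤^ : ∀ k → 0ℚ ℚ.≤ u ^ᵠ k
  0≤^ zero    = ℚₚ.<⇒≤ (ℚₚ.positive⁻¹ 1ℚ)
  0≤^ (suc k) = 0≤* 0≤u (0≤^ k)
  0≤· : ∀ k {a} → 0ℚ ℚ.≤ a → 0ℚ ℚ.≤ k ·ᵠ a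
  0≤· zero    0≤a = ℚₚ.≤-refl
  0≤· (suc k) 0≤a = 0≤+ 0≤a (0≤· k 0≤a)
  higher = u ^ᵠ 10 ℚ.+ 4 ·ᵠ u ^ᵠ 9 ℚ.+ 14 ·ᵠ u ^ᵠ 8 ℚ.+ 30 ·ᵠ u ^ᵠ 7 ℚ.+ 53 ·ᵠ u ^ᵠ 6
    ℚ.+ 69 ·ᵠ u ^ᵠ 5 ℚ.+ 71 ·ᵠ u ^ᵠ 4 ℚ.+ 55 ·ᵠ u ^ᵠ 3 ℚ.+ 31 ·ᵠ u ^ᵠ 2
  0≤higher : 0ℚ ℚ.≤ higher
  0≤higher = 0≤+ (0≤+ (0≤+ (0≤+ (0≤+ (0≤+ (0≤+ (0≤+ (0≤^ 10)
    (0≤· 4 (0≤^ 9))) (0≤· 14 (0≤^ 8))) (0≤· 30 (0≤^ 7))) (0≤· 53 (0≤^ 6)))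
    (0≤· 69 (0≤^ 5))) (0≤· 71 (0≤^ 4))) (0≤· 55 (0≤^ 3))) (0≤· 31 (0≤^ 2))
  t≤𝒩 : t ℚ.≤ ℚ-Polynomials.𝒩 u
  t≤𝒩 = begin
    t
      ≤⟨ ℚₚ.≤-trans (p≤∣p∣ t) (p≤r+p {r = 1ℚ} (ℚₚ.<⇒≤ (ℚₚ.positive⁻¹ 1ℚ))) ⟩
    u
      ≡⟨ solve 1 (λ u → u := con ½ :* (u :+ u)) refl u ⟩
    ½ ℚ.* (u ℚ.+ u)
      ≤⟨ ℚₚ.*-monoˡ-≤-nonNeg ½ (begin
           u ℚ.+ u                                  ≤⟨ ℚₚ.+-monoʳ-≤ u (begin
             u                                        ≡⟨ ℚₚ.+-identityʳ u ⟨
             u ℚ.+ 0ℚ                                 ≤⟨ ℚₚ.+-monoʳ-≤ u (0≤· 10 0≤u) ⟩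
             11 ·ᵠ u                                   ∎) ⟩
           12 ·ᵠ u                                   ≤⟨ p≤r+p 0≤higher ⟩
           higher ℚ.+ 12 ·ᵠ u                        ≡⟨ ℚₚ.+-identityʳ (higher ℚ.+ 12 ·ᵠ u) ⟨
           higher ℚ.+ 12 ·ᵠ u ℚ.+ 0ℚ                 ≤⟨ ℚₚ.+-monoʳ-≤ (higher ℚ.+ 12 ·ᵠ u)
                                                         (0≤· 2 {1ℚ} (ℚₚ.<⇒≤ (ℚₚ.positive⁻¹ 1ℚ))) ⟩
           higher ℚ.+ 12 ·ᵠ u ℚ.+ 2 ·ᵠ 1ℚ             ∎) ⟩
    ℚ-Polynomials.𝒩 u ∎
    where
    open ℚₚ.≤-Reasoning
    open +-*-Solver

-- The real y ≥ 0 with y ^ k = t, for k ≥ 1 and t ≥ 0.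
root : ℕ → ℚ → ℝ
root k t = Bisection.solution (_^ᵠ k) t

0≤root : ∀ k t → ℚ→ℝ 0ℚ ≤ᴿ root k t
0≤root k t = Bisection.0≤solution (_^ᵠ k) t

1≤^ᵠ : ∀ {a} k → 1ℚ ℚ.≤ a → 1ℚ ℚ.≤ a ^ᵠ k
1≤^ᵠ zero    1≤a = ℚₚ.≤-refl
1≤^ᵠ (suc k) 1≤a = *-mono-≤ {1ℚ} {1ℚ} 0≤1 (ℚₚ.≤-trans 0≤1 (1≤^ᵠ k 1≤a)) 1≤a (1≤^ᵠ k 1≤a)
  where 0≤1 = ℚₚ.<⇒≤ (ℚₚ.positive⁻¹ 1ℚ)

root-^ : ∀ k .{{_ : ℕ.NonZero k}} t → 0ℚ ℚ.≤ t → root k t ^ᴿ k ≃ ℚ→ℝ t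
root-^ k@(suc j) t 0≤t = Bisection.solves (_^ᵠ k) t
  (subst (ℚ._≤ t) (sym (ℚₚ.*-zeroˡ (0ℚ ^ᵠ j))) 0≤t)
  (ℚₚ.≤-trans (ℚₚ.≤-trans (p≤∣p∣ t) (p≤r+p 0≤1))
    (subst (ℚ._≤ b ^ᵠ k) (ℚₚ.*-identityʳ b)
      (ℚₚ.*-monoˡ-≤-nonNeg b {{ℚ.nonNegative (ℚₚ.<⇒≤ (0<1+∣p∣ t))}} (1≤^ᵠ j 1≤b))))
  (lifts-^ k lifts-id)
  where
  b   = 1ℚ ℚ.+ ∣ t ∣
  0≤1 = ℚₚ.<⇒≤ (ℚₚ.positive⁻¹ 1ℚ)
  1≤b = ℚₚ.+-monoʳ-≤ 1ℚ (ℚₚ.0≤∣p∣ t)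

_^ᶻ_ : (a : ℕ) .{{_ : ℕ.NonZero a}} → ℤ → ℚ
a ^ᶻ (+ m)    = ℕ→ℚ (a ℕ.^ m)
a ^ᶻ -[1+ m ] = (+ 1 / (a ℕ.^ suc m)) {{ℕₚ.m^n≢0 a (suc m)}}

-- a ^ (m / k) is the nonnegative k-th root of a ^ m.
infixr 8 _^^_
_^^_ : (a : ℕ) .{{_ : ℕ.NonZero a}} → ℚ → ℝ
a ^^ e = root (↧ₙ e) (a ^ᶻ (↥ e))

0≤^ᶻ : ∀ a .{{_ : ℕ.NonZero a}} i → 0ℚ ℚ.≤ a ^ᶻ i
0≤^ᶻ a (+ m)      = 0≤ℕ→ℚ (a ℕ.^ m)
0≤^ᶻ a (-[1+ m ]) = ℚₚ.nonNegative⁻¹ _ {{ℚₚ.normalize-nonNeg 1 (a ℕ.^ suc m) {{ℕₚ.m^n≢0 a (suc m)}}}}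

^^-spec : ∀ a .{{_ : ℕ.NonZero a}} e → (a ^^ e) ^ᴿ (↧ₙ e) ≃ ℚ→ℝ (a ^ᶻ (↥ e))
^^-spec a e = root-^ (↧ₙ e) (a ^ᶻ (↥ e)) (0≤^ᶻ a (↥ e))

record K₃N : Set where
  field
    p q r : ℕ
    1<p   : 1 ℕ.< p
    p<q   : p ℕ.< q
    q<r   : q ℕ.< r
    p-odd : 2 ∤ p
    q-odd : 2 ∤ q
    r-odd : 2 ∤ r

  n : ℕ
  n = p ℕ.* q ℕ.* r

  field
    p∸1∣n∸1 : p ∸ 1 ∣ n ∸ 1
    q∸1∣n∸1 : q ∸ 1 ∣ n ∸ 1
    r∸1∣n∸1 : r ∸ 1 ∣ n ∸ 1

  1<q : 1 ℕ.< q
  1<q = ℕₚ.<-trans 1<p p<q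

  1<r : 1 ℕ.< r
  1<r = ℕₚ.<-trans 1<q q<r

  instance
    p≢0 : ℕ.NonZero p
    p≢0 = ℕ.>-nonZero (ℕₚ.<-trans ℕ.z<s 1<p)

    q≢0 : ℕ.NonZero q
    q≢0 = ℕ.>-nonZero (ℕₚ.<-trans ℕ.z<s 1<q)

    r≢0 : ℕ.NonZero r
    r≢0 = ℕ.>-nonZero (ℕₚ.<-trans ℕ.z<s 1<r)

    p∸1≢0 : ℕ.NonZero (p ∸ 1)
    p∸1≢0 = ℕ.>-nonZero (ℕₚ.m<n⇒0<n∸m 1<p)

    q∸1≢0 : ℕ.NonZero (q ∸ 1)
    q∸1≢0 = ℕ.>-nonZero (ℕₚ.m<n⇒0<n∸m 1<q)

    r∸1≢0 : ℕ.NonZero (r ∸ 1)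
    r∸1≢0 = ℕ.>-nonZero (ℕₚ.m<n⇒0<n∸m 1<r)

    n≢0 : ℕ.NonZero n
    n≢0 = ℕₚ.m*n≢0 (p ℕ.* q) r {{ℕₚ.m*n≢0 p q}}

  E : ℕ
  E = (p ℕ.* q ∸ 1) ℕ./ (r ∸ 1)

  field
    2≤E : 2 ℕ.≤ E

  H : ℕ
  H = gcd (gcd (p ∸ 1) (q ∸ 1)) (r ∸ 1)

  H∣p∸1 : H ∣ p ∸ 1
  H∣p∸1 = ∣-trans (gcd[m,n]∣m (gcd (p ∸ 1) (q ∸ 1)) (r ∸ 1)) (gcd[m,n]∣m (p ∸ 1) (q ∸ 1))

  H∣q∸1 : H ∣ q ∸ 1
  H∣q∸1 = ∣-trans (gcd[m,n]∣m (gcd (p ∸ 1) (q ∸ 1)) (r ∸ 1)) (gcd[m,n]∣n (p ∸ 1) (q ∸ 1))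

  H∣r∸1 : H ∣ r ∸ 1
  H∣r∸1 = gcd[m,n]∣n (gcd (p ∸ 1) (q ∸ 1)) (r ∸ 1)

  instance
    H≢0 : ℕ.NonZero H
    H≢0 = ℕ.≢-nonZero (gcd[m,n]≢0 (gcd (p ∸ 1) (q ∸ 1)) (r ∸ 1) (inj₂ (ℕ.≢-nonZero⁻¹ (r ∸ 1))))

  A B C : ℕ
  A = (p ∸ 1) ℕ./ H
  B = (q ∸ 1) ℕ./ H
  C = (r ∸ 1) ℕ./ H

  instance
    A≢0 : ℕ.NonZero A
    A≢0 = ℕ.>-nonZero (m≥n⇒m/n>0 (∣⇒≤ H∣p∸1))

    B≢0 : ℕ.NonZero B
    B≢0 = ℕ.>-nonZero (m≥n⇒m/n>0 (∣⇒≤ H∣q∸1))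

    C≢0 : ℕ.NonZero C
    C≢0 = ℕ.>-nonZero (m≥n⇒m/n>0 (∣⇒≤ H∣r∸1))

    AB≢0 : ℕ.NonZero (A ℕ.* B)
    AB≢0 = ℕₚ.m*n≢0 A B

    AC≢0 : ℕ.NonZero (A ℕ.* C)
    AC≢0 = ℕₚ.m*n≢0 A C

    BC≢0 : ℕ.NonZero (B ℕ.* C)
    BC≢0 = ℕₚ.m*n≢0 B C

  F G : ℚ
  F = ℕ→ℚ H ℚ.* (+ 1 / A ℚ.+ + 1 / B ℚ.+ + 1 / C)
      ℚ.+ + 1 / (A ℕ.* B) ℚ.+ + 1 / (A ℕ.* C) ℚ.+ + 1 / (B ℕ.* C)
  G = ℕ→ℚ A ℚ.* F ℚ.- ℕ→ℚ H

  -- The divisions defining E, A, B, C are exact.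
  E-exact : E ℕ.* (r ∸ 1) ≡ p ℕ.* q ∸ 1
  E-exact = m/n*n≡m (∣m+n∣m⇒∣n (subst (r ∸ 1 ∣_) n∸1≡ r∸1∣n∸1) (n∣m*n (p ℕ.* q)))
    where
    open ≡-Reasoning
    1≤pq : 1 ℕ.≤ p ℕ.* q
    1≤pq = ℕ.>-nonZero⁻¹ (p ℕ.* q) {{ℕₚ.m*n≢0 p q}}
    n∸1≡ : n ∸ 1 ≡ p ℕ.* q ℕ.* (r ∸ 1) ℕ.+ (p ℕ.* q ∸ 1)
    n∸1≡ = begin
      p ℕ.* q ℕ.* r ∸ 1
        ≡⟨ cong (λ k → p ℕ.* q ℕ.* k ∸ 1) (ℕₚ.m∸n+n≡m (ℕₚ.<⇒≤ 1<r)) ⟨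
      p ℕ.* q ℕ.* (r ∸ 1 ℕ.+ 1) ∸ 1
        ≡⟨ cong (_∸ 1) (ℕₚ.*-distribˡ-+ (p ℕ.* q) (r ∸ 1) 1) ⟩
      p ℕ.* q ℕ.* (r ∸ 1) ℕ.+ p ℕ.* q ℕ.* 1 ∸ 1
        ≡⟨ cong (λ k → p ℕ.* q ℕ.* (r ∸ 1) ℕ.+ k ∸ 1) (ℕₚ.*-identityʳ (p ℕ.* q)) ⟩
      p ℕ.* q ℕ.* (r ∸ 1) ℕ.+ p ℕ.* q ∸ 1
        ≡⟨ ℕₚ.+-∸-assoc (p ℕ.* q ℕ.* (r ∸ 1)) 1≤pq ⟩
      p ℕ.* q ℕ.* (r ∸ 1) ℕ.+ (p ℕ.* q ∸ 1) ∎

  A-exact : A ℕ.* H ≡ p ∸ 1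
  A-exact = m/n*n≡m H∣p∸1

  B-exact : B ℕ.* H ≡ q ∸ 1
  B-exact = m/n*n≡m H∣q∸1

  C-exact : C ℕ.* H ≡ r ∸ 1
  C-exact = m/n*n≡m H∣r∸1

IsC₃N : K₃N → Set
IsC₃N k = Prime p × Prime q × Prime r
  where
  open K₃N k

{-# OPTIONS --safe #-}
module Submission where

open import Defs
open import Data.Integer using (+_; -_)
open import Data.Nat using (ℕ; _*_; _%_)
open import Data.Product using (Σ; _×_)
open import Data.Rational using (1ℚ; _/_)
open import Data.Sum using (_⊎_)
open import Function using (_⇔_)
open import Relation.Binary.PropositionalEquality using (_≡_; _≢_)

open import Algebra.Bundles.Raw using (RawSemiring)
import Data.Integer.Base as ℤ
import Data.Integer.Properties as ℤₚ
open import Data.Empty using (⊥; ⊥-elim)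
open import Data.Nat.Base as ℕ
  using (zero; suc; pred; _+_; _∸_; _^_; _≤_; _<_; z≤n; s≤s; NonZero; >-nonZero; >-nonZero⁻¹)
open import Data.Nat.Coprimality as Coprimality using (Coprime; coprime-divisor)
open import Data.Nat.Divisibility
open import Data.Nat.DivMod using (m≡m%n+[m/n]*n; m%n<n; m%n≤m)
open import Data.Nat.GCD using (gcd-greatest)
open import Data.Nat.Logarithm using (⌊log₂_⌋; ⌊log₂⌋-mono-≤; ⌊log₂[2^n]⌋≡n)
open import Data.Nat.Primality using (Prime; prime⇒irreducible)
open import Data.Nat.Properties hiding (*-mono-≤)
import Data.Nat.Properties as ℕₚ
open import Data.Nat.Tactic.RingSolver using (solve-∀)
open import Data.Product using (_,_; proj₁; proj₂)
open import Data.Rational.Base as ℚ using (ℚ; 0ℚ; ½; ∣_∣)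
import Data.Rational.Properties as ℚₚ
open import Data.Rational.Solver using (module +-*-Solver)
open import Data.Rational.Unnormalised.Base as ℚᵘ using (mkℚᵘ)
import Data.Rational.Unnormalised.Properties as ℚᵘₚ
open import Data.Sum using (inj₁; inj₂; [_,_]′)
open import Function using (mk⇔; Equivalence)
open import Function.Construct.Composition using (_⇔-∘_)
open import Level using (0ℓ)
open import Relation.Binary.PropositionalEquality
  using (refl; sym; trans; cong; cong₂; subst; subst₂; module ≡-Reasoning)
open import Relation.Nullary using (¬_; contradiction)
open import Relation.Nullary.Decidable using (from-yes; from-no)
open +-*-Solver using (Polynomial; solve; con; _:+_; _:*_; _:-_; _:=_)

-- With h = H, the divisibilities say that E C = A B h + A + B and that
-- G B = E + A h + 1 and A F = h + G for positive integers F and G.  Hence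
-- A ≤ h + G, and multiplying by G shows that E C and A B are largest for
-- F = G = 1; together with E ≥ 2 this gives C ≤ 𝒞(h) and
-- A B C ≤ (𝒜 ℬ 𝒞)(h), with equality only for E = 2 and F = G = 1.
--
-- To pass from h to a real z ≥ 0 with n ≤ 𝒩(z), compare
--   n - 1 = C h (E C h + E + 1) = A B C h (h² + F)
-- with the identities 𝒩 - 1 = 𝒞 z (2 𝒞 z + 3) = (𝒜 ℬ 𝒞) z (z² + 1): if
-- z ≤ h, then C h ≤ 𝒞(z) z and A B C h ≤ (𝒜 ℬ 𝒞)(z) z, while for z ≥ h
-- monotonicity suffices.  For X = C, φ = 𝒞 (or X = A B C, φ = 𝒜 ℬ 𝒞) of
-- degree d, both cases give X ^ d φ(h) ≤ φ(z) ^ (d + 1), which yields the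
-- bound and also forces φ(h) ≤ X when the bound is attained.
--
-- The asymptotic bounds only use C ≤ 𝒞(h) and A B C ≤ (𝒜 ℬ 𝒞)(h), together
-- with 2 C² h² ≤ n, A B C h³ ≤ n and n ≤ (2 h)¹⁰, the last of which makes h
-- tend to infinity with n.

-- Inequalities between the parameters

+≡⇒≤ : ∀ {m o} k → m + k ≡ o → m ≤ o
+≡⇒≤ {m} k eq = subst (m ≤_) eq (m≤m+n m k)

-- 𝒜ℬ h is 𝒜(h) ℬ(h) and 2𝒞 h is twice 𝒞(h), in terms of 𝒰 h = h² + h + 1.
𝒰 𝒜ℬ 2𝒞 : ℕ → ℕ
𝒰 h = h * h + h + 1
𝒜ℬ h = (h + 1) * (𝒰 h + 2)
2𝒞 h = 𝒰 h * (𝒰 h + 2) + (h + 1)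

-- The parameters A, B, C, H, E, F, G of a K₃N, the last two as natural numbers.
record Korselt (a b c h e f g : ℕ) : Set where
  field
    1≤a   : 1 ≤ a
    1≤h   : 1 ≤ h
    a<b   : a < b
    b<c   : b < c
    2≤e   : 2 ≤ e
    1≤f   : 1 ≤ f
    1≤g   : 1 ≤ g
    e*c≡  : e * c ≡ a * b * h + a + b
    g*b≡  : g * b ≡ e + a * h + 1
    a*f≡  : a * f ≡ h + g

m+n≤m⇒n≡0 : ∀ m {n} → m + n ≤ m → n ≡ 0
m+n≤m⇒n≡0 m {n} m+n≤m = n≤0⇒n≡0 (+-cancelˡ-≤ m n 0 (subst (m + n ≤_) (sym (+-identityʳ m)) m+n≤m))

n<2^n : ∀ n → n < 2 ^ n
n<2^n zero    = s≤s z≤n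
n<2^n (suc n) = subst (suc (suc n) ≤_) (cong (λ x → 2 ^ n + x) (sym (+-identityʳ (2 ^ n))))
  (+-mono-≤ (≤-trans (s≤s z≤n) (n<2^n n)) (n<2^n n))

2*n≤2^n : ∀ n .{{_ : NonZero n}} → 2 * n ≤ 2 ^ n
2*n≤2^n (suc n) = *-monoʳ-≤ 2 (n<2^n n)

^-distribʳ-* : ∀ m n k → (m * n) ^ k ≡ m ^ k * n ^ k
^-distribʳ-* m n zero    = refl
^-distribʳ-* m n (suc k) = trans (cong (m * n *_) (^-distribʳ-* m n k)) (swap m n (m ^ k) (n ^ k))
  where
  swap : ∀ m n x y → m * n * (x * y) ≡ m * x * (n * y)
  swap = solve-∀

-- Expanding in powers of `h - 1` leaves only nonnegative coefficients. The constant 16 is exact at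
-- `h = 1`, where `2𝒞 1 = 17`.
2𝒞≤ : ∀ h .{{_ : NonZero h}} → 2𝒞 h ≤ h ^ 3 * (h + 16)
2𝒞≤ (suc m) = +≡⇒≤ _ (expand m)
  where
  expand : ∀ m → (suc m * suc m + suc m + 1) * ((suc m * suc m + suc m + 1) + 2) + (suc m + 1)
    + (27 * m + 37 * (m * m) + 14 * (m * m * m)) ≡ suc m * (suc m * (suc m * 1)) * (suc m + 16)
  expand = solve-∀

𝒜ℬ≤ : ∀ h .{{_ : NonZero h}} → 𝒜ℬ h ≤ h ^ 2 * (h + 16)
𝒜ℬ≤ (suc m) = +≡⇒≤ _ (expand m)
  where
  expand : ∀ m → (suc m + 1) * ((suc m * suc m + suc m + 1) + 2)
    + (7 + 24 * m + 14 * (m * m)) ≡ suc m * (suc m * 1) * (suc m + 16)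
  expand = solve-∀

module _ {a b c h e f g} (K : Korselt a b c h e f g) where
  open Korselt K

  private instance
    h≢0 : NonZero h
    h≢0 = >-nonZero 1≤h
    a≢0 : NonZero a
    a≢0 = >-nonZero 1≤a
    f≢0 : NonZero f
    f≢0 = >-nonZero 1≤f
    g≢0 : NonZero g
    g≢0 = >-nonZero 1≤g
    e≢0 : NonZero e
    e≢0 = >-nonZero (≤-trans (n≤1+n 1) 2≤e)

  -- If `e` were at least `a * h + 1`, then `b + 1 ≤ c` would make `e * c` at least
  -- `(a h + 1) (b + 1)`, and comparison with `a b h + a + b` would give `a h + 1 ≤ a`.
  e≤a*h : e ≤ a * h
  e≤a*h = ≮⇒≥ λ ah<e → <⇒≱ (s≤s (m≤m*n a h)) (+-cancelˡ-≤ (a * b * h + b) _ _ (begin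
    a * b * h + b + suc (a * h)   ≡⟨ expand a b h ⟨
    suc (a * h) * suc b           ≤⟨ ℕₚ.*-mono-≤ ah<e b<c ⟩
    e * c                         ≡⟨ e*c≡ ⟩
    a * b * h + a + b             ≡⟨ +-assoc (a * b * h) a b ⟩
    a * b * h + (a + b)           ≡⟨ cong (λ x → a * b * h + x) (+-comm a b) ⟩
    a * b * h + (b + a)           ≡⟨ +-assoc (a * b * h) b a ⟨
    a * b * h + b + a             ∎))
    where
    open ≤-Reasoning
    expand : ∀ a b h → suc (a * h) * suc b ≡ a * b * h + b + suc (a * h)
    expand = solve-∀

  -- From `2 h ≤ g` and `a + 1 ≤ b`, the equation for `g * b` together with `e ≤ a h` would give
  -- `2 h (a + 1) ≤ 2 a h + 1`, hence `2 h ≤ 1`.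
  g<2*h : g < 2 * h
  g<2*h = ≰⇒> λ 2h≤g → <⇒≱ (*-monoʳ-≤ 2 1≤h) (+-cancelˡ-≤ (2 * (a * h)) _ _ (begin
    2 * (a * h) + 2 * h     ≡⟨ expand a h ⟨
    2 * h * suc a           ≤⟨ ℕₚ.*-mono-≤ 2h≤g a<b ⟩
    g * b                   ≡⟨ g*b≡ ⟩
    e + a * h + 1           ≤⟨ +-monoˡ-≤ 1 (+-monoˡ-≤ (a * h) e≤a*h) ⟩
    a * h + a * h + 1       ≡⟨ cong (_+ 1) (cong (λ x → a * h + x) (+-identityʳ (a * h))) ⟨
    2 * (a * h) + 1         ∎))
    where
    open ≤-Reasoning
    expand : ∀ a h → 2 * h * suc a ≡ 2 * (a * h) + 2 * h
    expand = solve-∀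

  a≤h+g : a ≤ h + g
  a≤h+g = subst (a ≤_) a*f≡ (m≤m*n a f)

  a≤3*h : a ≤ 3 * h
  a≤3*h = ≤-trans a≤h+g (+-monoʳ-≤ h (<⇒≤ g<2*h))

  e≤3*h*h : e ≤ 3 * h * h
  e≤3*h*h = ≤-trans e≤a*h (*-monoˡ-≤ h a≤3*h)

  2*h≤h*h+1 : 2 * h ≤ h * h + 1
  2*h≤h*h+1 = lemma h
    where
    square : ∀ m → 2 * suc m + m * m ≡ suc m * suc m + 1
    square = solve-∀
    lemma : ∀ h → 2 * h ≤ h * h + 1
    lemma zero    = z≤n
    lemma (suc m) = +≡⇒≤ (m * m) (square m)

  g<h*h+1+e : g < h * h + 1 + e
  g<h*h+1+e = <-≤-trans g<2*h (≤-trans 2*h≤h*h+1 (m≤m+n (h * h + 1) e))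

  -- The chain is `2 e ≤ 6 h² ≤ (3 h)² ≤ 𝒰²`, the last step because `2 h ≤ h² + 1`. It bounds the
  -- one negative term that arises when the product of all three parameters is maximised over `e`.
  2*e≤𝒰² : 2 * e ≤ 𝒰 h * 𝒰 h
  2*e≤𝒰² = begin
    2 * e                  ≤⟨ *-monoʳ-≤ 2 e≤3*h*h ⟩
    2 * (3 * h * h)        ≤⟨ +≡⇒≤ (3 * (h * h)) (expand h) ⟩
    (2 * h + h) * (2 * h + h) ≤⟨ ℕₚ.*-mono-≤ 3h≤𝒰 3h≤𝒰 ⟩
    𝒰 h * 𝒰 h              ∎
    where
    open ≤-Reasoning
    expand : ∀ h → 2 * (3 * h * h) + 3 * (h * h) ≡ (2 * h + h) * (2 * h + h)
    expand = solve-∀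
    swap : ∀ h → h * h + 1 + h ≡ h * h + h + 1
    swap = solve-∀
    3h≤𝒰 : 2 * h + h ≤ 𝒰 h
    3h≤𝒰 = subst (2 * h + h ≤_) (swap h) (+-monoˡ-≤ h 2*h≤h*h+1)

  private
    -- g * (e * c) and g * (a * b) as functions of a, once b is eliminated.
    Φ Ψ : ℕ → ℕ
    Φ x = x * h * (e + x * h + 1) + g * x + (e + x * h + 1)
    Ψ x = x * (e + x * h + 1)

    g*e*c≡Φ[a] : g * (e * c) ≡ Φ a
    g*e*c≡Φ[a] = begin
      g * (e * c)                       ≡⟨ cong (g *_) e*c≡ ⟩
      g * (a * b * h + a + b)           ≡⟨ expand a b g h ⟩
      a * h * (g * b) + g * a + g * b   ≡⟨ cong (λ x → a * h * x + g * a + x) g*b≡ ⟩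
      Φ a                               ∎
      where
      open ≡-Reasoning
      expand : ∀ a b g h → g * (a * b * h + a + b) ≡ a * h * (g * b) + g * a + g * b
      expand = solve-∀

    g*a*b≡Ψ[a] : g * (a * b) ≡ Ψ a
    g*a*b≡Ψ[a] = begin
      g * (a * b)     ≡⟨ expand a b g ⟩
      a * (g * b)     ≡⟨ cong (a *_) g*b≡ ⟩
      Ψ a             ∎
      where
      open ≡-Reasoning
      expand : ∀ a b g → g * (a * b) ≡ a * (g * b)
      expand = solve-∀

    h+g≡a+a*[f-1] : h + g ≡ a + a * pred f
    h+g≡a+a*[f-1] = trans (sym a*f≡) (trans (cong (a *_) (sym (suc-pred f))) (*-suc a (pred f)))

    -- The summand `g * x` alone contributes `g ≥ 1` for each unit of `x`; the other summands do not
    -- decrease.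
    Φ-slope : ∀ x d → Φ x + d ≤ Φ (x + d)
    Φ-slope x d = ≤-trans (+-monoʳ-≤ (Φ x) (m≤m*n d g)) (+≡⇒≤ _ (expand x d e g h))
      where
      expand : ∀ x d e g h →
        x * h * (e + x * h + 1) + g * x + (e + x * h + 1) + d * g
          + (d * h * (e + (x + d) * h + 1) + x * h * (d * h) + d * h)
        ≡ (x + d) * h * (e + (x + d) * h + 1) + g * (x + d) + (e + (x + d) * h + 1)
      expand = solve-∀

    -- Writing `R` for `𝒰 (𝒰 + e) + h + 1`, the value of `Φ (h + g)` at `g = 1`, one has `g R - Φ (h
    -- + g) = (g - 1) (h² + 1) (h² + 1 + e -
    -- g)`. The last factor is positive by `g<h*h+1+e`. Adding `k * g` to both sides avoids the
    -- subtraction.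
    Φ[h+g]+g-1≤ : Φ (h + g) + pred g ≤ g * (𝒰 h * (𝒰 h + e) + (h + 1))
    Φ[h+g]+g-1≤ = +-cancelʳ-≤ (k * g) _ _ (begin
      Φ (h + g) + pred g + k * g     ≡⟨ +-assoc (Φ (h + g)) (pred g) (k * g) ⟩
      Φ (h + g) + (pred g + k * g)   ≤⟨ +-monoʳ-≤ (Φ (h + g)) (+-monoˡ-≤ (k * g) (m≤m*n (pred g) (suc (h * h)))) ⟩
      Φ (h + g) + (k + k * g)        ≡⟨ cong (λ x → Φ (h + g) + x) (*-suc k g) ⟨
      Φ (h + g) + k * suc g          ≤⟨ +-monoʳ-≤ (Φ (h + g)) (*-monoʳ-≤ k g<h*h+1+e) ⟩
      Φ (h + g) + k * (h * h + 1 + e)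
        ≡⟨ subst (λ x → x * (𝒰 h * (𝒰 h + e) + (h + 1)) + k * x
               ≡ (h + x) * h * (e + (h + x) * h + 1) + x * (h + x) + (e + (h + x) * h + 1) + k * (h * h + 1 + e))
             (suc-pred g) (expand (pred g) h e) ⟨
      g * (𝒰 h * (𝒰 h + e) + (h + 1)) + k * g ∎)
      where
      open ≤-Reasoning
      k = pred g * suc (h * h)
      expand : ∀ m h e →
        suc m * ((h * h + h + 1) * (h * h + h + 1 + e) + (h + 1)) + m * suc (h * h) * suc m
        ≡ (h + suc m) * h * (e + (h + suc m) * h + 1) + suc m * (h + suc m) + (e + (h + suc m) * h + 1)
          + m * suc (h * h) * (h * h + 1 + e)
      expand = solve-∀

    -- The loss from `f > 1` appears as `a (f - 1)`, the distance from `a` to `h + g`, and the loss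
    -- from `g > 1` as `g - 1`. Keeping both terms makes the equality case readable from the same
    -- inequality.
    g*e*c+slack≤ : g * (e * c) + (a * pred f + pred g) ≤ g * (𝒰 h * (𝒰 h + e) + (h + 1))
    g*e*c+slack≤ = begin
      g * (e * c) + (a * pred f + pred g)   ≡⟨ cong (_+ (a * pred f + pred g)) g*e*c≡Φ[a] ⟩
      Φ a + (a * pred f + pred g)           ≡⟨ +-assoc (Φ a) (a * pred f) (pred g) ⟨
      Φ a + a * pred f + pred g             ≤⟨ +-monoˡ-≤ (pred g) (Φ-slope a (a * pred f)) ⟩
      Φ (a + a * pred f) + pred g           ≡⟨ cong (λ x → Φ x + pred g) h+g≡a+a*[f-1] ⟨
      Φ (h + g) + pred g                    ≤⟨ Φ[h+g]+g-1≤ ⟩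
      g * (𝒰 h * (𝒰 h + e) + (h + 1))       ∎
      where open ≤-Reasoning

  e*c≤ : e * c ≤ 𝒰 h * (𝒰 h + e) + (h + 1)
  e*c≤ = *-cancelˡ-≤ g (≤-trans (m≤m+n _ _) g*e*c+slack≤)

  e*c-tight : e * c ≡ 𝒰 h * (𝒰 h + e) + (h + 1) → f ≡ 1 × g ≡ 1
  e*c-tight eq = pred≡0 f f-1≡0 , pred≡0 g (m+n≡0⇒n≡0 (a * pred f) slack≡0)
    where
    slack≡0 : a * pred f + pred g ≡ 0
    slack≡0 = m+n≤m⇒n≡0 (g * (e * c)) (subst (λ x → g * (e * c) + (a * pred f + pred g) ≤ g * x) (sym eq) g*e*c+slack≤)
    f-1≡0 : pred f ≡ 0
    f-1≡0 = m*n≡0⇒n≡0 a (pred f) (m+n≡0⇒m≡0 (a * pred f) slack≡0)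
      where
      m*n≡0⇒n≡0 : ∀ m .{{_ : NonZero m}} n → m * n ≡ 0 → n ≡ 0
      m*n≡0⇒n≡0 m n eq = m*n≡0⇒m≡0 n m (trans (*-comm n m) eq)
    pred≡0 : ∀ m .{{_ : NonZero m}} → pred m ≡ 0 → m ≡ 1
    pred≡0 m eq = trans (sym (suc-pred m)) (cong suc eq)

  -- The argument is that for `Φ`: here `g (h + 1) (𝒰 + e) - Ψ (h + g) = (g - 1) h (h² + 1 + e -
  -- g)`, and `Ψ` is increasing.
  a*b≤ : a * b ≤ (h + 1) * (𝒰 h + e)
  a*b≤ = *-cancelˡ-≤ g (+-cancelʳ-≤ (k * g) _ _ (begin
    g * (a * b) + k * g            ≡⟨ cong (_+ k * g) g*a*b≡Ψ[a] ⟩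
    Ψ a + k * g                    ≤⟨ +-mono-≤ (ℕₚ.*-mono-≤ a≤h+g (+-monoˡ-≤ 1 (+-monoʳ-≤ e (*-monoˡ-≤ h a≤h+g))))
                                               (*-monoʳ-≤ k (<⇒≤ g<h*h+1+e)) ⟩
    Ψ (h + g) + k * (h * h + 1 + e)
      ≡⟨ subst (λ x → x * ((h + 1) * (𝒰 h + e)) + k * x ≡ (h + x) * (e + (h + x) * h + 1) + k * (h * h + 1 + e))
           (suc-pred g) (expand (pred g) h e) ⟨
    g * ((h + 1) * (𝒰 h + e)) + k * g ∎))
    where
    open ≤-Reasoning
    k = pred g * h
    expand : ∀ m h e →
      suc m * ((h + 1) * (h * h + h + 1 + e)) + m * h * suc m
      ≡ (h + suc m) * (e + (h + suc m) * h + 1) + m * h * (h * h + 1 + e)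
    expand = solve-∀

  private
    t : ℕ
    t = e ∸ 2

    e≡2+t : e ≡ 2 + t
    e≡2+t = sym (m+[n∸m]≡n 2≤e)

    -- Twice the bound on `e * c` falls short of `e * 2𝒞 h` by exactly `(e - 2) (𝒰² + h + 1)`.
    e*2c+slack≤ : e * (2 * c) + t * suc (h + 𝒰 h * 𝒰 h) ≤ e * 2𝒞 h
    e*2c+slack≤ = begin
      e * (2 * c) + t * suc (h + 𝒰 h * 𝒰 h)
        ≡⟨ cong (_+ t * suc (h + 𝒰 h * 𝒰 h)) (swap e c) ⟩
      2 * (e * c) + t * suc (h + 𝒰 h * 𝒰 h)
        ≤⟨ +-monoˡ-≤ (t * suc (h + 𝒰 h * 𝒰 h)) (*-monoʳ-≤ 2 e*c≤) ⟩
      2 * (𝒰 h * (𝒰 h + e) + (h + 1)) + t * suc (h + 𝒰 h * 𝒰 h)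
        ≡⟨ subst (λ x → 2 * (𝒰 h * (𝒰 h + x) + (h + 1)) + t * suc (h + 𝒰 h * 𝒰 h) ≡ x * 2𝒞 h)
             (sym e≡2+t) (expand t (𝒰 h) h) ⟩
      e * 2𝒞 h ∎
      where
      open ≤-Reasoning
      swap : ∀ e c → e * (2 * c) ≡ 2 * (e * c)
      swap = solve-∀
      expand : ∀ t u h → 2 * (u * (u + (2 + t)) + (h + 1)) + t * suc (h + u * u) ≡ (2 + t) * (u * (u + 2) + (h + 1))
      expand = solve-∀

    -- Twice the product of the bounds on `a * b` and `e * c` falls short of `e * (𝒜ℬ h * 2𝒞 h)` by
    -- `(e - 2) (h + 1) 𝒰 (𝒰² + h + 1 - 2 e)`, and `2 e ≤ 𝒰²` leaves at least the stated slack.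
    e*2abc+slack≤ : e * (2 * (a * b * c)) + t * (𝒰 h * (h + 1)) ≤ e * (𝒜ℬ h * 2𝒞 h)
    e*2abc+slack≤ = begin
      e * (2 * (a * b * c)) + s
        ≡⟨ cong (_+ s) (swap a b c e) ⟩
      2 * (a * b * (e * c)) + s
        ≤⟨ +-monoˡ-≤ s (*-monoʳ-≤ 2 (ℕₚ.*-mono-≤ a*b≤ e*c≤)) ⟩
      2 * ((h + 1) * (u + e) * (u * (u + e) + (h + 1))) + s
        ≤⟨ +-monoʳ-≤ (2 * ((h + 1) * (u + e) * (u * (u + e) + (h + 1)))) (*-monoʳ-≤ t (m≤n*m (u * (h + 1)) (suc h))) ⟩
      2 * ((h + 1) * (u + e) * (u * (u + e) + (h + 1))) + s′
        ≤⟨ +-cancelʳ-≤ (t * (suc h * (u * (2 * e)))) _ _ (begin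
          2 * ((h + 1) * (u + e) * (u * (u + e) + (h + 1))) + s′ + t * (suc h * (u * (2 * e)))
            ≤⟨ +-monoʳ-≤ (2 * ((h + 1) * (u + e) * (u * (u + e) + (h + 1))) + s′)
                 (*-monoʳ-≤ t (*-monoʳ-≤ (suc h) (*-monoʳ-≤ u 2*e≤𝒰²))) ⟩
          2 * ((h + 1) * (u + e) * (u * (u + e) + (h + 1))) + s′ + t * (suc h * (u * (u * u)))
            ≡⟨ subst (λ x → 2 * ((h + 1) * (u + x) * (u * (u + x) + (h + 1))) + s′ + t * (suc h * (u * (u * u)))
                 ≡ x * (𝒜ℬ h * 2𝒞 h) + t * (suc h * (u * (2 * x)))) (sym e≡2+t) (expand t u h) ⟩
          e * (𝒜ℬ h * 2𝒞 h) + t * (suc h * (u * (2 * e))) ∎) ⟩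
      e * (𝒜ℬ h * 2𝒞 h) ∎
      where
      open ≤-Reasoning
      u = 𝒰 h
      s = t * (u * (h + 1))
      s′ = t * (suc h * (u * (h + 1)))
      swap : ∀ a b c e → e * (2 * (a * b * c)) ≡ 2 * (a * b * (e * c))
      swap = solve-∀
      expand : ∀ t u h →
        2 * ((h + 1) * (u + (2 + t)) * (u * (u + (2 + t)) + (h + 1))) + t * (suc h * (u * (h + 1)))
          + t * (suc h * (u * (u * u)))
        ≡ (2 + t) * ((h + 1) * (u + 2) * (u * (u + 2) + (h + 1))) + t * (suc h * (u * (2 * (2 + t))))
      expand = solve-∀

    t≡0⇒e≡2 : ∀ m .{{_ : NonZero m}} → t * m ≡ 0 → e ≡ 2
    t≡0⇒e≡2 m eq = trans e≡2+t (cong (λ x → 2 + x) (m*n≡0⇒m≡0 t m eq))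

  2c≤2𝒞 : 2 * c ≤ 2𝒞 h
  2c≤2𝒞 = *-cancelˡ-≤ e (≤-trans (m≤m+n _ _) e*2c+slack≤)

  2c-tight : 2 * c ≡ 2𝒞 h → e ≡ 2 × f ≡ 1 × g ≡ 1
  2c-tight eq = e≡2 , e*c-tight (*-cancelˡ-≡ _ _ 2 (begin
    2 * (e * c)                         ≡⟨ cong (λ x → 2 * (x * c)) e≡2 ⟩
    2 * (2 * c)                         ≡⟨ cong (2 *_) eq ⟩
    2 * 2𝒞 h                            ≡⟨ cong (λ x → 2 * (𝒰 h * (𝒰 h + x) + (h + 1))) e≡2 ⟨
    2 * (𝒰 h * (𝒰 h + e) + (h + 1))     ∎))
    where
    open ≡-Reasoning
    e≡2 = t≡0⇒e≡2 (suc (h + 𝒰 h * 𝒰 h)) (m+n≤m⇒n≡0 (e * (2 * c))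
            (subst (λ x → e * (2 * c) + t * suc (h + 𝒰 h * 𝒰 h) ≤ e * x) (sym eq) e*2c+slack≤))

  2abc≤ : 2 * (a * b * c) ≤ 𝒜ℬ h * 2𝒞 h
  2abc≤ = *-cancelˡ-≤ e (≤-trans (m≤m+n _ _) e*2abc+slack≤)

  -- The slack first forces `e = 2`. Then `a * b` is at most `𝒜ℬ h`, so a strict inequality for `c`
  -- would make the product strict as well.
  2abc-tight : 2 * (a * b * c) ≡ 𝒜ℬ h * 2𝒞 h → e ≡ 2 × f ≡ 1 × g ≡ 1
  2abc-tight eq = [ (λ 2c< → contradiction eq (<⇒≢ (2abc< 2c<))) , 2c-tight ]′ (m≤n⇒m<n∨m≡n 2c≤2𝒞)
    where
    open ≤-Reasoning
    swap : ∀ a b c → 2 * (a * b * c) ≡ a * b * (2 * c)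
    swap = solve-∀
    h+1≢0 : NonZero (h + 1)
    h+1≢0 = >-nonZero (m≤n+m 1 h)
    𝒜ℬ≢0 : NonZero (𝒜ℬ h)
    𝒜ℬ≢0 = m*n≢0 (h + 1) (𝒰 h + 2) {{h+1≢0}} {{>-nonZero (≤-trans (n≤1+n 1) (m≤n+m 2 (𝒰 h)))}}
    𝒰≢0 : NonZero (𝒰 h)
    𝒰≢0 = >-nonZero (m≤n+m 1 (h * h + h))
    e≡2 = t≡0⇒e≡2 (𝒰 h * (h + 1)) {{m*n≢0 (𝒰 h) (h + 1) {{𝒰≢0}} {{h+1≢0}}}} (m+n≤m⇒n≡0 (e * (2 * (a * b * c)))
            (subst (λ x → e * (2 * (a * b * c)) + t * (𝒰 h * (h + 1)) ≤ e * x) (sym eq) e*2abc+slack≤))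
    2abc< : 2 * c < 2𝒞 h → 2 * (a * b * c) < 𝒜ℬ h * 2𝒞 h
    2abc< 2c< = begin-strict
      2 * (a * b * c)                 ≡⟨ swap a b c ⟩
      a * b * (2 * c)                 ≤⟨ *-monoˡ-≤ (2 * c) a*b≤ ⟩
      (h + 1) * (𝒰 h + e) * (2 * c)   ≡⟨ cong (λ x → (h + 1) * (𝒰 h + x) * (2 * c)) e≡2 ⟩
      𝒜ℬ h * (2 * c)                  <⟨ *-monoʳ-< (𝒜ℬ h) {{𝒜ℬ≢0}} 2c< ⟩
      𝒜ℬ h * 2𝒞 h                     ∎

  -- The size of `n` in terms of the parameters

  private
    n : ℕ
    n = (a * h + 1) * (b * h + 1) * (c * h + 1)

  -- The first factor is `p q = 1 + E (r - 1)`, the second is `r`.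
  n≡[1+ech][1+ch] : n ≡ (1 + e * (c * h)) * (1 + c * h)
  n≡[1+ech][1+ch] = begin
    n                                        ≡⟨ expand a b c h ⟩
    (1 + (a * b * h + a + b) * h) * (1 + c * h) ≡⟨ cong (λ x → (1 + x * h) * (1 + c * h)) e*c≡ ⟨
    (1 + e * c * h) * (1 + c * h)            ≡⟨ cong (λ x → (1 + x) * (1 + c * h)) (*-assoc e c h) ⟩
    (1 + e * (c * h)) * (1 + c * h)          ∎
    where
    open ≡-Reasoning
    expand : ∀ a b c h → (a * h + 1) * (b * h + 1) * (c * h + 1) ≡ (1 + (a * b * h + a + b) * h) * (1 + c * h)
    expand = solve-∀

  -- After expansion, the equations for `e * c`, `g * b` and `a * f` are applied in turn, each
  -- collecting the lower-order terms into one more common factor.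
  n≡1+abc*h[h²+f] : n ≡ 1 + a * b * c * h * (h * h + f)
  n≡1+abc*h[h²+f] = begin
    n
      ≡⟨ expand a b c h ⟩
    1 + (a * b * c * h * (h * h) + c * h * (b * h + a * h + 1) + h * (a * b * h + a + b))
      ≡⟨ cong (λ x → 1 + (a * b * c * h * (h * h) + c * h * (b * h + a * h + 1) + h * x)) e*c≡ ⟨
    1 + (a * b * c * h * (h * h) + c * h * (b * h + a * h + 1) + h * (e * c))
      ≡⟨ regroup a b c e h ⟩
    1 + (a * b * c * h * (h * h) + c * h * (b * h + (e + a * h + 1)))
      ≡⟨ cong (λ x → 1 + (a * b * c * h * (h * h) + c * h * (b * h + x))) g*b≡ ⟨
    1 + (a * b * c * h * (h * h) + c * h * (b * h + g * b))
      ≡⟨ factor a b c g h ⟩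
    1 + (a * b * c * h * (h * h) + b * c * h * (h + g))
      ≡⟨ cong (λ x → 1 + (a * b * c * h * (h * h) + b * c * h * x)) a*f≡ ⟨
    1 + (a * b * c * h * (h * h) + b * c * h * (a * f))
      ≡⟨ collect a b c f h ⟩
    1 + a * b * c * h * (h * h + f) ∎
    where
    open ≡-Reasoning
    expand : ∀ a b c h → (a * h + 1) * (b * h + 1) * (c * h + 1)
      ≡ 1 + (a * b * c * h * (h * h) + c * h * (b * h + a * h + 1) + h * (a * b * h + a + b))
    expand = solve-∀
    regroup : ∀ a b c e h → 1 + (a * b * c * h * (h * h) + c * h * (b * h + a * h + 1) + h * (e * c))
      ≡ 1 + (a * b * c * h * (h * h) + c * h * (b * h + (e + a * h + 1)))
    regroup = solve-∀
    factor : ∀ a b c g h → 1 + (a * b * c * h * (h * h) + c * h * (b * h + g * b))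
      ≡ 1 + (a * b * c * h * (h * h) + b * c * h * (h + g))
    factor = solve-∀
    collect : ∀ a b c f h → 1 + (a * b * c * h * (h * h) + b * c * h * (a * f)) ≡ 1 + a * b * c * h * (h * h + f)
    collect = solve-∀

  extremal : e ≡ 2 → f ≡ 1 → g ≡ 1 → a ≡ h + 1 × b ≡ 𝒰 h + 2 × 2 * c ≡ 2𝒞 h
  extremal refl refl refl = a≡ , b≡ , (begin
    2 * c                         ≡⟨ e*c≡ ⟩
    a * b * h + a + b             ≡⟨ cong₂ (λ x y → x * y * h + x + y) a≡ b≡ ⟩
    (h + 1) * (𝒰 h + 2) * h + (h + 1) + (𝒰 h + 2) ≡⟨ expand₂ h ⟩
    2𝒞 h                          ∎)
    where
    open ≡-Reasoning
    expand₁ : ∀ h → 2 + (h + 1) * h + 1 ≡ h * h + h + 1 + 2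
    expand₁ = solve-∀
    expand₂ : ∀ h → (h + 1) * (h * h + h + 1 + 2) * h + (h + 1) + (h * h + h + 1 + 2)
      ≡ (h * h + h + 1) * (h * h + h + 1 + 2) + (h + 1)
    expand₂ = solve-∀
    a≡ : a ≡ h + 1
    a≡ = trans (sym (*-identityʳ a)) a*f≡
    b≡ : b ≡ 𝒰 h + 2
    b≡ = begin
      b                      ≡⟨ *-identityˡ b ⟨
      1 * b                  ≡⟨ g*b≡ ⟩
      2 + a * h + 1          ≡⟨ cong (λ x → 2 + x * h + 1) a≡ ⟩
      2 + (h + 1) * h + 1    ≡⟨ expand₁ h ⟩
      𝒰 h + 2                ∎

  -- The three factors are at most `4 h²`, `8 h³` and `32 h⁵`; the constants multiply to `2¹⁰` and
  -- the exponents add up to 10.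
  n≤[2h]^10 : n ≤ (2 * h) ^ 10
  n≤[2h]^10 = begin
    (a * h + 1) * (b * h + 1) * (c * h + 1)
      ≤⟨ ℕₚ.*-mono-≤ (ℕₚ.*-mono-≤ p≤ q≤) r≤ ⟩
    (4 * h ^ 2) * (8 * h ^ 3) * (32 * h ^ 5)
      ≡⟨ expand h ⟩
    1024 * h ^ 10
      ≡⟨ ^-distribʳ-* 2 h 10 ⟨
    (2 * h) ^ 10 ∎
    where
    open ≤-Reasoning
    expand : ∀ h → 4 * (h * (h * 1)) * (8 * (h * (h * (h * 1)))) * (32 * (h * (h * (h * (h * (h * 1))))))
      ≡ 1024 * (h * (h * (h * (h * (h * (h * (h * (h * (h * (h * 1))))))))))
    expand = solve-∀
    absorb : ∀ {x} m k → x ≤ m * h ^ k → x + 1 ≤ suc m * h ^ k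
    absorb {x} m k x≤ = subst (x + 1 ≤_) (+-comm (m * h ^ k) (h ^ k)) (+-mono-≤ x≤ (m^n>0 h k))
    ah≤ : a * h ≤ 3 * h ^ 2
    ah≤ = ≤-trans (*-monoˡ-≤ h a≤3*h) (≤-reflexive (eq h))
      where
      eq : ∀ h → 3 * h * h ≡ 3 * (h * (h * 1))
      eq = solve-∀
    p≤ : a * h + 1 ≤ 4 * h ^ 2
    p≤ = absorb 3 2 ah≤
    b≤ : b ≤ 7 * h ^ 2
    b≤ = begin
      b                          ≤⟨ m≤n*m b g ⟩
      g * b                      ≡⟨ g*b≡ ⟩
      e + a * h + 1              ≤⟨ absorb 6 2 (≤-trans (+-mono-≤ (≤-trans e≤a*h ah≤) ah≤)
                                      (≤-reflexive (sym (*-distribʳ-+ (h ^ 2) 3 3)))) ⟩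
      7 * h ^ 2                  ∎
    bh≤ : b * h ≤ 7 * h ^ 3
    bh≤ = ≤-trans (*-monoˡ-≤ h b≤) (≤-reflexive (eq h))
      where
      eq : ∀ h → 7 * (h * (h * 1)) * h ≡ 7 * (h * (h * (h * 1)))
      eq = solve-∀
    q≤ : b * h + 1 ≤ 8 * h ^ 3
    q≤ = absorb 7 3 bh≤
    ch≤ : c * h ≤ 31 * h ^ 5
    ch≤ = begin
      c * h                                    ≤⟨ *-monoˡ-≤ h (m≤n*m c e) ⟩
      e * c * h                                ≡⟨ cong (_* h) e*c≡ ⟩
      (a * b * h + a + b) * h                  ≡⟨ eq₁ a b h ⟩
      a * h * (b * h) + a * h * 1 + b * h * 1  ≤⟨ +-mono-≤ (+-mono-≤ (ℕₚ.*-mono-≤ ah≤ bh≤)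
                                                    (ℕₚ.*-mono-≤ ah≤ (m^n>0 h 3))) (ℕₚ.*-mono-≤ bh≤ (m^n>0 h 2)) ⟩
      3 * h ^ 2 * (7 * h ^ 3) + 3 * h ^ 2 * h ^ 3 + 7 * h ^ 3 * h ^ 2 ≡⟨ eq₂ h ⟩
      31 * h ^ 5                               ∎
      where
      eq₁ : ∀ a b h → (a * b * h + a + b) * h ≡ a * h * (b * h) + a * h * 1 + b * h * 1
      eq₁ = solve-∀
      eq₂ : ∀ h → 3 * (h * (h * 1)) * (7 * (h * (h * (h * 1)))) + 3 * (h * (h * 1)) * (h * (h * (h * 1)))
        + 7 * (h * (h * (h * 1))) * (h * (h * 1)) ≡ 31 * (h * (h * (h * (h * (h * 1)))))
      eq₂ = solve-∀
    r≤ : c * h + 1 ≤ 32 * h ^ 5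
    r≤ = absorb 31 5 ch≤

  -- Weakening `2 h` to `2 ^ h` is crude, but any lower bound for `h` that grows with `n` is enough
  -- for the error term.
  ⌊log₂n⌋≤10h : ⌊log₂ n ⌋ ≤ 10 * h
  ⌊log₂n⌋≤10h = begin
    ⌊log₂ n ⌋                   ≤⟨ ⌊log₂⌋-mono-≤ n≤[2h]^10 ⟩
    ⌊log₂ (2 * h) ^ 10 ⌋        ≤⟨ ⌊log₂⌋-mono-≤ (^-monoˡ-≤ 10 (2*n≤2^n h)) ⟩
    ⌊log₂ (2 ^ h) ^ 10 ⌋        ≡⟨ cong ⌊log₂_⌋ (trans (^-*-assoc 2 h 10) (cong (2 ^_) (*-comm h 10))) ⟩
    ⌊log₂ 2 ^ (10 * h) ⌋        ≡⟨ ⌊log₂[2^n]⌋≡n (10 * h) ⟩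
    10 * h                      ∎
    where open ≤-Reasoning

  private
    2c²h²≤n : 2 * (c * h) * (c * h) ≤ n
    2c²h²≤n = subst (2 * (c * h) * (c * h) ≤_) (sym n≡[1+ech][1+ch])
      (ℕₚ.*-mono-≤ (≤-trans (*-monoˡ-≤ (c * h) 2≤e) (n≤1+n _)) (n≤1+n (c * h)))

    abc*h³≤n : a * b * c * (h * (h * h)) ≤ n
    abc*h³≤n = begin
      a * b * c * (h * (h * h))              ≡⟨ *-assoc (a * b * c) h (h * h) ⟨
      a * b * c * h * (h * h)                ≤⟨ *-monoʳ-≤ (a * b * c * h) (m≤m+n (h * h) f) ⟩
      a * b * c * h * (h * h + f)            ≤⟨ n≤1+n _ ⟩
      1 + a * b * c * h * (h * h + f)        ≡⟨ n≡1+abc*h[h²+f] ⟨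
      n                                      ∎
      where open ≤-Reasoning

  -- The left side splits as `(2 (c h)²)² (2 c h)`: each square is at most `n`, and
  -- `2 c ≤ h³ (h + 16)`. After division by `h⁵` it reads `8 c⁵ ≤ n² (1 + 16 / h)⁵`.
  8[ch]^5≤ : 8 * (c * h) ^ 5 ≤ n ^ 2 * (h + 16) ^ 5
  8[ch]^5≤ = begin
    8 * (c * h) ^ 5                          ≡⟨ eq₁ c h ⟩
    (2 * (c * h) * (c * h)) ^ 2 * (2 * c * h) ≤⟨ ℕₚ.*-mono-≤ (^-monoˡ-≤ 2 2c²h²≤n) (*-monoˡ-≤ h (≤-trans 2c≤2𝒞 (2𝒞≤ h))) ⟩
    n ^ 2 * (h ^ 3 * (h + 16) * h)           ≡⟨ cong (n ^ 2 *_) (eq₂ h) ⟩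
    n ^ 2 * ((h + 16) * h ^ 4)               ≤⟨ *-monoʳ-≤ (n ^ 2) (*-monoʳ-≤ (h + 16) (^-monoˡ-≤ 4 (m≤m+n h 16))) ⟩
    n ^ 2 * (h + 16) ^ 5                     ∎
    where
    open ≤-Reasoning
    eq₁ : ∀ c h → 8 * ((c * h) * ((c * h) * ((c * h) * ((c * h) * ((c * h) * 1)))))
      ≡ 2 * (c * h) * (c * h) * (2 * (c * h) * (c * h) * 1) * (2 * c * h)
    eq₁ = solve-∀
    eq₂ : ∀ h → h * (h * (h * 1)) * (h + 16) * h ≡ (h + 16) * (h * (h * (h * (h * 1))))
    eq₂ = solve-∀

  -- With `x = a b c` and `s = h + 16`, split `8 x¹⁰ = x⁷ (2 x)³` and use `2 x ≤ h⁵ s²` in the cube.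
  -- Of the resulting `h²⁵`, the part `h²¹` joins `x⁷` to form `(x h³)⁷ ≤ n⁷`, and the remaining
  -- `h⁴` is at most `s⁴`.
  8[abc*h]^10≤ : 8 * (a * b * c * h) ^ 10 ≤ n ^ 7 * (h + 16) ^ 10
  8[abc*h]^10≤ = begin
    8 * (a * b * c * h) ^ 10
      ≡⟨ cong (8 *_) (^-distribʳ-* x h 10) ⟩
    8 * (x ^ 10 * h ^ 10)
      ≡⟨ cong (λ y → 8 * (y * h ^ 10)) (^-distribˡ-+-* x 7 3) ⟩
    8 * (x ^ 7 * x ^ 3 * h ^ 10)
      ≡⟨ eq₁ (x ^ 7) (x ^ 3) (h ^ 10) ⟩
    x ^ 7 * (8 * x ^ 3) * h ^ 10
      ≡⟨ cong (λ y → x ^ 7 * y * h ^ 10) (^-distribʳ-* 2 x 3) ⟨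
    x ^ 7 * (2 * x) ^ 3 * h ^ 10
      ≤⟨ *-monoˡ-≤ (h ^ 10) (*-monoʳ-≤ (x ^ 7) (^-monoˡ-≤ 3 (≤-trans 2abc≤ (ℕₚ.*-mono-≤ (𝒜ℬ≤ h) (2𝒞≤ h))))) ⟩
    x ^ 7 * (h ^ 2 * s * (h ^ 3 * s)) ^ 3 * h ^ 10
      ≡⟨ cong (λ y → x ^ 7 * y ^ 3 * h ^ 10) (eq₂ h s) ⟩
    x ^ 7 * (h ^ 5 * s ^ 2) ^ 3 * h ^ 10
      ≡⟨ cong (λ y → x ^ 7 * y * h ^ 10)
           (trans (^-distribʳ-* (h ^ 5) (s ^ 2) 3) (cong₂ _*_ (^-*-assoc h 5 3) (^-*-assoc s 2 3))) ⟩
    x ^ 7 * (h ^ 15 * s ^ 6) * h ^ 10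
      ≡⟨ eq₃ (x ^ 7) (h ^ 15) (s ^ 6) (h ^ 10) ⟩
    x ^ 7 * (h ^ 15 * h ^ 10) * s ^ 6
      ≡⟨ cong (λ y → x ^ 7 * y * s ^ 6) (trans (sym (^-distribˡ-+-* h 15 10)) (^-distribˡ-+-* h 21 4)) ⟩
    x ^ 7 * (h ^ 21 * h ^ 4) * s ^ 6
      ≡⟨ eq₄ (x ^ 7) (h ^ 21) (h ^ 4) (s ^ 6) ⟩
    x ^ 7 * h ^ 21 * (s ^ 6 * h ^ 4)
      ≡⟨ cong (_* (s ^ 6 * h ^ 4))
           (trans (^-distribʳ-* x (h * (h * h)) 7) (cong (x ^ 7 *_) (trans (cong (_^ 7) (eq₅ h)) (^-*-assoc h 3 7)))) ⟨
    (x * (h * (h * h))) ^ 7 * (s ^ 6 * h ^ 4)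
      ≤⟨ ℕₚ.*-mono-≤ (^-monoˡ-≤ 7 abc*h³≤n) (*-monoʳ-≤ (s ^ 6) (^-monoˡ-≤ 4 (m≤m+n h 16))) ⟩
    n ^ 7 * (s ^ 6 * s ^ 4)
      ≡⟨ cong (n ^ 7 *_) (^-distribˡ-+-* s 6 4) ⟨
    n ^ 7 * s ^ 10 ∎
    where
    open ≤-Reasoning
    x = a * b * c
    s = h + 16
    eq₁ : ∀ x y z → 8 * (x * y * z) ≡ x * (8 * y) * z
    eq₁ = solve-∀
    eq₂ : ∀ h s → h * (h * 1) * s * (h * (h * (h * 1)) * s) ≡ h * (h * (h * (h * (h * 1)))) * (s * (s * 1))
    eq₂ = solve-∀
    eq₃ : ∀ x y z w → x * (y * z) * w ≡ x * (y * w) * z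
    eq₃ = solve-∀
    eq₄ : ∀ x y z w → x * (y * z) * w ≡ x * y * (w * z)
    eq₄ = solve-∀
    eq₅ : ∀ h → h * (h * h) ≡ h * (h * (h * 1))
    eq₅ = solve-∀

-- The polynomials over ℚ and their growth

module Q = ℚ-Polynomials

-- At the syntax of the ring solver the polynomials are terms it can normalise.
syntax-rawSemiring : ℕ → RawSemiring 0ℓ 0ℓ
syntax-rawSemiring k = record
  { Carrier = Polynomial k ; _≈_ = _≡_ ; _+_ = _:+_ ; _*_ = _:*_ ; 0# = con 0ℚ ; 1# = con 1ℚ }

module P = Polynomials (syntax-rawSemiring 1) (con ½)

1′ : Polynomial 1
1′ = con 1ℚ

𝒞-factors : ∀ z → let u = z ℚ.* z ℚ.+ z ℚ.+ 1ℚ in Q.𝒞 z ≡ ½ ℚ.* (u ℚ.* (u ℚ.+ (1ℚ ℚ.+ 1ℚ)) ℚ.+ (z ℚ.+ 1ℚ))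
𝒞-factors = solve 1 (λ z → let u = z :* z :+ z :+ 1′ in
  P.𝒞 z := con ½ :* (u :* (u :+ (1′ :+ 1′)) :+ (z :+ 1′))) refl

-- This is the factorisation `n = (1 + e c h) (1 + c h)` at `e = 2`, with `𝒞 z` for `c` and `z` for
-- `h`.
𝒩-factors : ∀ z → let v = Q.𝒞 z ℚ.* z in Q.𝒩 z ≡ (1ℚ ℚ.+ (v ℚ.+ v)) ℚ.* (1ℚ ℚ.+ v)
𝒩-factors = solve 1 (λ z → let v = P.𝒞 z :* z in
  P.𝒩 z := (1′ :+ (v :+ v)) :* (1′ :+ v)) refl

𝒜ℬ-factors : ∀ z → Q.𝒜 z ℚ.* Q.ℬ z ≡ (z ℚ.+ 1ℚ) ℚ.* (z ℚ.* z ℚ.+ z ℚ.+ 1ℚ ℚ.+ (1ℚ ℚ.+ 1ℚ))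
𝒜ℬ-factors = solve 1 (λ z → P.𝒜 z :* P.ℬ z := (z :+ 1′) :* (z :* z :+ z :+ 1′ :+ (1′ :+ 1′))) refl

-- This is the formula `n = 1 + a b c h (h² + f)` at `f = 1`, with `z` for `h`.
𝒩≡1+𝒬*z[z²+1] : ∀ z → Q.𝒩 z ≡ 1ℚ ℚ.+ Q.𝒜 z ℚ.* Q.ℬ z ℚ.* Q.𝒞 z ℚ.* z ℚ.* (z ℚ.* z ℚ.+ 1ℚ)
𝒩≡1+𝒬*z[z²+1] = solve 1 (λ z → P.𝒩 z := 1′ :+ P.𝒜 z :* P.ℬ z :* P.𝒞 z :* z :* (z :* z :+ 1′)) refl

lifts-𝒞 : Lifts 𝒞 Q.𝒞
lifts-𝒞 = lifts-* (lifts-const ½) (lifts-+ (lifts-+ (lifts-+ (lifts-+ (lifts-^ 4 lifts-id)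
  (lifts-· 2 (lifts-^ 3 lifts-id))) (lifts-· 5 (lifts-^ 2 lifts-id))) (lifts-· 5 lifts-id))
  (lifts-· 4 (lifts-const 1ℚ)))

𝒬 : ℝ → ℝ
𝒬 x = 𝒜 x *ᴿ ℬ x *ᴿ 𝒞 x

𝒬ᵠ : ℚ → ℚ
𝒬ᵠ z = Q.𝒜 z ℚ.* Q.ℬ z ℚ.* Q.𝒞 z

lifts-𝒬 : Lifts 𝒬 𝒬ᵠ
lifts-𝒬 = lifts-* (lifts-* (lifts-+ lifts-id (lifts-const 1ℚ))
  (lifts-+ (lifts-+ (lifts-^ 2 lifts-id) lifts-id) (lifts-· 3 (lifts-const 1ℚ)))) lifts-𝒞

<⇒≱ᵠ : ∀ {a b} → a ℚ.< b → ¬ b ℚ.≤ a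
<⇒≱ᵠ a<b b≤a = ℚₚ.<-irrefl refl (ℚₚ.<-≤-trans a<b b≤a)

0≤1 : 0ℚ ℚ.≤ 1ℚ
0≤1 = ℚₚ.<⇒≤ (ℚₚ.positive⁻¹ 1ℚ)

*-monoˡᵠ : ∀ {a b} c → 0ℚ ℚ.≤ c → a ℚ.≤ b → c ℚ.* a ℚ.≤ c ℚ.* b
*-monoˡᵠ c 0≤c = ℚₚ.*-monoˡ-≤-nonNeg c {{ℚ.nonNegative 0≤c}}

*-monoʳᵠ : ∀ {a b} c → 0ℚ ℚ.≤ c → a ℚ.≤ b → a ℚ.* c ℚ.≤ b ℚ.* c
*-monoʳᵠ c 0≤c = ℚₚ.*-monoʳ-≤-nonNeg c {{ℚ.nonNegative 0≤c}}

0<* : ∀ {a b} → 0ℚ ℚ.< a → 0ℚ ℚ.< b → 0ℚ ℚ.< a ℚ.* b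
0<* {a} {b} 0<a 0<b = ℚₚ.positive⁻¹ (a ℚ.* b) {{ℚₚ.pos*pos⇒pos a {{ℚ.positive 0<a}} b {{ℚ.positive 0<b}}}}

*-cancelˡᵠ : ∀ {a b} c → 0ℚ ℚ.< c → c ℚ.* a ℚ.≤ c ℚ.* b → a ℚ.≤ b
*-cancelˡᵠ c 0<c = ℚₚ.*-cancelˡ-≤-pos c {{ℚ.positive 0<c}}

*-cancelʳᵠ : ∀ {a b} c → 0ℚ ℚ.< c → a ℚ.* c ℚ.≤ b ℚ.* c → a ℚ.≤ b
*-cancelʳᵠ c 0<c = ℚₚ.*-cancelʳ-≤-pos c {{ℚ.positive 0<c}}

-- The embedding of the naturals and powers of rationals

ℕ→ℚ-+ : ∀ m n → ℕ→ℚ (m ℕ.+ n) ≡ ℕ→ℚ m ℚ.+ ℕ→ℚ n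
ℕ→ℚ-+ zero    n = sym (ℚₚ.+-identityˡ (ℕ→ℚ n))
ℕ→ℚ-+ (suc m) n = begin
  ℕ→ℚ (suc (m ℕ.+ n))                ≡⟨ ℕ→ℚ-suc (m ℕ.+ n) ⟩
  1ℚ ℚ.+ ℕ→ℚ (m ℕ.+ n)               ≡⟨ cong (1ℚ ℚ.+_) (ℕ→ℚ-+ m n) ⟩
  1ℚ ℚ.+ (ℕ→ℚ m ℚ.+ ℕ→ℚ n)           ≡⟨ ℚₚ.+-assoc 1ℚ (ℕ→ℚ m) (ℕ→ℚ n) ⟨
  1ℚ ℚ.+ ℕ→ℚ m ℚ.+ ℕ→ℚ n             ≡⟨ cong (ℚ._+ ℕ→ℚ n) (ℕ→ℚ-suc m) ⟨
  ℕ→ℚ (suc m) ℚ.+ ℕ→ℚ n              ∎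
  where open ≡-Reasoning

ℕ→ℚ-* : ∀ m n → ℕ→ℚ (m ℕ.* n) ≡ ℕ→ℚ m ℚ.* ℕ→ℚ n
ℕ→ℚ-* zero    n = sym (ℚₚ.*-zeroˡ (ℕ→ℚ n))
ℕ→ℚ-* (suc m) n = begin
  ℕ→ℚ (n ℕ.+ m ℕ.* n)                  ≡⟨ ℕ→ℚ-+ n (m ℕ.* n) ⟩
  ℕ→ℚ n ℚ.+ ℕ→ℚ (m ℕ.* n)              ≡⟨ cong (ℕ→ℚ n ℚ.+_) (ℕ→ℚ-* m n) ⟩
  ℕ→ℚ n ℚ.+ ℕ→ℚ m ℚ.* ℕ→ℚ n            ≡⟨ cong (ℚ._+ ℕ→ℚ m ℚ.* ℕ→ℚ n) (ℚₚ.*-identityˡ (ℕ→ℚ n)) ⟨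
  1ℚ ℚ.* ℕ→ℚ n ℚ.+ ℕ→ℚ m ℚ.* ℕ→ℚ n     ≡⟨ ℚₚ.*-distribʳ-+ (ℕ→ℚ n) 1ℚ (ℕ→ℚ m) ⟨
  (1ℚ ℚ.+ ℕ→ℚ m) ℚ.* ℕ→ℚ n             ≡⟨ cong (ℚ._* ℕ→ℚ n) (ℕ→ℚ-suc m) ⟨
  ℕ→ℚ (suc m) ℚ.* ℕ→ℚ n                ∎
  where open ≡-Reasoning

ℕ→ℚ-^ : ∀ m k → ℕ→ℚ (m ℕ.^ k) ≡ ℕ→ℚ m ^ᵠ k
ℕ→ℚ-^ m zero    = refl
ℕ→ℚ-^ m (suc k) = trans (ℕ→ℚ-* m (m ℕ.^ k)) (cong (ℕ→ℚ m ℚ.*_) (ℕ→ℚ-^ m k))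

ℕ→ℚ-mono-≤ : ∀ {m n} → m ℕ.≤ n → ℕ→ℚ m ℚ.≤ ℕ→ℚ n
ℕ→ℚ-mono-≤ {m} {n} m≤n = subst (ℕ→ℚ m ℚ.≤_)
  (trans (sym (ℕ→ℚ-+ (n ℕ.∸ m) m)) (cong ℕ→ℚ (ℕₚ.m∸n+n≡m m≤n))) (p≤r+p (0≤ℕ→ℚ (n ℕ.∸ m)))

p<1+p : ∀ p → p ℚ.< 1ℚ ℚ.+ p
p<1+p p = subst (ℚ._< 1ℚ ℚ.+ p) (ℚₚ.+-identityˡ p) (ℚₚ.+-monoˡ-< p (ℚₚ.positive⁻¹ 1ℚ))

ℕ→ℚ-mono-< : ∀ {m n} → m ℕ.< n → ℕ→ℚ m ℚ.< ℕ→ℚ n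
ℕ→ℚ-mono-< {m} m<n = ℚₚ.<-≤-trans (p<1+p (ℕ→ℚ m)) (subst (ℚ._≤ _) (ℕ→ℚ-suc m) (ℕ→ℚ-mono-≤ m<n))

ℕ→ℚ-cancel-≤ : ∀ {m n} → ℕ→ℚ m ℚ.≤ ℕ→ℚ n → m ℕ.≤ n
ℕ→ℚ-cancel-≤ m≤n = ℕₚ.≮⇒≥ λ n<m → <⇒≱ᵠ (ℕ→ℚ-mono-< n<m) m≤n

ℕ→ℚ-injective : ∀ {m n} → ℕ→ℚ m ≡ ℕ→ℚ n → m ≡ n
ℕ→ℚ-injective eq = ℕₚ.≤-antisym (ℕ→ℚ-cancel-≤ (ℚₚ.≤-reflexive eq)) (ℕ→ℚ-cancel-≤ (ℚₚ.≤-reflexive (sym eq)))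

*-interchange : ∀ a b c d → (a ℚ.* b) ℚ.* (c ℚ.* d) ≡ (a ℚ.* c) ℚ.* (b ℚ.* d)
*-interchange = solve 4 (λ a b c d → (a :* b) :* (c :* d) := (a :* c) :* (b :* d)) refl

^ᵠ-+ : ∀ a j k → a ^ᵠ (j ℕ.+ k) ≡ a ^ᵠ j ℚ.* a ^ᵠ k
^ᵠ-+ a zero    k = sym (ℚₚ.*-identityˡ (a ^ᵠ k))
^ᵠ-+ a (suc j) k = trans (cong (a ℚ.*_) (^ᵠ-+ a j k)) (sym (ℚₚ.*-assoc a (a ^ᵠ j) (a ^ᵠ k)))

^ᵠ-distribʳ-* : ∀ a b k → (a ℚ.* b) ^ᵠ k ≡ a ^ᵠ k ℚ.* b ^ᵠ k
^ᵠ-distribʳ-* a b zero    = refl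
^ᵠ-distribʳ-* a b (suc k) = trans (cong (a ℚ.* b ℚ.*_) (^ᵠ-distribʳ-* a b k)) (*-interchange a b (a ^ᵠ k) (b ^ᵠ k))

0≤^ᵠ : ∀ {a} k → 0ℚ ℚ.≤ a → 0ℚ ℚ.≤ a ^ᵠ k
0≤^ᵠ zero    0≤a = 0≤1
0≤^ᵠ (suc k) 0≤a = 0≤* 0≤a (0≤^ᵠ k 0≤a)

0<^ᵠ : ∀ {a} k → 0ℚ ℚ.< a → 0ℚ ℚ.< a ^ᵠ k
0<^ᵠ zero    0<a = ℚₚ.positive⁻¹ 1ℚ
0<^ᵠ (suc k) 0<a = 0<* 0<a (0<^ᵠ k 0<a)

^ᵠ-mono-≤ : ∀ {a b} k → 0ℚ ℚ.≤ a → a ℚ.≤ b → a ^ᵠ k ℚ.≤ b ^ᵠ k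
^ᵠ-mono-≤ zero    0≤a a≤b = ℚₚ.≤-refl
^ᵠ-mono-≤ (suc k) 0≤a a≤b = *-mono-≤ 0≤a (0≤^ᵠ k (ℚₚ.≤-trans 0≤a a≤b)) a≤b (^ᵠ-mono-≤ k 0≤a a≤b)

^ᵠ-cancel-≤ : ∀ {a b} k → 0ℚ ℚ.≤ b → a ^ᵠ suc k ℚ.≤ b ^ᵠ suc k → a ℚ.≤ b
^ᵠ-cancel-≤ {a} {b} k 0≤b a^≤b^ = ℚₚ.≮⇒≥ λ b<a → <⇒≱ᵠ (begin-strict
  b ℚ.* b ^ᵠ k   ≤⟨ *-monoˡᵠ b 0≤b (^ᵠ-mono-≤ k 0≤b (ℚₚ.<⇒≤ b<a)) ⟩
  b ℚ.* a ^ᵠ k   <⟨ ℚₚ.*-monoˡ-<-pos (a ^ᵠ k) {{ℚ.positive (0<^ᵠ k (ℚₚ.≤-<-trans 0≤b b<a))}} b<a ⟩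
  a ℚ.* a ^ᵠ k   ∎) a^≤b^
  where open ℚₚ.≤-Reasoning

-- φ behaves like a polynomial of degree at most d with nonnegative coefficients.
record Growth (d : ℕ) (φ : ℚ → ℚ) : Set where
  field
    nonneg : ∀ {z} → 0ℚ ℚ.≤ z → 0ℚ ℚ.≤ φ z
    mono   : ∀ {z w} → 0ℚ ℚ.≤ z → z ℚ.≤ w → φ z ℚ.≤ φ w
    subhom : ∀ {z w} → 0ℚ ℚ.≤ z → z ℚ.≤ w → z ^ᵠ d ℚ.* φ w ℚ.≤ w ^ᵠ d ℚ.* φ z

open Growth

growth-const : ∀ {a} → 0ℚ ℚ.≤ a → Growth 0 (λ _ → a)
growth-const 0≤a .nonneg _   = 0≤a
growth-const 0≤a .mono   _ _ = ℚₚ.≤-refl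
growth-const 0≤a .subhom _ _ = ℚₚ.≤-refl

growth-id : Growth 1 (λ z → z)
growth-id .nonneg 0≤z   = 0≤z
growth-id .mono   _ z≤w = z≤w
growth-id .subhom {z} {w} _ _ = ℚₚ.≤-reflexive
  (solve 2 (λ z w → (z :* con 1ℚ) :* w := (w :* con 1ℚ) :* z) refl z w)

growth-+ : ∀ {d φ ψ} → Growth d φ → Growth d ψ → Growth d (λ z → φ z ℚ.+ ψ z)
growth-+ Φ Ψ .nonneg 0≤z     = 0≤+ (nonneg Φ 0≤z) (nonneg Ψ 0≤z)
growth-+ Φ Ψ .mono   0≤z z≤w = ℚₚ.+-mono-≤ (mono Φ 0≤z z≤w) (mono Ψ 0≤z z≤w)
growth-+ {d} {φ} {ψ} Φ Ψ .subhom {z} {w} 0≤z z≤w = subst₂ ℚ._≤_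
  (sym (ℚₚ.*-distribˡ-+ (z ^ᵠ d) (φ w) (ψ w))) (sym (ℚₚ.*-distribˡ-+ (w ^ᵠ d) (φ z) (ψ z)))
  (ℚₚ.+-mono-≤ (subhom Φ 0≤z z≤w) (subhom Ψ 0≤z z≤w))

growth-* : ∀ {c d φ ψ} → Growth c φ → Growth d ψ → Growth (c ℕ.+ d) (λ z → φ z ℚ.* ψ z)
growth-* Φ Ψ .nonneg 0≤z     = 0≤* (nonneg Φ 0≤z) (nonneg Ψ 0≤z)
growth-* Φ Ψ .mono   0≤z z≤w =
  *-mono-≤ (nonneg Φ 0≤z) (nonneg Ψ (ℚₚ.≤-trans 0≤z z≤w)) (mono Φ 0≤z z≤w) (mono Ψ 0≤z z≤w)
growth-* {c} {d} {φ} {ψ} Φ Ψ .subhom {z} {w} 0≤z z≤w = subst₂ ℚ._≤_ (eq z w) (eq w z)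
  (*-mono-≤ (0≤* (0≤^ᵠ c 0≤z) (nonneg Φ 0≤w)) (0≤* (0≤^ᵠ d 0≤w) (nonneg Ψ 0≤z))
    (subhom Φ 0≤z z≤w) (subhom Ψ 0≤z z≤w))
  where
  0≤w = ℚₚ.≤-trans 0≤z z≤w
  eq : ∀ z w → (z ^ᵠ c ℚ.* φ w) ℚ.* (z ^ᵠ d ℚ.* ψ w) ≡ z ^ᵠ (c ℕ.+ d) ℚ.* (φ w ℚ.* ψ w)
  eq z w = trans (*-interchange (z ^ᵠ c) (φ w) (z ^ᵠ d) (ψ w)) (cong (ℚ._* (φ w ℚ.* ψ w)) (sym (^ᵠ-+ z c d)))

-- Sums require equal degrees, so lower-order summands are assigned the degree of the leading one.
growth-weaken : ∀ k {d φ} → Growth d φ → Growth (k ℕ.+ d) φ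
growth-weaken k Φ .nonneg = nonneg Φ
growth-weaken k Φ .mono   = mono Φ
growth-weaken k {d} {φ} Φ .subhom {z} {w} 0≤z z≤w = subst₂ ℚ._≤_ (eq z (φ w)) (eq w (φ z))
  (*-mono-≤ (0≤^ᵠ k 0≤z) (0≤* (0≤^ᵠ d 0≤w) (nonneg Φ 0≤z)) (^ᵠ-mono-≤ k 0≤z z≤w) (subhom Φ 0≤z z≤w))
  where
  0≤w = ℚₚ.≤-trans 0≤z z≤w
  eq : ∀ z a → z ^ᵠ k ℚ.* (z ^ᵠ d ℚ.* a) ≡ z ^ᵠ (k ℕ.+ d) ℚ.* a
  eq z a = trans (sym (ℚₚ.*-assoc (z ^ᵠ k) (z ^ᵠ d) a)) (cong (ℚ._* a) (sym (^ᵠ-+ z k d)))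

growth-^ : ∀ k → Growth k (_^ᵠ k)
growth-^ zero    = growth-const 0≤1
growth-^ (suc k) = growth-* growth-id (growth-^ k)

growth-· : ∀ m {d φ} → Growth d φ → Growth d (λ z → m ·ᵠ φ z)
growth-· zero    {d} {φ} Φ .nonneg _   = ℚₚ.≤-refl
growth-· zero    {d} {φ} Φ .mono   _ _ = ℚₚ.≤-refl
growth-· zero    {d} {φ} Φ .subhom {z} {w} _ _ = ℚₚ.≤-reflexive (trans (ℚₚ.*-zeroʳ (z ^ᵠ d)) (sym (ℚₚ.*-zeroʳ (w ^ᵠ d))))
growth-· (suc m) Φ = growth-+ Φ (growth-· m Φ)

growth-𝒞 : Growth 4 Q.𝒞
growth-𝒞 = growth-* (growth-const (ℚₚ.<⇒≤ (ℚₚ.positive⁻¹ ½))) (growth-+ (growth-+ (growth-+ (growth-+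
  (growth-^ 4) (growth-weaken 1 (growth-· 2 (growth-^ 3)))) (growth-weaken 2 (growth-· 5 (growth-^ 2))))
  (growth-weaken 3 (growth-· 5 growth-id))) (growth-weaken 4 (growth-· 4 (growth-const 0≤1))))

growth-𝒬 : Growth 7 𝒬ᵠ
growth-𝒬 = growth-* (growth-* (growth-+ growth-id (growth-weaken 1 (growth-const 0≤1)))
  (growth-+ (growth-+ (growth-^ 2) (growth-weaken 1 growth-id)) (growth-weaken 2 (growth-· 3 (growth-const 0≤1)))))
  growth-𝒞

-- For `z ≤ h`, multiply by `h ^ d`: then `(X h) ^ d ≤ (φ z · z) ^ d`, and subhomogeneity exchanges
-- `z ^ d · φ h` for `h ^ d · φ z`. Keeping one factor `φ h` on the left, rather than weakening it
-- to `X`, serves the equality case.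
power-bound : ∀ {d φ X h z} → Growth d φ → 0ℚ ℚ.≤ X → 0ℚ ℚ.< h → 0ℚ ℚ.≤ z → X ℚ.≤ φ h →
  (z ℚ.≤ h → X ℚ.* h ℚ.≤ φ z ℚ.* z) → X ^ᵠ d ℚ.* φ h ℚ.≤ φ z ^ᵠ suc d
power-bound {d} {φ} {X} {h} {z} Φ 0≤X 0<h 0≤z X≤φh step with ℚₚ.≤-total z h
... | inj₂ h≤z = begin
  X ^ᵠ d ℚ.* φ h      ≤⟨ *-mono-≤ (0≤^ᵠ d 0≤X) (nonneg Φ 0≤z) (^ᵠ-mono-≤ d 0≤X (ℚₚ.≤-trans X≤φh φh≤φz)) φh≤φz ⟩
  φ z ^ᵠ d ℚ.* φ z    ≡⟨ ℚₚ.*-comm (φ z ^ᵠ d) (φ z) ⟩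
  φ z ^ᵠ suc d        ∎
  where
  open ℚₚ.≤-Reasoning
  φh≤φz = mono Φ (ℚₚ.<⇒≤ 0<h) h≤z
... | inj₁ z≤h = *-cancelˡᵠ (h ^ᵠ d) (0<^ᵠ d 0<h) (begin
  h ^ᵠ d ℚ.* (X ^ᵠ d ℚ.* φ h)       ≡⟨ ℚₚ.*-assoc (h ^ᵠ d) (X ^ᵠ d) (φ h) ⟨
  h ^ᵠ d ℚ.* X ^ᵠ d ℚ.* φ h         ≡⟨ cong (ℚ._* φ h) (trans (ℚₚ.*-comm (h ^ᵠ d) (X ^ᵠ d)) (sym (^ᵠ-distribʳ-* X h d))) ⟩
  (X ℚ.* h) ^ᵠ d ℚ.* φ h            ≤⟨ *-monoʳᵠ (φ h) (nonneg Φ 0≤h) (^ᵠ-mono-≤ d (0≤* 0≤X 0≤h) (step z≤h)) ⟩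
  (φ z ℚ.* z) ^ᵠ d ℚ.* φ h          ≡⟨ cong (ℚ._* φ h) (^ᵠ-distribʳ-* (φ z) z d) ⟩
  φ z ^ᵠ d ℚ.* z ^ᵠ d ℚ.* φ h       ≡⟨ ℚₚ.*-assoc (φ z ^ᵠ d) (z ^ᵠ d) (φ h) ⟩
  φ z ^ᵠ d ℚ.* (z ^ᵠ d ℚ.* φ h)     ≤⟨ *-monoˡᵠ (φ z ^ᵠ d) (0≤^ᵠ d (nonneg Φ 0≤z)) (subhom Φ 0≤z z≤h) ⟩
  φ z ^ᵠ d ℚ.* (h ^ᵠ d ℚ.* φ z)     ≡⟨ solve 3 (λ x y w → x :* (y :* w) := y :* (w :* x)) refl (φ z ^ᵠ d) (h ^ᵠ d) (φ z) ⟩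
  h ^ᵠ d ℚ.* φ z ^ᵠ suc d           ∎)
  where
  open ℚₚ.≤-Reasoning
  0≤h = ℚₚ.<⇒≤ 0<h

-- Bounds for real numbers given by bisection

≤ᴿ-reflexive : ∀ {x y} → x ≃ y → x ≤ᴿ y
≤ᴿ-reflexive {x} {y} x≃y ε 0<ε = let N , h = x≃y ε 0<ε in N , λ n N≤n → begin
  seq x n                                  ≡⟨ solve 2 (λ a b → a := b :+ (a :- b)) refl (seq x n) (seq y n) ⟩
  seq y n ℚ.+ (seq x n ℚ.- seq y n)        ≤⟨ ℚₚ.+-monoʳ-≤ (seq y n) (ℚₚ.≤-trans (p≤∣p∣ (seq x n ℚ.- seq y n)) (h n N≤n)) ⟩
  seq y n ℚ.+ ε                            ∎
  where
  open ℚₚ.≤-Reasoning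

≤ᴿ-trans : ∀ {x y z} → x ≤ᴿ y → y ≤ᴿ z → x ≤ᴿ z
≤ᴿ-trans {x} {y} {z} x≤y y≤z ε 0<ε =
  let N  , h  = x≤y (½ ℚ.* ε) (0<½ε 0<ε)
      N′ , h′ = y≤z (½ ℚ.* ε) (0<½ε 0<ε)
  in N ℕ.⊔ N′ , λ n n≥ → begin
    seq x n                                  ≤⟨ h n (ℕₚ.m⊔n≤o⇒m≤o N N′ n≥) ⟩
    seq y n ℚ.+ ½ ℚ.* ε                      ≤⟨ ℚₚ.+-monoˡ-≤ (½ ℚ.* ε) (h′ n (ℕₚ.m⊔n≤o⇒n≤o N N′ n≥)) ⟩
    seq z n ℚ.+ ½ ℚ.* ε ℚ.+ ½ ℚ.* ε          ≡⟨ ℚₚ.+-assoc (seq z n) (½ ℚ.* ε) (½ ℚ.* ε) ⟩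
    seq z n ℚ.+ (½ ℚ.* ε ℚ.+ ½ ℚ.* ε)        ≡⟨ cong (seq z n ℚ.+_) (½ε+½ε≡ε ε) ⟩
    seq z n ℚ.+ ε                            ∎
  where open ℚₚ.≤-Reasoning

≤ᴿ-pointwise : ∀ {x y} → (∀ n → seq x n ℚ.≤ seq y n) → x ≤ᴿ y
≤ᴿ-pointwise {x} {y} x≤y ε 0<ε = 0 , λ n _ → ℚₚ.≤-trans (x≤y n)
  (subst (ℚ._≤ seq y n ℚ.+ ε) (ℚₚ.+-identityʳ (seq y n)) (ℚₚ.+-monoʳ-≤ (seq y n) (ℚₚ.<⇒≤ 0<ε)))

≤ᴿ-antisym : ∀ {x y} → x ≤ᴿ y → y ≤ᴿ x → x ≃ y
≤ᴿ-antisym {x} {y} x≤y y≤x ε 0<ε =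
  let N  , h  = x≤y ε 0<ε
      N′ , h′ = y≤x ε 0<ε
  in N ℕ.⊔ N′ , λ n n≥ → subst (∣ seq x n ℚ.- seq y n ∣ ℚ.≤_)
       (solve 2 (λ b e → (b :+ e) :- b := e) refl (seq y n) ε)
       (dist (seq x n) (seq y n) (h n (ℕₚ.m⊔n≤o⇒m≤o N N′ n≥)) (h′ n (ℕₚ.m⊔n≤o⇒n≤o N N′ n≥)))
  where
  b≤b+ε : ∀ b → b ℚ.≤ b ℚ.+ ε
  b≤b+ε b = subst (ℚ._≤ b ℚ.+ ε) (ℚₚ.+-identityʳ b) (ℚₚ.+-monoʳ-≤ b (ℚₚ.<⇒≤ 0<ε))
  dist : ∀ a b → a ℚ.≤ b ℚ.+ ε → b ℚ.≤ a ℚ.+ ε → ∣ a ℚ.- b ∣ ℚ.≤ (b ℚ.+ ε) ℚ.- b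
  dist a b a≤b+ε b≤a+ε with ℚₚ.≤-total a b
  ... | inj₂ b≤a = ∣a-b∣≤u-l b≤a a≤b+ε ℚₚ.≤-refl (b≤b+ε b)
  ... | inj₁ a≤b = subst (∣ a ℚ.- b ∣ ℚ.≤_) (solve 3 (λ a b e → (a :+ e) :- a := (b :+ e) :- b) refl a b ε)
                     (∣a-b∣≤u-l ℚₚ.≤-refl (b≤b+ε a) a≤b b≤a+ε)

≃-sym : ∀ {x y} → x ≃ y → y ≃ x
≃-sym {x} {y} x≃y ε 0<ε = let N , h = x≃y ε 0<ε in N , λ n N≤n →
  subst (ℚ._≤ ε) (∣p-q∣≡∣q-p∣ (seq x n) (seq y n)) (h n N≤n)

-- If `b < a`, the tolerance `½ (a - b)` is too small for the constant sequences to satisfy the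
-- relation.
ℚ→ℝ-cancel-≤ : ∀ {a b} → ℚ→ℝ a ≤ᴿ ℚ→ℝ b → a ℚ.≤ b
ℚ→ℝ-cancel-≤ {a} {b} a≤b = ℚₚ.≮⇒≥ λ b<a →
  let d    = a ℚ.- b
      0<d  = subst (ℚ._< d) (ℚₚ.+-inverseʳ b) (ℚₚ.+-monoˡ-< (ℚ.- b) b<a)
      0<½d = 0<½ε 0<d
      N , h = a≤b (½ ℚ.* d) 0<½d
  in <⇒≱ᵠ (begin-strict
    b ℚ.+ ½ ℚ.* d                   ≡⟨ ℚₚ.+-identityʳ (b ℚ.+ ½ ℚ.* d) ⟨
    b ℚ.+ ½ ℚ.* d ℚ.+ 0ℚ            <⟨ ℚₚ.+-monoʳ-< (b ℚ.+ ½ ℚ.* d) 0<½d ⟩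
    b ℚ.+ ½ ℚ.* d ℚ.+ ½ ℚ.* d       ≡⟨ solve 2 (λ a b → b :+ con ½ :* (a :- b) :+ con ½ :* (a :- b) := a) refl a b ⟩
    a                               ∎) (h N ℕₚ.≤-refl)
  where
  open ℚₚ.≤-Reasoning

-- The value of `n` at `e = 2` as a function of `v = c h`.
quad : ℚ → ℚ
quad v = (1ℚ ℚ.+ (v ℚ.+ v)) ℚ.* (1ℚ ℚ.+ v)

0≤1+ : ∀ {v} → 0ℚ ℚ.≤ v → 0ℚ ℚ.≤ 1ℚ ℚ.+ v
0≤1+ = 0≤+ 0≤1

quad-mono-< : ∀ {v w} → 0ℚ ℚ.≤ v → v ℚ.< w → quad v ℚ.< quad w
quad-mono-< {v} {w} 0≤v v<w = begin-strict
  (1ℚ ℚ.+ (v ℚ.+ v)) ℚ.* (1ℚ ℚ.+ v)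
    ≤⟨ *-monoˡᵠ (1ℚ ℚ.+ (v ℚ.+ v)) (0≤1+ (0≤+ 0≤v 0≤v)) (ℚₚ.+-monoʳ-≤ 1ℚ (ℚₚ.<⇒≤ v<w)) ⟩
  (1ℚ ℚ.+ (v ℚ.+ v)) ℚ.* (1ℚ ℚ.+ w)
    <⟨ ℚₚ.*-monoˡ-<-pos (1ℚ ℚ.+ w) {{ℚ.positive (ℚₚ.+-mono-<-≤ (ℚₚ.positive⁻¹ 1ℚ) (ℚₚ.≤-trans 0≤v (ℚₚ.<⇒≤ v<w)))}}
         (ℚₚ.+-monoʳ-< 1ℚ (ℚₚ.+-mono-< v<w v<w)) ⟩
  (1ℚ ℚ.+ (w ℚ.+ w)) ℚ.* (1ℚ ℚ.+ w) ∎
  where open ℚₚ.≤-Reasoning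

quad-cancel-≤ : ∀ {v w} → 0ℚ ℚ.≤ w → quad v ℚ.≤ quad w → v ℚ.≤ w
quad-cancel-≤ 0≤w qv≤qw = ℚₚ.≮⇒≥ λ w<v → <⇒≱ᵠ (quad-mono-< 0≤w w<v) qv≤qw

v≤quad[v] : ∀ {v} → 0ℚ ℚ.≤ v → v ℚ.≤ quad v
v≤quad[v] {v} 0≤v = begin
  v                    ≤⟨ ℚₚ.<⇒≤ (p<1+p v) ⟩
  1ℚ ℚ.+ v             ≡⟨ ℚₚ.*-identityˡ (1ℚ ℚ.+ v) ⟨
  1ℚ ℚ.* (1ℚ ℚ.+ v)    ≤⟨ *-monoʳᵠ (1ℚ ℚ.+ v) (0≤1+ 0≤v) (ℚₚ.+-monoʳ-≤ 1ℚ (0≤+ 0≤v 0≤v)) ⟩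
  quad v               ∎
  where open ℚₚ.≤-Reasoning

1≤𝒞 : ∀ {z} → 0ℚ ℚ.≤ z → 1ℚ ℚ.≤ Q.𝒞 z
-- `Q.𝒞 0ℚ` is 2, so the comparison at 0 is decided by evaluation and monotonicity does the rest.
1≤𝒞 0≤z = ℚₚ.≤-trans (from-yes (1ℚ ℚₚ.≤? Q.𝒞 0ℚ)) (Growth.mono growth-𝒞 ℚₚ.≤-refl 0≤z)

0≤𝒞*z : ∀ {z} → 0ℚ ℚ.≤ z → 0ℚ ℚ.≤ Q.𝒞 z ℚ.* z
0≤𝒞*z 0≤z = 0≤* (Growth.nonneg growth-𝒞 0≤z) 0≤z

𝒩-mono-< : ∀ {z w} → 0ℚ ℚ.≤ z → z ℚ.< w → Q.𝒩 z ℚ.< Q.𝒩 w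
𝒩-mono-< {z} {w} 0≤z z<w = subst₂ ℚ._<_ (sym (𝒩-factors z)) (sym (𝒩-factors w))
  (quad-mono-< (0≤𝒞*z 0≤z) (begin-strict
    Q.𝒞 z ℚ.* z   ≤⟨ *-monoʳᵠ z 0≤z (Growth.mono growth-𝒞 0≤z (ℚₚ.<⇒≤ z<w)) ⟩
    Q.𝒞 w ℚ.* z   <⟨ ℚₚ.*-monoʳ-<-pos (Q.𝒞 w)
                    {{ℚ.positive (ℚₚ.<-≤-trans (ℚₚ.positive⁻¹ 1ℚ) (1≤𝒞 (ℚₚ.≤-trans 0≤z (ℚₚ.<⇒≤ z<w))))}} z<w ⟩
    Q.𝒞 w ℚ.* w   ∎))
  where open ℚₚ.≤-Reasoning

-- Estimates at `𝒩⁻¹ n`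

module 𝒩-Inverse (n : ℕ) (1≤n : 1 ℕ.≤ n) where
  open Bisection Q.𝒩 (ℕ→ℚ n) public

  0≤lo : ∀ k → 0ℚ ℚ.≤ lo k
  0≤lo k = proj₁ (nested {0} {k} ℕ.z≤n)

  0≤hi : ∀ k → 0ℚ ℚ.≤ hi k
  0≤hi k = ℚₚ.≤-trans (0≤lo k) (lo≤hi k)

  𝒩-brackets : ∀ k → Q.𝒩 (lo k) ℚ.≤ ℕ→ℚ n × ℕ→ℚ n ℚ.≤ Q.𝒩 (hi k)
  -- At the left end `Q.𝒩 0ℚ` evaluates to 1; at the right end `u ≤ 𝒞 u · u`, which `quad` only
  -- increases.
  𝒩-brackets = brackets (ℕ→ℚ-mono-≤ 1≤n) (begin
    ℕ→ℚ n                ≤⟨ p≤∣p∣ (ℕ→ℚ n) ⟩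
    ∣ ℕ→ℚ n ∣            ≤⟨ ℚₚ.<⇒≤ (p<1+p ∣ ℕ→ℚ n ∣) ⟩
    u                    ≡⟨ ℚₚ.*-identityˡ u ⟨
    1ℚ ℚ.* u             ≤⟨ *-monoʳᵠ u 0≤u (1≤𝒞 0≤u) ⟩
    Q.𝒞 u ℚ.* u          ≤⟨ v≤quad[v] (0≤𝒞*z 0≤u) ⟩
    quad (Q.𝒞 u ℚ.* u)   ≡⟨ 𝒩-factors u ⟨
    Q.𝒩 u                ∎)
    where
    open ℚₚ.≤-Reasoning
    u   = 1ℚ ℚ.+ ∣ ℕ→ℚ n ∣
    0≤u = ℚₚ.<⇒≤ (0<1+∣p∣ (ℕ→ℚ n))

  module _ {g φ} (L : Lifts g φ) where

    -- The upper endpoints of the bisection satisfy `n ≤ 𝒩 z`, so the rational hypothesis applies to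
    -- each of them, and their limit equals `𝒩⁻¹ n`.
    lower-bound : ∀ {X} → (∀ z → 0ℚ ℚ.≤ z → ℕ→ℚ n ℚ.≤ Q.𝒩 z → X ℚ.≤ φ z) → ℚ→ℝ X ≤ᴿ g (𝒩⁻¹ n)
    lower-bound {X} X≤φ = ≤ᴿ-trans {ℚ→ℝ X} {g upper} {g solution}
      (≤ᴿ-pointwise {ℚ→ℝ X} {g upper} λ k → subst (X ℚ.≤_) (sym (Lifts.pointwise L upper k))
        (X≤φ (hi k) (0≤hi k) (proj₂ (𝒩-brackets k))))
      (≤ᴿ-reflexive {g upper} {g solution} (≃-sym {g solution} {g upper} (Lifts.g-cong L solution≃upper)))

    upper-bound : ∀ {X} → (∀ z → 0ℚ ℚ.≤ z → Q.𝒩 z ℚ.≤ ℕ→ℚ n → φ z ℚ.≤ X) → g (𝒩⁻¹ n) ≤ᴿ ℚ→ℝ X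
    upper-bound {X} φ≤X = ≤ᴿ-pointwise {g solution} {ℚ→ℝ X} λ k → subst (ℚ._≤ X) (sym (Lifts.pointwise L solution k))
      (φ≤X (lo k) (0≤lo k) (proj₁ (𝒩-brackets k)))

  -- The common argument for both bounds, applied with `X = c` and `φ = 𝒞` of degree 4, and with
  -- `X = a b c` and `φ = 𝒜 ℬ 𝒞` of degree 7.
  module Extremum {g φ d h X} (L : Lifts g φ) (Φ : Growth d φ) (0<h : 0ℚ ℚ.< h) (0<X : 0ℚ ℚ.< X) (X≤φh : X ℚ.≤ φ h)
    (step : ∀ z → 0ℚ ℚ.≤ z → z ℚ.≤ h → ℕ→ℚ n ℚ.≤ Q.𝒩 z → X ℚ.* h ℚ.≤ φ z ℚ.* z) where

    private
      powers : ∀ z → 0ℚ ℚ.≤ z → ℕ→ℚ n ℚ.≤ Q.𝒩 z → X ^ᵠ d ℚ.* φ h ℚ.≤ φ z ^ᵠ suc d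
      powers z 0≤z n≤𝒩z = power-bound Φ (ℚₚ.<⇒≤ 0<X) 0<h 0≤z X≤φh (λ z≤h → step z 0≤z z≤h n≤𝒩z)

    bound : ℚ→ℝ X ≤ᴿ g (𝒩⁻¹ n)
    bound = lower-bound L λ z 0≤z n≤𝒩z → ^ᵠ-cancel-≤ d (Growth.nonneg Φ 0≤z) (begin
      X ^ᵠ suc d          ≡⟨ ℚₚ.*-comm X (X ^ᵠ d) ⟩
      X ^ᵠ d ℚ.* X        ≤⟨ *-monoˡᵠ (X ^ᵠ d) (0≤^ᵠ d (ℚₚ.<⇒≤ 0<X)) X≤φh ⟩
      X ^ᵠ d ℚ.* φ h      ≤⟨ powers z 0≤z n≤𝒩z ⟩
      φ z ^ᵠ suc d        ∎)
      where open ℚₚ.≤-Reasoning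

    -- The rational inequality of `powers` passes to the limit as
    -- `X ^ d · φ h ≤ g (𝒩⁻¹ n) ^ (d + 1)`; under equality the right side is `X ^ (d + 1)`, and
    -- `X ^ d` cancels.
    attained⇒ : ℚ→ℝ X ≃ g (𝒩⁻¹ n) → φ h ℚ.≤ X
    attained⇒ X≃ = *-cancelˡᵠ (X ^ᵠ d) (0<^ᵠ d 0<X) (subst (X ^ᵠ d ℚ.* φ h ℚ.≤_) (ℚₚ.*-comm X (X ^ᵠ d))
      (ℚ→ℝ-cancel-≤ (≤ᴿ-trans {ℚ→ℝ (X ^ᵠ d ℚ.* φ h)} {g (𝒩⁻¹ n) ^ᴿ suc d} {ℚ→ℝ (X ^ᵠ suc d)}
        (lower-bound (lifts-^ (suc d) L) powers)
        (≤ᴿ-trans {g (𝒩⁻¹ n) ^ᴿ suc d} {ℚ→ℝ X ^ᴿ suc d} {ℚ→ℝ (X ^ᵠ suc d)}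
          (≤ᴿ-reflexive {g (𝒩⁻¹ n) ^ᴿ suc d} {ℚ→ℝ X ^ᴿ suc d}
            (Lifts.g-cong power {g (𝒩⁻¹ n)} {ℚ→ℝ X} (≃-sym {ℚ→ℝ X} {g (𝒩⁻¹ n)} X≃)))
          (≤ᴿ-pointwise {ℚ→ℝ X ^ᴿ suc d} {ℚ→ℝ (X ^ᵠ suc d)} λ k →
            ℚₚ.≤-reflexive (Lifts.pointwise power (ℚ→ℝ X) k))))))
      where power = lifts-^ (suc d) lifts-id

    -- When `n = 𝒩 h`, strict monotonicity of `𝒩` shows that every `z ≥ 0` with `𝒩 z ≤ n` is at most
    -- `h`, so `φ z ≤ φ h = X`.
    attained⇐ : ℕ→ℚ n ≡ Q.𝒩 h → φ h ≡ X → ℚ→ℝ X ≃ g (𝒩⁻¹ n)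
    attained⇐ n≡𝒩h φh≡X = ≤ᴿ-antisym {ℚ→ℝ X} {g (𝒩⁻¹ n)} bound
      (upper-bound L λ z 0≤z 𝒩z≤n → subst (φ z ℚ.≤_) φh≡X (Growth.mono Φ 0≤z
        (ℚₚ.≮⇒≥ λ h<z → <⇒≱ᵠ (𝒩-mono-< (ℚₚ.<⇒≤ 0<h) h<z) (subst (Q.𝒩 z ℚ.≤_) n≡𝒩h 𝒩z≤n))))

-- Roots and the asymptotic error term

/-* : ∀ m n .{{_ : NonZero n}} → (+ m / n) ℚ.* ℕ→ℚ n ≡ ℕ→ℚ m
/-* m n@(suc k) = ℚₚ.toℚᵘ-injective (begin
  ℚ.toℚᵘ ((+ m / n) ℚ.* ℕ→ℚ n)             ≈⟨ ℚₚ.toℚᵘ-homo-* (+ m / n) (ℕ→ℚ n) ⟩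
  ℚ.toℚᵘ (+ m / n) ℚᵘ.* ℚ.toℚᵘ (ℕ→ℚ n)     ≈⟨ ℚᵘₚ.*-cong (ℚₚ.toℚᵘ-fromℚᵘ (mkℚᵘ (+ m) k)) (toℚᵘ-ℕ→ℚ n) ⟩
  mkℚᵘ (+ m) k ℚᵘ.* mkℚᵘ (+ n) 0           ≈⟨ ℚᵘ.*≡* (trans (ℤₚ.*-identityʳ _)
                                                (cong (+ m ℤ.*_) (cong +_ (sym (ℕₚ.*-identityʳ n))))) ⟩
  mkℚᵘ (+ m) 0                             ≈⟨ toℚᵘ-ℕ→ℚ m ⟨
  ℚ.toℚᵘ (ℕ→ℚ m)                           ∎)
  where open import Relation.Binary.Reasoning.Setoid ℚᵘₚ.≃-setoid

0<ℕ→ℚ : ∀ n .{{_ : NonZero n}} → 0ℚ ℚ.< ℕ→ℚ n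
0<ℕ→ℚ n = ℕ→ℚ-mono-< (ℕ.>-nonZero⁻¹ n)

0≤/ : ∀ m n .{{_ : NonZero n}} → 0ℚ ℚ.≤ + m / n
0≤/ m n = *-cancelʳᵠ (ℕ→ℚ n) (0<ℕ→ℚ n)
  (subst₂ ℚ._≤_ (sym (ℚₚ.*-zeroˡ (ℕ→ℚ n))) (sym (/-* m n)) (0≤ℕ→ℚ m))

root-upper : ∀ k t → 0ℚ ℚ.≤ t → ∀ i →
  0ℚ ℚ.≤ Bisection.hi (_^ᵠ suc k) t i × t ℚ.≤ Bisection.hi (_^ᵠ suc k) t i ^ᵠ suc k
root-upper k t 0≤t i = ℚₚ.≤-trans (proj₁ (nested {0} {i} ℕ.z≤n)) (lo≤hi i) ,
  proj₂ (brackets (subst (ℚ._≤ t) (sym (ℚₚ.*-zeroˡ (0ℚ ^ᵠ k))) 0≤t) (begin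
    t                  ≤⟨ p≤∣p∣ t ⟩
    ∣ t ∣              ≤⟨ ℚₚ.<⇒≤ (p<1+p ∣ t ∣) ⟩
    b                  ≡⟨ ℚₚ.*-identityʳ b ⟨
    b ℚ.* 1ℚ           ≤⟨ *-monoˡᵠ b (ℚₚ.<⇒≤ (0<1+∣p∣ t)) (1≤^ᵠ k (ℚₚ.+-monoʳ-≤ 1ℚ (ℚₚ.0≤∣p∣ t))) ⟩
    b ^ᵠ suc k         ∎) i)
  where
  open Bisection (_^ᵠ suc k) t
  open ℚₚ.≤-Reasoning
  b = 1ℚ ℚ.+ ∣ t ∣

-- The upper endpoints `a`, `b` of the two bisections have powers at least `s` and `t`, so `X` is
-- bounded by `a b (1 + d)` at every stage; these endpoints converge to the roots.
root-bound : ∀ k {X s t d} → 0ℚ ℚ.≤ s → 0ℚ ℚ.≤ t → 0ℚ ℚ.≤ d → X ^ᵠ suc k ℚ.≤ s ℚ.* t ℚ.* (1ℚ ℚ.+ d) ^ᵠ suc k →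
  ℚ→ℝ X ≤ᴿ root (suc k) s *ᴿ root (suc k) t *ᴿ (ℚ→ℝ 1ℚ +ᴿ ℚ→ℝ d)
root-bound k {X} {s} {t} {d} 0≤s 0≤t 0≤d X^≤ =
  ≤ᴿ-trans {ℚ→ℝ X} {S.upper *ᴿ T.upper *ᴿ W} {S.solution *ᴿ T.solution *ᴿ W}
    (≤ᴿ-pointwise {ℚ→ℝ X} {S.upper *ᴿ T.upper *ᴿ W} X≤)
    (≤ᴿ-reflexive {S.upper *ᴿ T.upper *ᴿ W} {S.solution *ᴿ T.solution *ᴿ W}
      (≃-sym {S.solution *ᴿ T.solution *ᴿ W} {S.upper *ᴿ T.upper *ᴿ W}
        (*ᴿ-cong {S.solution *ᴿ T.solution} {S.upper *ᴿ T.upper} {W} {W}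
          (*ᴿ-cong {S.solution} {S.upper} {T.solution} {T.upper} S.solution≃upper T.solution≃upper) (≃-refl {W}))))
  where
  module S = Bisection (_^ᵠ suc k) s
  module T = Bisection (_^ᵠ suc k) t
  W = ℚ→ℝ 1ℚ +ᴿ ℚ→ℝ d
  w = 1ℚ ℚ.+ d
  X≤ : ∀ i → X ℚ.≤ S.hi i ℚ.* T.hi i ℚ.* w
  X≤ i = ^ᵠ-cancel-≤ k (0≤* (0≤* 0≤a 0≤b) (0≤1+ 0≤d)) (begin
    X ^ᵠ suc k                                ≤⟨ X^≤ ⟩
    s ℚ.* t ℚ.* w ^ᵠ suc k                    ≤⟨ *-monoʳᵠ (w ^ᵠ suc k) (0≤^ᵠ (suc k) (0≤1+ 0≤d))
                                                   (*-mono-≤ 0≤s (0≤^ᵠ (suc k) 0≤b) s≤ t≤) ⟩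
    a ^ᵠ suc k ℚ.* b ^ᵠ suc k ℚ.* w ^ᵠ suc k  ≡⟨ cong (ℚ._* w ^ᵠ suc k) (^ᵠ-distribʳ-* a b (suc k)) ⟨
    (a ℚ.* b) ^ᵠ suc k ℚ.* w ^ᵠ suc k         ≡⟨ ^ᵠ-distribʳ-* (a ℚ.* b) w (suc k) ⟨
    (a ℚ.* b ℚ.* w) ^ᵠ suc k                  ∎)
    where
    open ℚₚ.≤-Reasoning
    a = S.hi i
    b = T.hi i
    0≤a = proj₁ (root-upper k s 0≤s i)
    0≤b = proj₁ (root-upper k t 0≤t i)
    s≤  = proj₂ (root-upper k s 0≤s i)
    t≤  = proj₂ (root-upper k t 0≤t i)

-- The relative error is at most 16 / h, and 1 + ⌊log₂ n⌋ ≤ 11 h.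
error : ℕ → ℚ
error n = + 176 / suc ⌊log₂ n ⌋

0≤error : ∀ n → 0ℚ ℚ.≤ error n
0≤error n = 0≤/ 176 (suc ⌊log₂ n ⌋)

error-vanishes : Vanishes (λ n → ℚ→ℝ (error n))
-- Here `m` is a natural number at least `176 / ε`, and `n ≥ 2 ^ m` ensures `⌊log₂ n ⌋ ≥ m`.
error-vanishes ε 0<ε = 2 ℕ.^ m , λ n 2^m≤n →
  ≤ᴿ-pointwise {ℚ→ℝ (ℚ.- ε)} {ℚ→ℝ (error n)} (λ _ → ℚₚ.≤-trans (ℚₚ.neg-antimono-≤ (ℚₚ.<⇒≤ 0<ε)) (0≤error n)) ,
  ≤ᴿ-pointwise {ℚ→ℝ (error n)} {ℚ→ℝ ε} (λ _ → *-cancelʳᵠ (ℕ→ℚ (suc ⌊log₂ n ⌋)) (0<ℕ→ℚ (suc ⌊log₂ n ⌋)) (begin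
    error n ℚ.* ℕ→ℚ (suc ⌊log₂ n ⌋)   ≡⟨ /-* 176 (suc ⌊log₂ n ⌋) ⟩
    ℕ→ℚ 176                           ≡⟨ εa≡176 ⟨
    ε ℚ.* a                           ≤⟨ *-monoˡᵠ ε (ℚₚ.<⇒≤ 0<ε) (ℚₚ.≤-trans a≤m (ℕ→ℚ-mono-≤ (m≤n⇒m≤1+n
                                           (subst (ℕ._≤ ⌊log₂ n ⌋) (⌊log₂[2^n]⌋≡n m) (⌊log₂⌋-mono-≤ 2^m≤n))))) ⟩
    ε ℚ.* ℕ→ℚ (suc ⌊log₂ n ⌋)         ∎))
  where
  open ℚₚ.≤-Reasoning
  quot = divide ε (ℕ→ℚ 176) 0<ε (0<ℕ→ℚ 176)
  a = proj₁ quot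
  εa≡176 = proj₂ (proj₂ quot)
  m = proj₁ (archimedean a)
  a≤m = proj₂ (archimedean a)

h+16≤h[1+error] : ∀ h n → 1 ℕ.≤ h → ⌊log₂ n ⌋ ℕ.≤ 10 ℕ.* h → ℕ→ℚ (h ℕ.+ 16) ℚ.≤ ℕ→ℚ h ℚ.* (1ℚ ℚ.+ error n)
h+16≤h[1+error] h n 1≤h log≤ = begin
  ℕ→ℚ (h ℕ.+ 16)                          ≡⟨ ℕ→ℚ-+ h 16 ⟩
  ℕ→ℚ h ℚ.+ ℕ→ℚ 16                        ≤⟨ ℚₚ.+-monoʳ-≤ (ℕ→ℚ h) (*-cancelʳᵠ (ℕ→ℚ l) (0<ℕ→ℚ l) (begin
    ℕ→ℚ 16 ℚ.* ℕ→ℚ l                        ≡⟨ ℕ→ℚ-* 16 l ⟨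
    -- `1 ≤ h` absorbs the successor in `l`, so `l ≤ 11 h`, and `176 = 16 · 11`.
    ℕ→ℚ (16 ℕ.* l)                          ≤⟨ ℕ→ℚ-mono-≤ (ℕₚ.≤-trans (ℕₚ.*-monoʳ-≤ 16 (ℕₚ.+-mono-≤ 1≤h log≤))
                                                 (ℕₚ.≤-reflexive (trans (sym (ℕₚ.*-assoc 16 11 h)) (ℕₚ.*-comm 176 h)))) ⟩
    ℕ→ℚ (h ℕ.* 176)                         ≡⟨ ℕ→ℚ-* h 176 ⟩
    ℕ→ℚ h ℚ.* ℕ→ℚ 176                       ≡⟨ cong (ℕ→ℚ h ℚ.*_) (/-* 176 l) ⟨
    ℕ→ℚ h ℚ.* (error n ℚ.* ℕ→ℚ l)           ≡⟨ ℚₚ.*-assoc (ℕ→ℚ h) (error n) (ℕ→ℚ l) ⟨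
    ℕ→ℚ h ℚ.* error n ℚ.* ℕ→ℚ l             ∎)) ⟩
  ℕ→ℚ h ℚ.+ ℕ→ℚ h ℚ.* error n             ≡⟨ cong (ℚ._+ ℕ→ℚ h ℚ.* error n) (ℚₚ.*-identityʳ (ℕ→ℚ h)) ⟨
  ℕ→ℚ h ℚ.* 1ℚ ℚ.+ ℕ→ℚ h ℚ.* error n      ≡⟨ ℚₚ.*-distribˡ-+ (ℕ→ℚ h) 1ℚ (error n) ⟨
  ℕ→ℚ h ℚ.* (1ℚ ℚ.+ error n)              ∎
  where
  open ℚₚ.≤-Reasoning
  l = suc ⌊log₂ n ⌋

-- Cancelling 8 and the power of `h` turns the hypothesis into a bound on `X ^ suc j`, from which
-- `root-bound` extracts the root. The factor `1 / 8` is the source of the power `2 ^ (-3 / suc j)`.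
asymptotic : ∀ X h n j m → 1 ℕ.≤ h → ⌊log₂ n ⌋ ℕ.≤ 10 ℕ.* h →
  8 ℕ.* (X ℕ.* h) ℕ.^ suc j ℕ.≤ n ℕ.^ m ℕ.* (h ℕ.+ 16) ℕ.^ suc j →
  ℕ→ℝ X ≤ᴿ root (suc j) (+ 1 / 8) *ᴿ root (suc j) (ℕ→ℚ (n ℕ.^ m)) *ᴿ (ℚ→ℝ 1ℚ +ᴿ ℚ→ℝ (error n))
asymptotic X h n j m 1≤h log≤ 8[Xh]^≤ =
  root-bound j (0≤/ 1 8) (0≤ℕ→ℚ (n ℕ.^ m)) (0≤error n)
    (*-cancelʳᵠ (hᵠ ^ᵠ k) (0<^ᵠ k (0<ℕ→ℚ h {{ℕ.>-nonZero 1≤h}})) (*-cancelˡᵠ (ℕ→ℚ 8) (0<ℕ→ℚ 8) (begin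
      ℕ→ℚ 8 ℚ.* (ℕ→ℚ X ^ᵠ k ℚ.* hᵠ ^ᵠ k)
        ≡⟨ cong (ℕ→ℚ 8 ℚ.*_)
             (trans (sym (^ᵠ-distribʳ-* (ℕ→ℚ X) hᵠ k)) (trans (cong (_^ᵠ k) (sym (ℕ→ℚ-* X h))) (sym (ℕ→ℚ-^ (X ℕ.* h) k)))) ⟩
      ℕ→ℚ 8 ℚ.* ℕ→ℚ ((X ℕ.* h) ℕ.^ k)
        ≡⟨ ℕ→ℚ-* 8 ((X ℕ.* h) ℕ.^ k) ⟨
      ℕ→ℚ (8 ℕ.* (X ℕ.* h) ℕ.^ k)
        ≤⟨ ℕ→ℚ-mono-≤ 8[Xh]^≤ ⟩
      ℕ→ℚ (n ℕ.^ m ℕ.* (h ℕ.+ 16) ℕ.^ k)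
        ≡⟨ trans (ℕ→ℚ-* (n ℕ.^ m) ((h ℕ.+ 16) ℕ.^ k)) (cong (N ℚ.*_) (ℕ→ℚ-^ (h ℕ.+ 16) k)) ⟩
      N ℚ.* ℕ→ℚ (h ℕ.+ 16) ^ᵠ k
        ≤⟨ *-monoˡᵠ N (0≤ℕ→ℚ (n ℕ.^ m)) (^ᵠ-mono-≤ k (0≤ℕ→ℚ (h ℕ.+ 16)) (h+16≤h[1+error] h n 1≤h log≤)) ⟩
      N ℚ.* (hᵠ ℚ.* w) ^ᵠ k
        ≡⟨ cong (N ℚ.*_) (^ᵠ-distribʳ-* hᵠ w k) ⟩
      N ℚ.* (hᵠ ^ᵠ k ℚ.* w ^ᵠ k)
        ≡⟨ ℚₚ.*-identityˡ (N ℚ.* (hᵠ ^ᵠ k ℚ.* w ^ᵠ k)) ⟨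
      1ℚ ℚ.* (N ℚ.* (hᵠ ^ᵠ k ℚ.* w ^ᵠ k))
        ≡⟨ cong (ℚ._* (N ℚ.* (hᵠ ^ᵠ k ℚ.* w ^ᵠ k))) (/-* 1 8) ⟨
      (+ 1 / 8) ℚ.* ℕ→ℚ 8 ℚ.* (N ℚ.* (hᵠ ^ᵠ k ℚ.* w ^ᵠ k))
        ≡⟨ regroup (+ 1 / 8) (ℕ→ℚ 8) N (hᵠ ^ᵠ k) (w ^ᵠ k) ⟩
      ℕ→ℚ 8 ℚ.* ((+ 1 / 8) ℚ.* N ℚ.* w ^ᵠ k ℚ.* hᵠ ^ᵠ k) ∎)))
  where
  open ℚₚ.≤-Reasoning
  k = suc j
  hᵠ = ℕ→ℚ h
  N = ℕ→ℚ (n ℕ.^ m)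
  w = 1ℚ ℚ.+ error n
  regroup : ∀ i e N x y → i ℚ.* e ℚ.* (N ℚ.* (x ℚ.* y)) ≡ e ℚ.* (i ℚ.* N ℚ.* y ℚ.* x)
  regroup = solve 5 (λ i e N x y → i :* e :* (N :* (x :* y)) := e :* (i :* N :* y :* x)) refl

-- Bounds in terms of n

ℕ→ℚ-𝒰 : ∀ h → ℕ→ℚ (𝒰 h) ≡ ℕ→ℚ h ℚ.* ℕ→ℚ h ℚ.+ ℕ→ℚ h ℚ.+ 1ℚ
ℕ→ℚ-𝒰 h = trans (ℕ→ℚ-+ (h * h + h) 1) (cong (ℚ._+ 1ℚ) (trans (ℕ→ℚ-+ (h * h) h) (cong (ℚ._+ ℕ→ℚ h) (ℕ→ℚ-* h h))))

ℕ→ℚ-𝒜ℬ : ∀ h → ℕ→ℚ (𝒜ℬ h) ≡ Q.𝒜 (ℕ→ℚ h) ℚ.* Q.ℬ (ℕ→ℚ h)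
ℕ→ℚ-𝒜ℬ h = trans (ℕ→ℚ-* (h + 1) (𝒰 h + 2)) (trans (cong₂ ℚ._*_ (ℕ→ℚ-+ h 1)
  (trans (ℕ→ℚ-+ (𝒰 h) 2) (cong (ℚ._+ (1ℚ ℚ.+ 1ℚ)) (ℕ→ℚ-𝒰 h)))) (sym (𝒜ℬ-factors (ℕ→ℚ h))))

ℕ→ℚ-2𝒞 : ∀ h → ½ ℚ.* ℕ→ℚ (2𝒞 h) ≡ Q.𝒞 (ℕ→ℚ h)
ℕ→ℚ-2𝒞 h = trans (cong (½ ℚ.*_) (trans (ℕ→ℚ-+ (𝒰 h * (𝒰 h + 2)) (h + 1)) (cong₂ ℚ._+_
  (trans (ℕ→ℚ-* (𝒰 h) (𝒰 h + 2)) (cong₂ ℚ._*_ (ℕ→ℚ-𝒰 h) (trans (ℕ→ℚ-+ (𝒰 h) 2) (cong (ℚ._+ (1ℚ ℚ.+ 1ℚ)) (ℕ→ℚ-𝒰 h)))))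
  (ℕ→ℚ-+ h 1)))) (sym (𝒞-factors (ℕ→ℚ h)))

ℕ→ℚ-𝒬 : ∀ h → ½ ℚ.* ℕ→ℚ (𝒜ℬ h * 2𝒞 h) ≡ 𝒬ᵠ (ℕ→ℚ h)
ℕ→ℚ-𝒬 h = begin
  ½ ℚ.* ℕ→ℚ (𝒜ℬ h * 2𝒞 h)                ≡⟨ cong (½ ℚ.*_) (ℕ→ℚ-* (𝒜ℬ h) (2𝒞 h)) ⟩
  ½ ℚ.* (ℕ→ℚ (𝒜ℬ h) ℚ.* ℕ→ℚ (2𝒞 h))      ≡⟨ solve 3 (λ i x y → i :* (x :* y) := x :* (i :* y)) refl
                                              ½ (ℕ→ℚ (𝒜ℬ h)) (ℕ→ℚ (2𝒞 h)) ⟩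
  ℕ→ℚ (𝒜ℬ h) ℚ.* (½ ℚ.* ℕ→ℚ (2𝒞 h))      ≡⟨ cong₂ ℚ._*_ (ℕ→ℚ-𝒜ℬ h) (ℕ→ℚ-2𝒞 h) ⟩
  𝒬ᵠ (ℕ→ℚ h)                             ∎
  where
  open ≡-Reasoning

½*ℕ→ℚ[2*m] : ∀ m → ½ ℚ.* ℕ→ℚ (2 * m) ≡ ℕ→ℚ m
½*ℕ→ℚ[2*m] m = trans (cong (½ ℚ.*_) (ℕ→ℚ-* 2 m)) (trans (sym (ℚₚ.*-assoc ½ (ℕ→ℚ 2) (ℕ→ℚ m))) (ℚₚ.*-identityˡ (ℕ→ℚ m)))

-- `𝒞` takes half-integral values, for instance `17 / 2` at 1, so the natural-number inequalities
-- concern doubled quantities and are halved here.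
module _ (m : ℕ) {φ} {M : ℕ} (φh≡ : ½ ℚ.* ℕ→ℚ M ≡ φ) where
  2m≤⇒≤ : 2 * m ≤ M → ℕ→ℚ m ℚ.≤ φ
  2m≤⇒≤ 2m≤M = subst₂ ℚ._≤_ (½*ℕ→ℚ[2*m] m) φh≡ (*-monoˡᵠ ½ (ℚₚ.<⇒≤ (ℚₚ.positive⁻¹ ½)) (ℕ→ℚ-mono-≤ 2m≤M))

  ≤⇒≤2m : φ ℚ.≤ ℕ→ℚ m → M ≤ 2 * m
  ≤⇒≤2m φ≤m = ℕ→ℚ-cancel-≤ (*-cancelˡᵠ ½ (ℚₚ.positive⁻¹ ½) (subst₂ ℚ._≤_ (sym φh≡) (sym (½*ℕ→ℚ[2*m] m)) φ≤m))

  2m≡⇒≡ : 2 * m ≡ M → φ ≡ ℕ→ℚ m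
  2m≡⇒≡ eq = trans (sym φh≡) (trans (cong (λ x → ½ ℚ.* ℕ→ℚ x) (sym eq)) (½*ℕ→ℚ[2*m] m))

*-cancelʳ-≡ᵠ : ∀ {x y} z → 0ℚ ℚ.< z → x ℚ.* z ≡ y ℚ.* z → x ≡ y
*-cancelʳ-≡ᵠ z 0<z eq = ℚₚ.≤-antisym (*-cancelʳᵠ z 0<z (ℚₚ.≤-reflexive eq)) (*-cancelʳᵠ z 0<z (ℚₚ.≤-reflexive (sym eq)))

1/[m*n] : ∀ m n .{{_ : NonZero m}} .{{_ : NonZero n}} .{{_ : NonZero (m * n)}} → + 1 / (m * n) ≡ (+ 1 / m) ℚ.* (+ 1 / n)
1/[m*n] m n = *-cancelʳ-≡ᵠ (ℕ→ℚ (m * n)) (0<ℕ→ℚ (m * n)) (begin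
  (+ 1 / (m * n)) ℚ.* ℕ→ℚ (m * n)                    ≡⟨ /-* 1 (m * n) ⟩
  1ℚ ℚ.* 1ℚ                                          ≡⟨ cong₂ ℚ._*_ (/-* 1 m) (/-* 1 n) ⟨
  (+ 1 / m) ℚ.* ℕ→ℚ m ℚ.* ((+ 1 / n) ℚ.* ℕ→ℚ n)      ≡⟨ *-interchange (+ 1 / m) (ℕ→ℚ m) (+ 1 / n) (ℕ→ℚ n) ⟩
  (+ 1 / m) ℚ.* (+ 1 / n) ℚ.* (ℕ→ℚ m ℚ.* ℕ→ℚ n)      ≡⟨ cong ((+ 1 / m) ℚ.* (+ 1 / n) ℚ.*_) (ℕ→ℚ-* m n) ⟨
  (+ 1 / m) ℚ.* (+ 1 / n) ℚ.* ℕ→ℚ (m * n)            ∎)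
  where open ≡-Reasoning

ℕ→ℚ-quad : ∀ u → ℕ→ℚ ((1 + (u + u)) * (1 + u)) ≡ quad (ℕ→ℚ u)
ℕ→ℚ-quad u = trans (ℕ→ℚ-* (1 + (u + u)) (1 + u)) (cong₂ ℚ._*_
  (trans (ℕ→ℚ-suc (u + u)) (cong (1ℚ ℚ.+_) (ℕ→ℚ-+ u u))) (ℕ→ℚ-suc u))

module _ {a b c h e f g n} (K : Korselt a b c h e f g) (n≡ : n ≡ (a * h + 1) * (b * h + 1) * (c * h + 1)) where
  open Korselt K
  private
    η : ℚ
    η = ℕ→ℚ h

    instance
      h≢0 : NonZero h
      h≢0 = >-nonZero 1≤h
      a≢0 : NonZero a
      a≢0 = >-nonZero 1≤a
      b≢0 : NonZero b
      b≢0 = >-nonZero (≤-<-trans z≤n a<b)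
      c≢0 : NonZero c
      c≢0 = >-nonZero (≤-<-trans z≤n b<c)
      abc≢0 : NonZero (a * b * c)
      abc≢0 = m*n≢0 (a * b) c {{m*n≢0 a b}}

    1≤n : 1 ≤ n
    1≤n = subst (1 ≤_) (sym (trans n≡ (n≡[1+ech][1+ch] K))) (s≤s z≤n)

  quad[ch]≤n : quad (ℕ→ℚ c ℚ.* η) ℚ.≤ ℕ→ℚ n
  quad[ch]≤n = begin
    quad (ℕ→ℚ c ℚ.* η)                  ≡⟨ cong quad (ℕ→ℚ-* c h) ⟨
    quad (ℕ→ℚ u)                        ≡⟨ ℕ→ℚ-quad u ⟨
    ℕ→ℚ ((1 + (u + u)) * (1 + u))       ≡⟨ cong (λ x → ℕ→ℚ ((1 + (u + x)) * (1 + u))) (+-identityʳ u) ⟨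
    ℕ→ℚ ((1 + 2 * u) * (1 + u))         ≤⟨ ℕ→ℚ-mono-≤ (*-monoˡ-≤ (1 + u) (s≤s (*-monoˡ-≤ u 2≤e))) ⟩
    ℕ→ℚ ((1 + e * u) * (1 + u))         ≡⟨ cong ℕ→ℚ (trans n≡ (n≡[1+ech][1+ch] K)) ⟨
    ℕ→ℚ n                               ∎
    where
    open ℚₚ.≤-Reasoning
    u = c * h

  1+abc*h[h²+1]≤n : 1ℚ ℚ.+ ℕ→ℚ (a * b * c) ℚ.* η ℚ.* (η ℚ.* η ℚ.+ 1ℚ) ℚ.≤ ℕ→ℚ n
  1+abc*h[h²+1]≤n = begin
    1ℚ ℚ.+ ℕ→ℚ t ℚ.* η ℚ.* (η ℚ.* η ℚ.+ 1ℚ)    ≡⟨ cong (1ℚ ℚ.+_) (cong₂ ℚ._*_ (ℕ→ℚ-* t h)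
                                                    (trans (ℕ→ℚ-+ (h * h) 1) (cong (ℚ._+ 1ℚ) (ℕ→ℚ-* h h)))) ⟨
    1ℚ ℚ.+ ℕ→ℚ (t * h) ℚ.* ℕ→ℚ (h * h + 1)     ≡⟨ cong (1ℚ ℚ.+_) (ℕ→ℚ-* (t * h) (h * h + 1)) ⟨
    1ℚ ℚ.+ ℕ→ℚ (t * h * (h * h + 1))           ≡⟨ ℕ→ℚ-suc (t * h * (h * h + 1)) ⟨
    ℕ→ℚ (1 + t * h * (h * h + 1))              ≤⟨ ℕ→ℚ-mono-≤ (s≤s (*-monoʳ-≤ (t * h) (+-monoʳ-≤ (h * h) 1≤f))) ⟩
    ℕ→ℚ (1 + t * h * (h * h + f))              ≡⟨ cong ℕ→ℚ (trans n≡ (n≡1+abc*h[h²+f] K)) ⟨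
    ℕ→ℚ n                                      ∎
    where
    open ℚₚ.≤-Reasoning
    t = a * b * c

  -- Both sides are arguments of `quad`, since `quad (c h) ≤ n ≤ 𝒩 z = quad (𝒞 z · z)`, and `quad`
  -- is strictly increasing.
  𝒞-step : ∀ z → 0ℚ ℚ.≤ z → z ℚ.≤ η → ℕ→ℚ n ℚ.≤ Q.𝒩 z → ℕ→ℚ c ℚ.* η ℚ.≤ Q.𝒞 z ℚ.* z
  𝒞-step z 0≤z _ n≤𝒩z = quad-cancel-≤ (0≤𝒞*z 0≤z)
    (ℚₚ.≤-trans quad[ch]≤n (subst (ℕ→ℚ n ℚ.≤_) (𝒩-factors z) n≤𝒩z))

  -- Comparing the two formulas for `n - 1` gives `a b c h (h² + 1) ≤ 𝒬 z · z (z² + 1)`; by `z ≤ h`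
  -- the last factor grows to `h² + 1`, which cancels.
  𝒬-step : ∀ z → 0ℚ ℚ.≤ z → z ℚ.≤ η → ℕ→ℚ n ℚ.≤ Q.𝒩 z → ℕ→ℚ (a * b * c) ℚ.* η ℚ.≤ 𝒬ᵠ z ℚ.* z
  𝒬-step z 0≤z z≤h n≤𝒩z = *-cancelʳᵠ h²+1 (ℚₚ.+-mono-≤-< (0≤* 0≤h 0≤h) (ℚₚ.positive⁻¹ 1ℚ)) (begin
    ℕ→ℚ (a * b * c) ℚ.* η ℚ.* h²+1        ≤⟨ 1+-cancel-≤ (ℚₚ.≤-trans 1+abc*h[h²+1]≤n
                                               (subst (ℕ→ℚ n ℚ.≤_) (𝒩≡1+𝒬*z[z²+1] z) n≤𝒩z)) ⟩
    𝒬ᵠ z ℚ.* z ℚ.* (z ℚ.* z ℚ.+ 1ℚ)       ≤⟨ *-monoˡᵠ (𝒬ᵠ z ℚ.* z) (0≤* (Growth.nonneg growth-𝒬 0≤z) 0≤z)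
                                               (ℚₚ.+-monoˡ-≤ 1ℚ (*-mono-≤ 0≤z 0≤h z≤h z≤h)) ⟩
    𝒬ᵠ z ℚ.* z ℚ.* h²+1                   ∎)
    where
    open ℚₚ.≤-Reasoning
    h²+1 = η ℚ.* η ℚ.+ 1ℚ
    0≤h = 0≤ℕ→ℚ h
    1+-cancel-≤ : ∀ {x y} → 1ℚ ℚ.+ x ℚ.≤ 1ℚ ℚ.+ y → x ℚ.≤ y
    1+-cancel-≤ {x} {y} 1+x≤1+y = subst₂ ℚ._≤_ (eq x) (eq y) (ℚₚ.+-monoʳ-≤ (ℚ.- 1ℚ) 1+x≤1+y)
      where
      eq : ∀ x → ℚ.- 1ℚ ℚ.+ (1ℚ ℚ.+ x) ≡ x
      eq = solve 1 (λ x → con (ℚ.- 1ℚ) :+ (con 1ℚ :+ x) := x) refl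

  extremal⇒n≡𝒩[h] : e ≡ 2 → 2 * c ≡ 2𝒞 h → ℕ→ℚ n ≡ Q.𝒩 η
  extremal⇒n≡𝒩[h] e≡2 2c≡ = begin
    ℕ→ℚ n                                ≡⟨ cong ℕ→ℚ (trans n≡ (n≡[1+ech][1+ch] K)) ⟩
    ℕ→ℚ ((1 + e * u) * (1 + u))          ≡⟨ cong (λ x → ℕ→ℚ ((1 + x * u) * (1 + u))) e≡2 ⟩
    ℕ→ℚ ((1 + 2 * u) * (1 + u))          ≡⟨ cong (λ x → ℕ→ℚ ((1 + (u + x)) * (1 + u))) (+-identityʳ u) ⟩
    ℕ→ℚ ((1 + (u + u)) * (1 + u))        ≡⟨ ℕ→ℚ-quad u ⟩
    quad (ℕ→ℚ u)                         ≡⟨ cong quad (ℕ→ℚ-* c h) ⟩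
    quad (ℕ→ℚ c ℚ.* η)                   ≡⟨ cong (λ x → quad (x ℚ.* η)) (2m≡⇒≡ c (ℕ→ℚ-2𝒞 h) 2c≡) ⟨
    quad (Q.𝒞 η ℚ.* η)                   ≡⟨ 𝒩-factors η ⟨
    Q.𝒩 η                                ∎
    where
    open ≡-Reasoning
    u = c * h

  private
    module I = 𝒩-Inverse n 1≤n
    module 𝒞-Extremum = I.Extremum lifts-𝒞 growth-𝒞 (0<ℕ→ℚ h) (0<ℕ→ℚ c)
      (2m≤⇒≤ c (ℕ→ℚ-2𝒞 h) (2c≤2𝒞 K)) 𝒞-step
    module 𝒬-Extremum = I.Extremum lifts-𝒬 growth-𝒬 (0<ℕ→ℚ h) (0<ℕ→ℚ (a * b * c))
      (2m≤⇒≤ (a * b * c) (ℕ→ℚ-𝒬 h) (2abc≤ K)) 𝒬-step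

  𝒞-bound : ℕ→ℝ c ≤ᴿ 𝒞 (𝒩⁻¹ n)
  𝒞-bound = 𝒞-Extremum.bound

  𝒬-bound : ℕ→ℝ (a * b * c) ≤ᴿ 𝒬 (𝒩⁻¹ n)
  𝒬-bound = 𝒬-Extremum.bound

  𝒞-attained⇔ : ℕ→ℝ c ≃ 𝒞 (𝒩⁻¹ n) ⇔ (e ≡ 2 × f ≡ 1 × g ≡ 1)
  𝒞-attained⇔ = mk⇔
    (λ eq → 2c-tight K (≤-antisym (2c≤2𝒞 K) (≤⇒≤2m c (ℕ→ℚ-2𝒞 h) (𝒞-Extremum.attained⇒ eq))))
    (λ { (e≡2 , f≡1 , g≡1) → let _ , _ , 2c≡ = extremal K e≡2 f≡1 g≡1 in
      𝒞-Extremum.attained⇐ (extremal⇒n≡𝒩[h] e≡2 2c≡) (2m≡⇒≡ c (ℕ→ℚ-2𝒞 h) 2c≡) })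

  𝒬-attained⇔ : ℕ→ℝ (a * b * c) ≃ 𝒬 (𝒩⁻¹ n) ⇔ (e ≡ 2 × f ≡ 1 × g ≡ 1)
  𝒬-attained⇔ = mk⇔
    (λ eq → 2abc-tight K (≤-antisym (2abc≤ K) (≤⇒≤2m (a * b * c) (ℕ→ℚ-𝒬 h) (𝒬-Extremum.attained⇒ eq))))
    (λ { (e≡2 , f≡1 , g≡1) → let a≡ , b≡ , 2c≡ = extremal K e≡2 f≡1 g≡1 in
      𝒬-Extremum.attained⇐ (extremal⇒n≡𝒩[h] e≡2 2c≡)
        (2m≡⇒≡ (a * b * c) (ℕ→ℚ-𝒬 h) (trans (swap a b c) (cong₂ _*_ (cong₂ _*_ a≡ b≡) 2c≡))) })
    where
    swap : ∀ a b c → 2 * (a * b * c) ≡ a * b * (2 * c)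
    swap = solve-∀

  private
    log≤ : ⌊log₂ n ⌋ ≤ 10 * h
    log≤ = subst (λ m → ⌊log₂ m ⌋ ≤ 10 * h) (sym n≡) (⌊log₂n⌋≤10h K)

  𝒞-asymptotic : ℕ→ℝ c ≤ᴿ root 5 (+ 1 / 8) *ᴿ root 5 (ℕ→ℚ (n ^ 2)) *ᴿ (ℚ→ℝ 1ℚ +ᴿ ℚ→ℝ (error n))
  𝒞-asymptotic = asymptotic c h n 4 2 1≤h log≤ (subst (λ m → 8 * (c * h) ^ 5 ≤ m ^ 2 * (h + 16) ^ 5) (sym n≡) (8[ch]^5≤ K))

  𝒬-asymptotic : ℕ→ℝ (a * b * c) ≤ᴿ root 10 (+ 1 / 8) *ᴿ root 10 (ℕ→ℚ (n ^ 7)) *ᴿ (ℚ→ℝ 1ℚ +ᴿ ℚ→ℝ (error n))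
  𝒬-asymptotic = asymptotic (a * b * c) h n 9 7 1≤h log≤
    (subst (λ m → 8 * (a * b * c * h) ^ 10 ≤ m ^ 7 * (h + 16) ^ 10) (sym n≡) (8[abc*h]^10≤ K))

-- The rational definitions of `F` and `G`

f*abc≡ : ∀ {a b c h e f g} → Korselt a b c h e f g → f * (a * b * c) ≡ h * (b * c + a * c + a * b) + (c + b + a)
f*abc≡ {a} {b} {c} {h} {e} {f} {g} K = begin
  f * (a * b * c)                               ≡⟨ expand₁ a b c f ⟩
  a * f * (b * c)                               ≡⟨ cong (_* (b * c)) a*f≡ ⟩
  (h + g) * (b * c)                             ≡⟨ expand₂ b c h g ⟩
  h * (b * c) + c * (g * b)                     ≡⟨ cong (λ x → h * (b * c) + c * x) g*b≡ ⟩
  h * (b * c) + c * (e + a * h + 1)             ≡⟨ expand₃ a b c e h ⟩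
  h * (b * c + a * c) + c + e * c               ≡⟨ cong (λ x → h * (b * c + a * c) + c + x) e*c≡ ⟩
  h * (b * c + a * c) + c + (a * b * h + a + b) ≡⟨ expand₄ a b c h ⟩
  h * (b * c + a * c + a * b) + (c + b + a)     ∎
  where
  open Korselt K
  open ≡-Reasoning
  expand₁ : ∀ a b c f → f * (a * b * c) ≡ a * f * (b * c)
  expand₁ = solve-∀
  expand₂ : ∀ b c h g → (h + g) * (b * c) ≡ h * (b * c) + c * (g * b)
  expand₂ = solve-∀
  expand₃ : ∀ a b c e h → h * (b * c) + c * (e + a * h + 1) ≡ h * (b * c + a * c) + c + e * c
  expand₃ = solve-∀
  expand₄ : ∀ a b c h → h * (b * c + a * c) + c + (a * b * h + a + b) ≡ h * (b * c + a * c + a * b) + (c + b + a)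
  expand₄ = solve-∀

-- The hypothesis divided by `a b c` is the defining formula of `F`.
clear-denominators : ∀ a b c h f .{{_ : NonZero a}} .{{_ : NonZero b}} .{{_ : NonZero c}}
  .{{_ : NonZero (a * b)}} .{{_ : NonZero (a * c)}} .{{_ : NonZero (b * c)}} →
  f * (a * b * c) ≡ h * (b * c + a * c + a * b) + (c + b + a) →
  ℕ→ℚ h ℚ.* (+ 1 / a ℚ.+ + 1 / b ℚ.+ + 1 / c) ℚ.+ + 1 / (a * b) ℚ.+ + 1 / (a * c) ℚ.+ + 1 / (b * c) ≡ ℕ→ℚ f
clear-denominators a b c h f f*abc = *-cancelʳ-≡ᵠ (ℕ→ℚ (a * b * c)) (0<ℕ→ℚ (a * b * c) {{m*n≢0 (a * b) c}}) (begin
  (η ℚ.* (i ℚ.+ j ℚ.+ l) ℚ.+ + 1 / (a * b) ℚ.+ + 1 / (a * c) ℚ.+ + 1 / (b * c)) ℚ.* ℕ→ℚ (a * b * c)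
    ≡⟨ cong₂ ℚ._*_ (cong₂ ℚ._+_ (cong₂ ℚ._+_ (cong (η ℚ.* (i ℚ.+ j ℚ.+ l) ℚ.+_) (1/[m*n] a b)) (1/[m*n] a c)) (1/[m*n] b c))
                   (trans (ℕ→ℚ-* (a * b) c) (cong (ℚ._* z) (ℕ→ℚ-* a b))) ⟩
  (η ℚ.* (i ℚ.+ j ℚ.+ l) ℚ.+ i ℚ.* j ℚ.+ i ℚ.* l ℚ.+ j ℚ.* l) ℚ.* (x ℚ.* y ℚ.* z)
    ≡⟨ expand η i j l x y z ⟩
  over (i ℚ.* x) (j ℚ.* y) (l ℚ.* z)
    ≡⟨ cong₂ (λ s t → over s t (l ℚ.* z)) (/-* 1 a) (/-* 1 b) ⟩
  over 1ℚ 1ℚ (l ℚ.* z)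
    ≡⟨ cong (over 1ℚ 1ℚ) (/-* 1 c) ⟩
  over 1ℚ 1ℚ 1ℚ
    ≡⟨ collect η x y z ⟩
  η ℚ.* (y ℚ.* z ℚ.+ x ℚ.* z ℚ.+ x ℚ.* y) ℚ.+ (z ℚ.+ y ℚ.+ x)
    ≡⟨ cong₂ ℚ._+_ (trans (ℕ→ℚ-* h (b * c + a * c + a * b)) (cong (η ℚ.*_) (trans (ℕ→ℚ-+ (b * c + a * c) (a * b))
         (cong₂ ℚ._+_ (trans (ℕ→ℚ-+ (b * c) (a * c)) (cong₂ ℚ._+_ (ℕ→ℚ-* b c) (ℕ→ℚ-* a c))) (ℕ→ℚ-* a b)))))
       (trans (ℕ→ℚ-+ (c + b) a) (cong (ℚ._+ x) (ℕ→ℚ-+ c b))) ⟨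
  ℕ→ℚ (h * (b * c + a * c + a * b)) ℚ.+ ℕ→ℚ (c + b + a)
    ≡⟨ ℕ→ℚ-+ (h * (b * c + a * c + a * b)) (c + b + a) ⟨
  ℕ→ℚ (h * (b * c + a * c + a * b) + (c + b + a))
    ≡⟨ cong ℕ→ℚ f*abc ⟨
  ℕ→ℚ (f * (a * b * c))
    ≡⟨ ℕ→ℚ-* f (a * b * c) ⟩
  ℕ→ℚ f ℚ.* ℕ→ℚ (a * b * c) ∎)
  where
  open ≡-Reasoning
  η = ℕ→ℚ h
  x = ℕ→ℚ a
  y = ℕ→ℚ b
  z = ℕ→ℚ c
  i = + 1 / a
  j = + 1 / b
  l = + 1 / c
  -- `over` is the cleared expression with the products `i x`, `j y`, `l z` isolated, so that each
  -- can be replaced by 1.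
  over : ℚ → ℚ → ℚ → ℚ
  over r s t = η ℚ.* (r ℚ.* (y ℚ.* z) ℚ.+ s ℚ.* (x ℚ.* z) ℚ.+ t ℚ.* (x ℚ.* y))
    ℚ.+ (r ℚ.* s ℚ.* z ℚ.+ r ℚ.* t ℚ.* y ℚ.+ s ℚ.* t ℚ.* x)
  expand : ∀ h i j l a b c →
    (h ℚ.* (i ℚ.+ j ℚ.+ l) ℚ.+ i ℚ.* j ℚ.+ i ℚ.* l ℚ.+ j ℚ.* l) ℚ.* (a ℚ.* b ℚ.* c)
    ≡ h ℚ.* (i ℚ.* a ℚ.* (b ℚ.* c) ℚ.+ j ℚ.* b ℚ.* (a ℚ.* c) ℚ.+ l ℚ.* c ℚ.* (a ℚ.* b))
      ℚ.+ (i ℚ.* a ℚ.* (j ℚ.* b) ℚ.* c ℚ.+ i ℚ.* a ℚ.* (l ℚ.* c) ℚ.* b ℚ.+ j ℚ.* b ℚ.* (l ℚ.* c) ℚ.* a)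
  expand = solve 7 (λ h i j l a b c →
    (h :* (i :+ j :+ l) :+ i :* j :+ i :* l :+ j :* l) :* (a :* b :* c)
    := h :* (i :* a :* (b :* c) :+ j :* b :* (a :* c) :+ l :* c :* (a :* b))
      :+ (i :* a :* (j :* b) :* c :+ i :* a :* (l :* c) :* b :+ j :* b :* (l :* c) :* a)) refl
  collect : ∀ h a b c →
    h ℚ.* (1ℚ ℚ.* (b ℚ.* c) ℚ.+ 1ℚ ℚ.* (a ℚ.* c) ℚ.+ 1ℚ ℚ.* (a ℚ.* b))
      ℚ.+ (1ℚ ℚ.* 1ℚ ℚ.* c ℚ.+ 1ℚ ℚ.* 1ℚ ℚ.* b ℚ.+ 1ℚ ℚ.* 1ℚ ℚ.* a)
    ≡ h ℚ.* (b ℚ.* c ℚ.+ a ℚ.* c ℚ.+ a ℚ.* b) ℚ.+ (c ℚ.+ b ℚ.+ a)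
  collect = solve 4 (λ h a b c →
    h :* (con 1ℚ :* (b :* c) :+ con 1ℚ :* (a :* c) :+ con 1ℚ :* (a :* b))
      :+ (con 1ℚ :* con 1ℚ :* c :+ con 1ℚ :* con 1ℚ :* b :+ con 1ℚ :* con 1ℚ :* a)
    := h :* (b :* c :+ a :* c :+ a :* b) :+ (c :+ b :+ a)) refl

af-h≡g : ∀ a f g h → a * f ≡ h + g → ℕ→ℚ a ℚ.* ℕ→ℚ f ℚ.- ℕ→ℚ h ≡ ℕ→ℚ g
af-h≡g a f g h a*f≡ = begin
  ℕ→ℚ a ℚ.* ℕ→ℚ f ℚ.- ℕ→ℚ h        ≡⟨ cong (ℚ._- ℕ→ℚ h) (ℕ→ℚ-* a f) ⟨
  ℕ→ℚ (a * f) ℚ.- ℕ→ℚ h            ≡⟨ cong (λ x → ℕ→ℚ x ℚ.- ℕ→ℚ h) a*f≡ ⟩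
  ℕ→ℚ (h + g) ℚ.- ℕ→ℚ h            ≡⟨ cong (ℚ._- ℕ→ℚ h) (ℕ→ℚ-+ h g) ⟩
  ℕ→ℚ h ℚ.+ ℕ→ℚ g ℚ.- ℕ→ℚ h        ≡⟨ solve 2 (λ h g → h :+ g :- h := g) refl (ℕ→ℚ h) (ℕ→ℚ g) ⟩
  ℕ→ℚ g                            ∎
  where open ≡-Reasoning

-- Divisibility

-- Modulo `a h` the first factor is 1, so what remains of `n - 1` is `(b c h + b + c) h`, and `h`
-- cancels.
a*h∣⇒a∣ : ∀ a b c h .{{_ : NonZero h}} → a * h ∣ (a * h + 1) * (b * h + 1) * (c * h + 1) ∸ 1 → a ∣ b * c * h + b + c
a*h∣⇒a∣ a b c h ah∣ = *-cancelʳ-∣ h (∣m+n∣m⇒∣n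
  (subst (λ x → a * h ∣ x ∸ 1) (expand a b c h) ah∣) (m∣m*n ((b * h + 1) * (c * h + 1))))
  where
  expand : ∀ a b c h → (a * h + 1) * (b * h + 1) * (c * h + 1)
    ≡ suc (a * h * ((b * h + 1) * (c * h + 1)) + (b * c * h + b + c) * h)
  expand = solve-∀

module _ (k : K₃N) where
  open K₃N k

  p≡ : p ≡ A * H + 1
  p≡ = trans (sym (m∸n+n≡m (<⇒≤ 1<p))) (cong (_+ 1) (sym A-exact))

  q≡ : q ≡ B * H + 1
  q≡ = trans (sym (m∸n+n≡m (<⇒≤ 1<q))) (cong (_+ 1) (sym B-exact))

  r≡ : r ≡ C * H + 1
  r≡ = trans (sym (m∸n+n≡m (<⇒≤ 1<r))) (cong (_+ 1) (sym C-exact))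

  n≡ : n ≡ (A * H + 1) * (B * H + 1) * (C * H + 1)
  n≡ = cong₂ _*_ (cong₂ _*_ p≡ q≡) r≡

  -- Otherwise `d * H` would be a common divisor of `p - 1`, `q - 1`, `r - 1` larger than their
  -- greatest one.
  common-divisor : ∀ {d} → d ∣ A → d ∣ B → d ∣ C → d ≡ 1
  common-divisor {d} d∣A d∣B d∣C = ∣1⇒≡1 (*-cancelʳ-∣ H (subst (d * H ∣_) (sym (*-identityˡ H))
    (gcd-greatest (gcd-greatest (lift d∣A A-exact) (lift d∣B B-exact)) (lift d∣C C-exact))))
    where
    lift : ∀ {x y} → d ∣ x → x * H ≡ y → d * H ∣ y
    lift d∣x eq = subst (d * H ∣_) eq (*-monoˡ-∣ H d∣x)

  A∣ : A ∣ B * C * H + B + C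
  A∣ = a*h∣⇒a∣ A B C H (subst₂ (λ x y → x ∣ y ∸ 1) (sym A-exact) n≡ p∸1∣n∸1)

  B∣ : B ∣ A * C * H + A + C
  B∣ = a*h∣⇒a∣ B A C H (subst₂ (λ x y → x ∣ y ∸ 1) (sym B-exact)
    (trans n≡ (cong (_* (C * H + 1)) (*-comm (A * H + 1) (B * H + 1)))) q∸1∣n∸1)

  C∣ : C ∣ A * B * H + A + B
  -- Choosing `E` itself as the quotient makes the equation of this divisibility the relation
  -- `E*C≡`.
  C∣ = divides E (*-cancelʳ-≡ _ _ H (begin
    (A * B * H + A + B) * H       ≡⟨ cong pred (expand A B H) ⟩
    (A * H + 1) * (B * H + 1) ∸ 1 ≡⟨ cong (_∸ 1) (cong₂ _*_ p≡ q≡) ⟨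
    p * q ∸ 1                     ≡⟨ E-exact ⟨
    E * (r ∸ 1)                   ≡⟨ cong (E *_) C-exact ⟨
    E * (C * H)                   ≡⟨ *-assoc E C H ⟨
    E * C * H                     ∎))
    where
    open ≡-Reasoning
    expand : ∀ a b h → suc ((a * b * h + a + b) * h) ≡ (a * h + 1) * (b * h + 1)
    expand = solve-∀

  E*C≡ : E * C ≡ A * B * H + A + B
  E*C≡ = sym (_∣_.equality C∣)

  -- A common divisor of `x` and `y` divides `x z H + x`, hence also the remaining summand `z`, so
  -- it divides all three.
  coprime-of-divides : ∀ {x y z} → (∀ {d} → d ∣ x → d ∣ y → d ∣ z → d ≡ 1) → y ∣ x * z * H + x + z → Coprime x y
  coprime-of-divides {x} {y} {z} common y∣ {d} (d∣x , d∣y) = common d∣x d∣y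
    (∣m+n∣m⇒∣n (∣-trans d∣y y∣) (∣m∣n⇒∣m+n (∣m⇒∣m*n H (∣m⇒∣m*n z d∣x)) d∣x))

  A⊥B : Coprime A B
  A⊥B = coprime-of-divides {z = C} common-divisor B∣

  A⊥C : Coprime A C
  A⊥C = coprime-of-divides {z = B} (λ a c b → common-divisor a b c) C∣

  B⊥C : Coprime B C
  B⊥C = coprime-of-divides {z = A} (λ b c a → common-divisor a b c)
    (subst (C ∣_) (swap A B H) C∣)
    where
    swap : ∀ a b h → a * b * h + a + b ≡ b * a * h + b + a
    swap = solve-∀

  -- `C (E + A H + 1)` is a multiple of `B` plus `A C H + A + C`, and `C` is coprime to `B`.
  B∣E+AH+1 : B ∣ E + A * H + 1
  B∣E+AH+1 = coprime-divisor B⊥C (subst (B ∣_) eq (∣m∣n⇒∣m+n (m∣m*n (A * H + 1)) B∣))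
    where
    open ≡-Reasoning
    expand₁ : ∀ a b c h → b * (a * h + 1) + (a * c * h + a + c) ≡ (a * b * h + a + b) + c * (a * h + 1)
    expand₁ = solve-∀
    expand₂ : ∀ a c e h → e * c + c * (a * h + 1) ≡ c * (e + a * h + 1)
    expand₂ = solve-∀
    eq : B * (A * H + 1) + (A * C * H + A + C) ≡ C * (E + A * H + 1)
    eq = trans (expand₁ A B C H) (trans (cong (_+ C * (A * H + 1)) (sym E*C≡)) (expand₂ A C E H))

  Gₙ : ℕ
  Gₙ = quotient B∣E+AH+1

  Gₙ*B≡ : Gₙ * B ≡ E + A * H + 1
  Gₙ*B≡ = sym (_∣_.equality B∣E+AH+1)

  -- `C B (H + Gₙ)` is `B C H + B + C` plus a multiple of `A`, and `A` is coprime to `B` and to `C`.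
  A∣H+Gₙ : A ∣ H + Gₙ
  A∣H+Gₙ = coprime-divisor A⊥B (coprime-divisor A⊥C (subst (A ∣_) eq (∣m∣n⇒∣m+n A∣ (m∣m*n (B * H + 1 + C * H)))))
    where
    expand₁ : ∀ a b c h → b * c * h + b + c + a * (b * h + 1 + c * h) ≡ b * c * h + c * (a * h + 1) + (a * b * h + a + b)
    expand₁ = solve-∀
    expand₂ : ∀ a b c e h → b * c * h + c * (a * h + 1) + e * c ≡ c * (b * h + (e + a * h + 1))
    expand₂ = solve-∀
    expand₃ : ∀ b c g h → c * (b * h + g * b) ≡ c * (b * (h + g))
    expand₃ = solve-∀
    eq : B * C * H + B + C + A * (B * H + 1 + C * H) ≡ C * (B * (H + Gₙ))
    eq = trans (expand₁ A B C H) (trans (cong (λ x → B * C * H + C * (A * H + 1) + x) (sym E*C≡))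
      (trans (expand₂ A B C E H) (trans (cong (λ x → C * (B * H + x)) (sym Gₙ*B≡)) (expand₃ B C Gₙ H))))

  Fₙ : ℕ
  Fₙ = quotient A∣H+Gₙ

  korselt : Korselt A B C H E Fₙ Gₙ
  korselt = record
    { 1≤a = >-nonZero⁻¹ A ; 1≤h = 1≤H
    ; a<b = *-cancelʳ-< H A B (subst₂ _<_ (sym A-exact) (sym B-exact) (∸-monoˡ-< p<q (<⇒≤ 1<p)))
    ; b<c = *-cancelʳ-< H B C (subst₂ _<_ (sym B-exact) (sym C-exact) (∸-monoˡ-< q<r (<⇒≤ 1<q)))
    ; 2≤e = 2≤E ; 1≤f = n≢0⇒n>0 f≢0 ; 1≤g = n≢0⇒n>0 g≢0
    ; e*c≡ = E*C≡ ; g*b≡ = Gₙ*B≡ ; a*f≡ = a*f≡ }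
    where
    1≤H : 1 ≤ H
    1≤H = >-nonZero⁻¹ H
    a*f≡ : A * Fₙ ≡ H + Gₙ
    a*f≡ = trans (*-comm A Fₙ) (sym (_∣_.equality A∣H+Gₙ))
    f≢0 : Fₙ ≢ 0
    f≢0 eq = contradiction (trans (sym a*f≡) (trans (cong (A *_) eq) (*-zeroʳ A))) (m<n⇒n≢0 (≤-trans 1≤H (m≤m+n H Gₙ)))
    g≢0 : Gₙ ≢ 0
    g≢0 eq = contradiction (trans (sym Gₙ*B≡) (cong (_* B) eq)) (m<n⇒n≢0 (m≤n+m 1 (E + A * H)))

  -- Residues of `H` modulo 6

  extremal-H%6≢2 : E ≡ 2 → A ≡ H + 1 → B ≡ 𝒰 H + 2 → H % 6 ≢ 2
  -- If `H` is 2 modulo 3, then 3 divides `A = H + 1` and `B = H² + H + 3`, hence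
  -- `2 C = A B H + A + B` and so `C`, against the absence of a common divisor.
  extremal-H%6≢2 e≡2 a≡ b≡ H%6≡2 = contradiction (common-divisor 3∣A 3∣B 3∣C) λ()
    where
    j = H ℕ./ 6
    H≡ : H ≡ 2 + j * 6
    H≡ = trans (m≡m%n+[m/n]*n H 6) (cong (_+ j * 6) H%6≡2)
    expand₁ : ∀ j → 2 + j * 6 + 1 ≡ (2 * j + 1) * 3
    expand₁ = solve-∀
    expand₂ : ∀ j → (2 + j * 6) * (2 + j * 6) + (2 + j * 6) + 1 + 2 ≡ (12 * j * j + 10 * j + 3) * 3
    expand₂ = solve-∀
    3∣A : 3 ∣ A
    3∣A = divides (2 * j + 1) (trans a≡ (trans (cong (_+ 1) H≡) (expand₁ j)))
    3∣B : 3 ∣ B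
    3∣B = divides (12 * j * j + 10 * j + 3) (trans b≡ (trans (cong (λ h → 𝒰 h + 2) H≡) (expand₂ j)))
    3⊥2 : Coprime 3 2
    3⊥2 = Coprimality.gcd≡1⇒coprime refl
    3∣C : 3 ∣ C
    3∣C = coprime-divisor 3⊥2 (subst (3 ∣_) (trans (sym E*C≡) (cong (_* C) e≡2))
      (∣m∣n⇒∣m+n (∣m∣n⇒∣m+n (∣m⇒∣m*n H (∣m⇒∣m*n B 3∣A)) 3∣A) 3∣B))

  2∣H : 2 ∣ H
  2∣H = gcd-greatest (gcd-greatest (even p 1<p p-odd) (even q 1<q q-odd)) (even r 1<r r-odd)
    where
    2∣m∨2∣1+m : ∀ m → (2 ∣ m) ⊎ (2 ∣ suc m)
    2∣m∨2∣1+m zero          = inj₁ (2 ∣0)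
    2∣m∨2∣1+m (suc zero)    = inj₂ ∣-refl
    2∣m∨2∣1+m (suc (suc m)) with 2∣m∨2∣1+m m
    ... | inj₁ 2∣m  = inj₁ (∣m∣n⇒∣m+n ∣-refl 2∣m)
    ... | inj₂ 2∣1+m = inj₂ (∣m∣n⇒∣m+n ∣-refl 2∣1+m)
    even : ∀ m → 1 < m → 2 ∤ m → 2 ∣ m ∸ 1
    even (suc m) _ 2∤1+m with 2∣m∨2∣1+m m
    ... | inj₁ 2∣m   = 2∣m
    ... | inj₂ 2∣1+m = contradiction 2∣1+m 2∤1+m

  -- Here `p = H² + H + 1`, which 3 divides when `H` is 1 modulo 3, while `p > H ≥ 4` excludes
  -- `p = 3`.
  extremal-prime-H%6≢4 : Prime p → A ≡ H + 1 → H % 6 ≢ 4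
  extremal-prime-H%6≢4 p-prime a≡ H%6≡4 =
    [ (λ ()) , (λ 3≡p → <⇒≢ 3<p 3≡p) ]′ (prime⇒irreducible p-prime (divides w p≡w*3))
    where
    j = H ℕ./ 6
    w = 12 * j * j + 18 * j + 7
    H≡ : H ≡ 4 + j * 6
    H≡ = trans (m≡m%n+[m/n]*n H 6) (cong (_+ j * 6) H%6≡4)
    expand : ∀ j → (4 + j * 6 + 1) * (4 + j * 6) + 1 ≡ (12 * j * j + 18 * j + 7) * 3
    expand = solve-∀
    p≡w*3 : p ≡ w * 3
    p≡w*3 = trans p≡ (trans (cong (λ a → a * H + 1) a≡) (trans (cong (λ h → (h + 1) * h + 1) H≡) (expand j)))
    open ≤-Reasoning
    3<p : 3 < p
    3<p = begin
      4              ≡⟨ H%6≡4 ⟨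
      H % 6          ≤⟨ m%n≤m H 6 ⟩
      H              ≤⟨ m≤n*m H A ⟩
      A * H          ≤⟨ m≤m+n (A * H) 1 ⟩
      A * H + 1      ≡⟨ p≡ ⟨
      p              ∎

  extremal-prime-H%6≡0 : Prime p → E ≡ 2 → A ≡ H + 1 → B ≡ 𝒰 H + 2 → H % 6 ≡ 0
  extremal-prime-H%6≡0 p-prime e≡2 a≡ b≡ = go (H % 6) refl (m%n<n H 6)
    where
    odd : ∀ m → H % 6 ≡ m → 2 ∤ m → ⊥
    odd m eq 2∤m = 2∤m (∣m+n∣m⇒∣n
      (subst (2 ∣_) (trans (m≡m%n+[m/n]*n H 6) (trans (cong (_+ H ℕ./ 6 * 6) eq) (+-comm m (H ℕ./ 6 * 6)))) 2∣H)
      (∣n⇒∣m*n (H ℕ./ 6) (divides 3 refl)))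
    go : ∀ m → H % 6 ≡ m → m < 6 → H % 6 ≡ 0
    go 0 eq _ = eq
    go 1 eq _ = ⊥-elim (odd 1 eq (from-no (2 ∣? 1)))
    go 2 eq _ = contradiction eq (extremal-H%6≢2 e≡2 a≡ b≡)
    go 3 eq _ = ⊥-elim (odd 3 eq (from-no (2 ∣? 3)))
    go 4 eq _ = contradiction eq (extremal-prime-H%6≢4 p-prime a≡)
    go 5 eq _ = ⊥-elim (odd 5 eq (from-no (2 ∣? 5)))
    go (suc (suc (suc (suc (suc (suc _)))))) _ (s≤s (s≤s (s≤s (s≤s (s≤s (s≤s ()))))))

  -- The bounds and their equality cases for a given Korselt number

  F≡ : F ≡ ℕ→ℚ Fₙ
  F≡ = clear-denominators A B C H Fₙ (f*abc≡ korselt)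

  G≡ : G ≡ ℕ→ℚ Gₙ
  G≡ = trans (cong (λ x → ℕ→ℚ A ℚ.* x ℚ.- ℕ→ℚ H) F≡) (af-h≡g A Fₙ Gₙ H (Korselt.a*f≡ korselt))

  Extremal : Set
  Extremal = E ≡ 2 × F ≡ 1ℚ × G ≡ 1ℚ

  extremal⇔ : (E ≡ 2 × Fₙ ≡ 1 × Gₙ ≡ 1) ⇔ Extremal
  extremal⇔ = mk⇔
    (λ { (e≡2 , f≡1 , g≡1) → e≡2 , trans F≡ (cong ℕ→ℚ f≡1) , trans G≡ (cong ℕ→ℚ g≡1) })
    (λ { (e≡2 , F≡1 , G≡1) → e≡2 , ℕ→ℚ-injective (trans (sym F≡) F≡1) , ℕ→ℚ-injective (trans (sym G≡) G≡1) })

  extremal-residue : Extremal → H % 6 ≢ 2 × (IsC₃N k → H % 6 ≡ 0)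
  extremal-residue ext =
    let e≡2 , f≡1 , g≡1 = Equivalence.from extremal⇔ ext
        a≡ , b≡ , _     = extremal korselt e≡2 f≡1 g≡1
    in extremal-H%6≢2 e≡2 a≡ b≡ , λ prime → extremal-prime-H%6≡0 (proj₁ prime) e≡2 a≡ b≡

  bounds : let x = 𝒩⁻¹ n in
      ℕ→ℝ C ≤ᴿ 𝒞 x
    × ℕ→ℝ (A * B * C) ≤ᴿ 𝒬 x
    × (ℕ→ℝ C ≃ 𝒞 x ⇔ Extremal)
    × (ℕ→ℝ (A * B * C) ≃ 𝒬 x ⇔ Extremal)
    × (ℕ→ℝ C ≃ 𝒞 x ⊎ ℕ→ℝ (A * B * C) ≃ 𝒬 x → H % 6 ≢ 2 × (IsC₃N k → H % 6 ≡ 0))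
  bounds = 𝒞-bound korselt n≡ , 𝒬-bound korselt n≡ , 𝒞⇔ , 𝒬⇔ ,
    λ eq → extremal-residue ([ Equivalence.to 𝒞⇔ , Equivalence.to 𝒬⇔ ]′ eq)
    where
    𝒞⇔ = extremal⇔ ⇔-∘ 𝒞-attained⇔ korselt n≡
    𝒬⇔ = extremal⇔ ⇔-∘ 𝒬-attained⇔ korselt n≡

theorem4p10 : (∀ (k : K₃N) → let open K₃N k in let x = 𝒩⁻¹ n in
    ℕ→ℝ C ≤ᴿ 𝒞 x
    × ℕ→ℝ (A * B * C) ≤ᴿ 𝒜 x *ᴿ ℬ x *ᴿ 𝒞 x
    × (ℕ→ℝ C ≃ 𝒞 x ⇔ (E ≡ 2 × F ≡ 1ℚ × G ≡ 1ℚ))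
    × (ℕ→ℝ (A * B * C) ≃ 𝒜 x *ᴿ ℬ x *ᴿ 𝒞 x ⇔ (E ≡ 2 × F ≡ 1ℚ × G ≡ 1ℚ))
    × (ℕ→ℝ C ≃ 𝒞 x ⊎ ℕ→ℝ (A * B * C) ≃ 𝒜 x *ᴿ ℬ x *ᴿ 𝒞 x →
    H % 6 ≢ 2 × (IsC₃N k → H % 6 ≡ 0)))
    × Σ (ℕ → ℝ) (λ δ → Vanishes δ × (∀ (k : K₃N) → let open K₃N k in
    ℕ→ℝ C ≤ᴿ 2 ^^ (- (+ 3) / 5) *ᴿ n ^^ (+ 2 / 5) *ᴿ (ℚ→ℝ 1ℚ +ᴿ δ n)))
    × Σ (ℕ → ℝ) (λ δ → Vanishes δ × (∀ (k : K₃N) → let open K₃N k in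
    ℕ→ℝ (A * B * C) ≤ᴿ 2 ^^ (- (+ 3) / 10) *ᴿ n ^^ (+ 7 / 10) *ᴿ (ℚ→ℝ 1ℚ +ᴿ δ n)))
theorem4p10 = bounds ,
  -- The exponents are in lowest terms, so `2 ^^ (- (+ 3) / 5)` and `n ^^ (+ 2 / 5)` compute to
  -- `root 5 (+ 1 / 8)` and `root 5 (ℕ→ℚ (n ^ 2))`; the tenth roots below arise in the same way.
  ((λ n → ℚ→ℝ (error n)) , error-vanishes , λ k → 𝒞-asymptotic (korselt k) (n≡ k)) ,
  ((λ n → ℚ→ℝ (error n)) , error-vanishes , λ k → 𝒬-asymptotic (korselt k) (n≡ k))
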